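{- Let $G$ be an undirected edge-weighted multigraph with a given tree decomposition $\langle X,T\rangle$, $X=\{X_1,\dots,X_t\}$, of width $w$. Then the graph balancing problem parameterized by the graph treewidth and the maximum degree $r$ is solvable on $G$ in time $O\left(2^{2w\cdot r}\cdot wr\cdot|X|\right)$.
   Context: Graph balancing problem: given an undirected edge-weighted multigraph (loops allowed), orient each edge so that the maximum, over all nodes, of the weighted in-degree (the total weight of edges directed into the node; a loop always counts toward its node) is minimized. Equivalently: nodes are machines, each job $j$ is an edge of weight $p_j$ joining the two machines on which it can be processed (or a loop if there is only one), and one minimizes the makespan. The maximum degree of $G=(V,E)$ is $r=\max_{v\in V}|N(v)|$, where $N(v)$ is the set of edges $e\in E$ of the form $e=vu$ for some $u\in V$. A tree decomposition of $G=(V,E)$ is a pair $\langle X,T\rangle$, where $X=\{X_1,\dots,X_t\}$ is a family of subsets of $V$ (bags) and $T$ is a tree whose nodes are the $X_i$, such that: (1) $\bigcup_i X_i=V$; (2) for every edge $(v,u)$ of $G$ some $X_i$ contains both $v$ and $u$; (3) if $X_i$ and $X_j$ both contain $v$, then all nodes $X_k$ on the unique path in $T$ between $X_i$ and $X_j$ contain $v$. Its width is $\max_i|X_i|-1$; the treewidth of $G$ is the minimum width over all its tree decompositions. -}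

module Defs where

open import Data.Bool using (if_then_else_)
open import Data.Fin using (Fin; toℕ)
open import Data.Fin.Properties using (_≟_)
open import Data.Fin.Subset using (Subset; _∈_; ∣_∣)
open import Data.Fin.Subset.Properties using (_∈?_)
open import Data.List using (List; []; _∷_; _∷ʳ_; map; filter; length; concatMap; allFin)
open import Data.List.Extrema.Nat using (max)
open import Data.List.Membership.Propositional using () renaming (_∈_ to _∈ₗ_)
open import Data.List.Relation.Unary.Unique.Propositional using (Unique)
open import Data.Nat using (ℕ; zero; suc; _+_; _∸_; _≤_; _≡ᵇ_)
open import Data.Nat.ListAction using (sum)
open import Data.Product using (∃; _×_; _,_)
open import Data.Sum using (_⊎_)
open import Relation.Binary.Construct.Closure.ReflexiveTransitive using (Star; ε; _◅_)
open import Relation.Binary.PropositionalEquality using (_≡_; _≢_)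
open import Relation.Nullary using (¬_)
open import Relation.Nullary.Decidable using (_⊎-dec_)

-- Undirected multigraphs: the order of the two ends is an artefact of the
-- representation.  Parallel edges and loops (end₁ e ≡ end₂ e) are allowed.

record Multigraph : Set where
  field
    #V   : ℕ
    #E   : ℕ
    end₁ : Fin #E → Fin #V
    end₂ : Fin #E → Fin #V

  Vertex : Set
  Vertex = Fin #V

  Edge : Set
  Edge = Fin #E

  Joins : Edge → Vertex → Vertex → Set
  Joins e u v = (end₁ e ≡ u × end₂ e ≡ v) ⊎ (end₁ e ≡ v × end₂ e ≡ u)

  incidentEdges : Vertex → List Edge
  incidentEdges v = filter (λ e → (end₁ e ≟ v) ⊎-dec (end₂ e ≟ v)) (allFin #E)

  maxDegree : ℕ
  maxDegree = max 0 (map (λ v → length (incidentEdges v)) (allFin #V))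

  Walk : Vertex → Vertex → Set
  Walk = Star (λ u v → ∃ λ e → Joins e u v)

  edgesOf : ∀ {u v} → Walk u v → List Edge
  edgesOf ε             = []
  edgesOf ((e , _) ◅ π) = e ∷ edgesOf π

  -- All vertices visited, except for the last one.
  sources : ∀ {u v} → Walk u v → List Vertex
  sources ε           = []
  sources {u} (_ ◅ π) = u ∷ sources π

  verticesOf : ∀ {u v} → Walk u v → List Vertex
  verticesOf {v = v} π = sources π ∷ʳ v

  IsPath : ∀ {u v} → Walk u v → Set
  IsPath π = Unique (verticesOf π)

  -- A loop is a cycle of length 1, two parallel edges form one of length 2.
  IsCycle : ∀ {v} → Walk v v → Set
  IsCycle π = edgesOf π ≢ [] × Unique (edgesOf π) × Unique (sources π)

open Multigraph public

record IsTree (T : Multigraph) : Set where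
  field
    root      : Vertex T        -- only says that T is nonempty
    connected : ∀ i j → Walk T i j
    acyclic   : ∀ {i} (π : Walk T i i) → ¬ IsCycle T π

record TreeDecomposition (G : Multigraph) : Set where
  field
    tree         : Multigraph
    isTree       : IsTree tree
    bag          : Vertex tree → Subset (#V G)
    coversVertex : ∀ v → ∃ λ i → v ∈ bag i
    coversEdge   : ∀ e → ∃ λ i → end₁ G e ∈ bag i × end₂ G e ∈ bag i
    -- In a tree, the path π from i to j is unique.
    coherent     : ∀ v {i j} → v ∈ bag i → v ∈ bag j →
                   (π : Walk tree i j) → IsPath tree π →
                   ∀ {k} → k ∈ₗ verticesOf tree π → v ∈ bag k

  #bags : ℕ
  #bags = #V tree

  width : ℕ
  width = max 0 (map (λ i → ∣ bag i ∣) (allFin #bags)) ∸ 1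

open TreeDecomposition public

Weighting : Multigraph → Set
Weighting G = Edge G → ℕ

record Orientation (G : Multigraph) : Set where
  field
    head       : Edge G → Vertex G
    head-valid : ∀ e → head e ≡ end₁ G e ⊎ head e ≡ end₂ G e

open Orientation public

module _ {G : Multigraph} (p : Weighting G) where

  weightedInDegree : Orientation G → Vertex G → ℕ
  weightedInDegree o v = sum (map p (filter (λ e → head o e ≟ v) (allFin (#E G))))

  makespan : Orientation G → ℕ
  makespan o = max 0 (map (weightedInDegree o) (allFin (#V G)))

  Optimal : Orientation G → Set
  Optimal o = ∀ o′ → makespan o ≤ makespan o′

-- Programs for a random access machine under the uniform cost measure.  It
-- has scalar registers and arrays of registers (both named by numbers; a
-- program mentions only finitely many names), all holding natural numbers.
-- The operations are those of the Cook–Reckhow RAM: constants, addition,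
-- (truncated) subtraction, indirect load and store, and tests against zero;
-- jumps are structured into conditionals and while loops.  Multiplication is
-- deliberately not a unit-cost operation.

Name : Set
Name = ℕ

data Expr : Set where
  lit  : ℕ → Expr
  var  : Name → Expr
  _⊕_  : Expr → Expr → Expr
  _⊖_  : Expr → Expr → Expr
  _[_] : Name → Expr → Expr

data Program : Set where
  skip          : Program
  _≔_           : Name → Expr → Program
  _[_]≔_        : Name → Expr → Expr → Program
  _⨟_           : Program → Program → Program
  if′_then_else_ : Expr → Program → Program → Program
  while_loop_   : Expr → Program → Program

infixl 6 _⊕_ _⊖_
infix  4 _≔_ _[_]≔_
infixr 3 _⨟_

record State : Set where
  constructor state
  field
    scalar : Name → ℕ
    array  : Name → ℕ → ℕ

open State public

eval : State → Expr → ℕ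
eval σ (lit n)   = n
eval σ (var x)   = scalar σ x
eval σ (d ⊕ e)   = eval σ d + eval σ e
eval σ (d ⊖ e)   = eval σ d ∸ eval σ e
eval σ (a [ e ]) = array σ a (eval σ e)

cost : Expr → ℕ
cost (lit _)   = 1
cost (var _)   = 1
cost (d ⊕ e)   = 1 + cost d + cost e
cost (d ⊖ e)   = 1 + cost d + cost e
cost (_ [ e ]) = 1 + cost e

update : ∀ {A : Set} → (ℕ → A) → ℕ → A → (ℕ → A)
update f i x j = if i ≡ᵇ j then x else f j

setScalar : State → Name → ℕ → State
setScalar (state s a) x n = state (update s x n) a

setCell : State → Name → ℕ → ℕ → State
setCell (state s a) b i n = state s (update a b (update (a b) i n))

-- ⟨ P , σ ⟩⇓ τ after t : started in σ, P halts in τ after exactly t steps.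
data ⟨_,_⟩⇓_after_ : Program → State → State → ℕ → Set where
  ⇓skip  : ∀ {σ} → ⟨ skip , σ ⟩⇓ σ after 1
  ⇓set   : ∀ {σ x e} →
           ⟨ x ≔ e , σ ⟩⇓ setScalar σ x (eval σ e) after (1 + cost e)
  ⇓store : ∀ {σ a d e} →
           ⟨ a [ d ]≔ e , σ ⟩⇓ setCell σ a (eval σ d) (eval σ e)
             after (1 + cost d + cost e)
  ⇓seq   : ∀ {P Q σ τ υ s t} →
           ⟨ P , σ ⟩⇓ τ after s → ⟨ Q , τ ⟩⇓ υ after t →
           ⟨ P ⨟ Q , σ ⟩⇓ υ after (s + t)
  ⇓then  : ∀ {e P Q σ τ t} → eval σ e ≢ 0 → ⟨ P , σ ⟩⇓ τ after t →
           ⟨ if′ e then P else Q , σ ⟩⇓ τ after (1 + cost e + t)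
  ⇓else  : ∀ {e P Q σ τ t} → eval σ e ≡ 0 → ⟨ Q , σ ⟩⇓ τ after t →
           ⟨ if′ e then P else Q , σ ⟩⇓ τ after (1 + cost e + t)
  ⇓stop  : ∀ {e P σ} → eval σ e ≡ 0 →
           ⟨ while e loop P , σ ⟩⇓ σ after (1 + cost e)
  ⇓loop  : ∀ {e P σ τ υ s t} → eval σ e ≢ 0 →
           ⟨ P , σ ⟩⇓ τ after s → ⟨ while e loop P , τ ⟩⇓ υ after t →
           ⟨ while e loop P , σ ⟩⇓ υ after (1 + cost e + s + t)

cells : List ℕ → ℕ → ℕ
cells []       _       = 0
cells (x ∷ _)  zero    = x
cells (_ ∷ xs) (suc i) = cells xs i

members : ∀ {n} → Subset n → List (Fin n)
members {n} S = filter (_∈? S) (allFin n)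

module _ (G : Multigraph) (p : Weighting G) (D : TreeDecomposition G) where

  private
    T = tree D

  inputScalar : Name → ℕ
  inputScalar 0 = #V G
  inputScalar 1 = #E G
  inputScalar 2 = #V T
  inputScalar 3 = #E T
  inputScalar _ = 0

  -- The bags are stored one after the other in array 6; array 5 has
  -- their sizes.
  inputArray : Name → List ℕ
  inputArray 0 = map (λ e → toℕ (end₁ G e)) (allFin (#E G))
  inputArray 1 = map (λ e → toℕ (end₂ G e)) (allFin (#E G))
  inputArray 2 = map p (allFin (#E G))
  inputArray 3 = map (λ e → toℕ (end₁ T e)) (allFin (#E T))
  inputArray 4 = map (λ e → toℕ (end₂ T e)) (allFin (#E T))
  inputArray 5 = map (λ i → ∣ bag D i ∣) (allFin (#V T))
  inputArray 6 = concatMap (λ i → map toℕ (members (bag D i))) (allFin (#V T))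
  inputArray _ = []

  input : State
  input = state inputScalar (λ a → cells (inputArray a))

outputArray : Name
outputArray = 7

Represents : ∀ {G} → State → Orientation G → Set
Represents {G} σ o = ∀ e → array σ outputArray (toℕ e) ≡ toℕ (head o e)

-- On the given instance, P halts within b steps and its output is an
-- orientation of minimum makespan.
SolvesWithin : Program → (G : Multigraph) → Weighting G → TreeDecomposition G → ℕ → Set
SolvesWithin P G p D b =
  ∃ λ σ → ∃ λ t → ⟨ P , input G p D ⟩⇓ σ after t × t ≤ b ×
  ∃ λ (o : Orientation G) → Optimal p o × Represents σ o

-- Orient the edges touching a bag in all possible ways: a bag has at most w + 1 vertices, hence at most
-- (w + 1) r ≤ 2 w r such edges, and the bags touched by a fixed edge form a subtree.  Every vertex v lies in some
-- bag, whose orientation determines the load of v, so the makespan is the maximum over all bags of the peak load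
-- that the bag sees; edges at other bags that are left out only make loads smaller.
--
-- Breadth-first search roots the tree.  In reverse search order, every bag c sends to its parent p, for every
-- orientation of the edges shared by c and p, the least cost over the orientations at c that extend it, where the
-- cost is the maximum of the peak load at c and the messages received.  This cannot exceed the makespan of any
-- orientation of the whole graph that extends it.  Conversely, going down from the root, each bag can be given an
-- orientation that attains the message sent to its parent; it agrees with all choices made before, because an edge
-- at c and at an earlier bag is also at p.  The resulting orientation has the cost of the root as its makespan.
--
-- An orientation of k edges is a number below 2 ^ k.  Running through all of them with a binary counter and
-- recomputing their codes and loads from scratch takes O(2 ^ k · k) steps, and this happens three times per bag.

module Submission where

open import Data.Bool using (Bool; true; false; if_then_else_; _∨_; _∧_; not; T)
open import Data.Empty using (⊥-elim)
open import Data.Fin as Fin using (Fin; toℕ; fromℕ<)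
import Data.Fin.Properties as Finₚ
open import Data.Fin.Subset using (Subset; ∣_∣) renaming (_∈_ to _∈ˢ_)
open import Data.Fin.Subset.Properties using () renaming (_∈?_ to _∈ˢ?_)
open import Data.List using (List; []; _∷_; _∷ʳ_; _++_; map; filter; length; upTo; allFin; tabulate; concat; concatMap; foldl)
open import Data.List.Extrema.Nat using (max; xs≤max; max≤v⁺)
open import Data.List.Membership.Propositional using (_∈_; _∉_)
open import Data.List.Membership.Propositional.Properties
open import Data.List.Properties hiding (sum-++)
open import Data.List.Relation.Unary.All as All using (All; []; _∷_)
import Data.List.Relation.Unary.All.Properties as Allₚ
open import Data.List.Relation.Unary.AllPairs using ([]; _∷_)
open import Data.List.Relation.Unary.Any using (here; there)
open import Data.List.Relation.Unary.Unique.Propositional using (Unique)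
import Data.List.Relation.Unary.Unique.Propositional.Properties as Uniqueₚ
open import Data.Nat
open import Data.Nat.DivMod using ([m+kn]%n≡m%n; m<n⇒m%n≡m)
open import Data.Nat.Induction using (<-wellFounded)
open import Data.Nat.ListAction using (sum)
open import Data.Nat.ListAction.Properties using (sum-++)
open import Data.Nat.Properties
open import Data.List.Membership.DecPropositional _≟_ using (_∈?_)
open import Data.Nat.Tactic.RingSolver using (solve-∀)
open import Data.Product using (∃; _×_; _,_; proj₁; proj₂)
open import Data.Sum using (_⊎_; inj₁; inj₂; [_,_]′)
open import Data.Unit using (tt)
open import Data.Vec using ([]; _∷_)
open import Function using (_∘_; id; case_of_)
open import Induction.WellFounded using (Acc; acc)
open import Relation.Binary.Construct.Closure.ReflexiveTransitive using (ε; _◅_; _◅◅_)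
open import Relation.Binary.Definitions using (tri<; tri≈; tri>)
open import Relation.Binary.PropositionalEquality hiding ([_]; J)
open import Relation.Nullary using (¬_; Dec; yes; no; does)
open import Relation.Nullary.Decidable using (_⊎-dec_)
open import Defs

-- Total correctness with time bounds for RAM programs

-- The factor `2 ^ (2 * w * r)` leaves room for one enumeration at a time, not for pairs of
-- orientations of a bag and its parent. Hence a tree edge is served by two separate enumerations,
-- `sweep` at the bag and `push` at the parent, which meet in a message table indexed by the part of
-- the code that both bags see. Optimality is proved without minima over orientations. Table entries
-- stay below every bound `B` that some global choice respects (`LowerBound`), and every message has
-- a witness (`Attained`); the two facts meet at the root. Multiplication is not a unit-cost
-- operation, so all table addresses are built by repeated addition. Clearing the loads of all
-- vertices for each orientation would be too slow: the loads move to fresh cells, and the bit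
-- counter returns to zero by overflow. Work linear in the size of the input fits because `#E G` is
-- at most `K` times the number of bags and because the tree, being acyclic, has no more edges than
-- nodes; the search that yields the second fact is the one the program itself performs.

writesScalar : Program → Name → Bool
writesScalar skip                     x = false
writesScalar (y ≔ _)                  x = y ≡ᵇ x
writesScalar (_ [ _ ]≔ _)             x = false
writesScalar (P ⨟ Q)                  x = writesScalar P x ∨ writesScalar Q x
writesScalar (if′ _ then P else Q)    x = writesScalar P x ∨ writesScalar Q x
writesScalar (while _ loop P)         x = writesScalar P x

writesArray : Program → Name → Bool
writesArray skip                     a = false
writesArray (_ ≔ _)                  a = false
writesArray (b [ _ ]≔ _)             a = b ≡ᵇ a
writesArray (P ⨟ Q)                  a = writesArray P a ∨ writesArray Q a
writesArray (if′ _ then P else Q)    a = writesArray P a ∨ writesArray Q a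
writesArray (while _ loop P)         a = writesArray P a

-- A frame condition decided by computation: for a concrete program and name the implicit argument
-- reduces to the unit type and is found by unification, so that `scalars s $x` alone is a proof.
record Same (P : Program) (σ τ : State) : Set where
  constructor same
  field
    scalars : ∀ x {_ : T (not (writesScalar P x))} → scalar τ x ≡ scalar σ x
    arrays  : ∀ a {_ : T (not (writesArray P a))} → array τ a ≡ array σ a

open Same

same-refl : ∀ {P σ} → Same P σ σ
same-refl = same (λ _ → refl) (λ _ → refl)

same-trans : ∀ {P σ τ υ} → Same P σ τ → Same P τ υ → Same P σ υ
same-trans s t = same (λ x {w} → trans (scalars t x {w}) (scalars s x {w}))
                      (λ a {w} → trans (arrays t a {w}) (arrays s a {w}))

∨-falseˡ : ∀ {b c} → T (not (b ∨ c)) → T (not b)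
∨-falseˡ {false} _ = tt

∨-falseʳ : ∀ b {c} → T (not (b ∨ c)) → T (not c)
∨-falseʳ false w = w

same-⨟ˡ : ∀ {P Q σ τ} → Same P σ τ → Same (P ⨟ Q) σ τ
same-⨟ˡ s = same (λ x {w} → scalars s x {∨-falseˡ w}) (λ a {w} → arrays s a {∨-falseˡ w})

same-⨟ʳ : ∀ {P Q σ τ} → Same Q σ τ → Same (P ⨟ Q) σ τ
same-⨟ʳ {P} s = same (λ x {w} → scalars s x {∨-falseʳ (writesScalar P x) w})
                     (λ a {w} → arrays s a {∨-falseʳ (writesArray P a) w})

infixl 5 _▹_

_▹_ : ∀ {P Q σ τ υ} → Same P σ τ → Same Q τ υ → Same (P ⨟ Q) σ υ
_▹_ {P} {Q} s t = same-trans (same-⨟ˡ s) (same-⨟ʳ {P} t)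

exec-same : ∀ {P σ τ t} → ⟨ P , σ ⟩⇓ τ after t → Same P σ τ
exec-same ⇓skip = same-refl
exec-same {x ≔ e} {σ} ⇓set = same change (λ _ → refl)
  where
  change : ∀ y {_ : T (not (x ≡ᵇ y))} → update (scalar σ) x (eval σ e) y ≡ scalar σ y
  change y {w} with x ≡ᵇ y
  ... | false = refl
exec-same {a [ d ]≔ e} {σ} ⇓store = same (λ _ → refl) change
  where
  change : ∀ b {_ : T (not (a ≡ᵇ b))} →
           update (array σ) a (update (array σ a) (eval σ d) (eval σ e)) b ≡ array σ b
  change b {w} with a ≡ᵇ b
  ... | false = refl
exec-same (⇓seq {P} {Q} p q) = exec-same p ▹ exec-same q
exec-same (⇓then {P = P} {Q} _ p) =
  same (λ x {w} → scalars (exec-same p) x {∨-falseˡ w}) (λ a {w} → arrays (exec-same p) a {∨-falseˡ w})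
exec-same (⇓else {P = P} {Q} _ q) =
  same (λ x {w} → scalars (exec-same q) x {∨-falseʳ (writesScalar P x) w})
       (λ a {w} → arrays (exec-same q) a {∨-falseʳ (writesArray P a) w})
exec-same (⇓stop _) = same-refl
exec-same {while e loop P} (⇓loop _ p q) =
  same (λ x {w} → trans (scalars (exec-same q) x {w}) (scalars (exec-same p) x {w}))
       (λ a {w} → trans (arrays (exec-same q) a {w}) (arrays (exec-same p) a {w}))

∧-trueˡ : ∀ {b c} → T (b ∧ c) → T b
∧-trueˡ {true} _ = tt

∧-trueʳ : ∀ b {c} → T (b ∧ c) → T c
∧-trueʳ true w = w

-- Collects many frame conditions in one boolean, so that a lemma about an unknown program can ask
-- for all of them in a single implicit argument.
spares : Program → List Name → List Name → Bool
spares P (x ∷ xs) as       = not (writesScalar P x) ∧ spares P xs as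
spares P []       (a ∷ as) = not (writesArray P a) ∧ spares P [] as
spares P []       []       = true

kept : ∀ {P σ τ} xs as → Same P σ τ → T (spares P xs as) →
       All (λ x → scalar τ x ≡ scalar σ x) xs × All (λ a → array τ a ≡ array σ a) as
kept {P} (x ∷ xs) as s w = let ss , aa = kept xs as s (∧-trueʳ (not (writesScalar P x)) w) in
                           scalars s x {∧-trueˡ w} ∷ ss , aa
kept {P} [] (a ∷ as)   s w = let ss , aa = kept [] as s (∧-trueʳ (not (writesArray P a)) w) in
                           ss , arrays s a {∧-trueˡ w} ∷ aa
kept     [] []         s w = [] , []

-- A Hoare triple for total correctness with a time budget. The initial state is fixed rather than
-- constrained by a precondition, so `Q` can refer to its values directly.
record Run (P : Program) (σ : State) (b : ℕ) (Q : State → Set) : Set where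
  constructor run
  field
    {final} : State
    {time}  : ℕ
    exec    : ⟨ P , σ ⟩⇓ final after time
    fast    : time ≤ b
    post    : Q final

open Run

weaken : ∀ {P σ b b′} {Q Q′ : State → Set} → b ≤ b′ → Run P σ b Q → (∀ {τ} → Same P σ τ → Q τ → Q′ τ) → Run P σ b′ Q′
weaken b≤b′ (run e f q) i = run e (≤-trans f b≤b′) (i (exec-same e) q)

slower : ∀ {P σ b b′ Q} → b ≤ b′ → Run P σ b Q → Run P σ b′ Q
slower b≤b′ r = weaken b≤b′ r (λ _ q → q)

infixr 3 _then-run_

-- The continuation receives the frame of `P` besides its postcondition, so postconditions need not
-- list what stays unchanged.
_then-run_ : ∀ {P P′ σ b b′} {Q Q′ : State → Set} → Run P σ b Q →
             (∀ {τ} → Same P σ τ → Q τ → Run P′ τ b′ Q′) → Run (P ⨟ P′) σ (b + b′) Q′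
run e f q then-run k with k (exec-same e) q
... | run e′ f′ q′ = run (⇓seq e e′) (+-mono-≤ f f′) q′

-- The budgets of the branches are added rather than compared: this loses at most a constant factor
-- and keeps maxima out of the time bounds.
run-if : ∀ {e P P′ σ b b′} {Q : State → Set} →
         (eval σ e ≢ 0 → Run P σ b Q) → (eval σ e ≡ 0 → Run P′ σ b′ Q) →
         Run (if′ e then P else P′) σ (1 + cost e + (b + b′)) Q
run-if {e} {σ = σ} {b} {b′} p p′ with eval σ e ≟ 0
... | yes z with p′ z
...   | run x f q = run (⇓else z x) (+-monoʳ-≤ (1 + cost e) (≤-trans f (m≤n+m b′ b))) q
run-if {e} {σ = σ} {b} {b′} p p′ | no nz with p nz
...   | run x f q = run (⇓then nz x) (+-monoʳ-≤ (1 + cost e) (≤-trans f (m≤m+n b b′))) q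

straight : Program → Bool
straight skip          = true
straight (_ ≔ _)       = true
straight (_ [ _ ]≔ _)  = true
straight (P ⨟ Q)       = straight P ∧ straight Q
straight _             = false

effect : Program → State → State
effect (x ≔ e)      σ = setScalar σ x (eval σ e)
effect (a [ d ]≔ e) σ = setCell σ a (eval σ d) (eval σ e)
effect (P ⨟ Q)      σ = effect Q (effect P σ)
effect _            σ = σ

steps : Program → ℕ
steps skip         = 1
steps (x ≔ e)      = 1 + cost e
steps (a [ d ]≔ e) = 1 + cost d + cost e
steps (P ⨟ Q)      = steps P + steps Q
steps _            = 0

-- Straight-line code is run by evaluation: `effect` computes the final state, and once the code is
-- concrete many postconditions hold by reflexivity.
straight-exec : ∀ P {_ : T (straight P)} σ → ⟨ P , σ ⟩⇓ effect P σ after steps P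
straight-exec skip         σ = ⇓skip
straight-exec (_ ≔ _)      σ = ⇓set
straight-exec (_ [ _ ]≔ _) σ = ⇓store
straight-exec (P ⨟ Q) {w}  σ = ⇓seq (straight-exec P {∧-trueˡ w} σ) (straight-exec Q {∧-trueʳ (straight P) w} _)

run-straight : ∀ {P σ} {Q : State → Set} {_ : T (straight P)} → Q (effect P σ) → Run P σ (steps P) Q
run-straight {P} {σ} {_} {w} q = run (straight-exec P {w} σ) ≤-refl q

straight-then : ∀ {P P′ σ b} {Q : State → Set} {_ : T (straight P)} →
                (Same P σ (effect P σ) → Run P′ (effect P σ) b Q) → Run (P ⨟ P′) σ (steps P + b) Q
straight-then {P} {P′} {σ} {b} {Q} {w} k with k (exec-same (straight-exec P {w} σ))
... | run e f q = run (⇓seq (straight-exec P {w} σ) e) (+-monoʳ-≤ (steps P) f) q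

-- I n σ may assume that n units of time are left, so the budget also serves as the termination measure.
run-while : ∀ {e P σ₀} {Q : State → Set} (I : ℕ → State → Set) →
  (∀ {n σ} → Same P σ₀ σ → I n σ →
     (eval σ e ≡ 0 × Q σ × suc (cost e) ≤ n) ⊎
     (eval σ e ≢ 0 × ∃ λ b → Run P σ b (λ τ → ∃ λ n′ → I n′ τ × suc (cost e) + b + n′ ≤ n))) →
  ∀ {n} → I n σ₀ → Run (while e loop P) σ₀ n Q
run-while {e} {P} {σ₀} {Q} I step {n} i = go (<-wellFounded n) same-refl i
  where
  go : ∀ {n σ} → Acc _<_ n → Same P σ₀ σ → I n σ → Run (while e loop P) σ n Q
  go {n} {σ} (acc rec) s i with step s i
  ... | inj₁ (z , q , f) = run (⇓stop z) f q
  ... | inj₂ (nz , b , run x f (n′ , i′ , le))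
      with go (rec (≤-trans (s≤s (m≤n+m n′ (cost e + b))) le)) (same-trans s (exec-same x)) i′
  ...   | run y g q = run (⇓loop nz x y) (≤-trans (+-mono-≤ (+-monoʳ-≤ (suc (cost e)) f) g) le) q

-- The invariant is indexed by the rounds still to come; `run-while` is applied with the budget that
-- pays for exactly these rounds and the last test.
run-loop : ∀ {e P σ₀ d} (I : ℕ → State → Set) →
  (∀ {σ} → Same P σ₀ σ → I 0 σ → eval σ e ≡ 0) →
  (∀ {n σ} → Same P σ₀ σ → I (suc n) σ → eval σ e ≢ 0 × Run P σ d (I n)) →
  ∀ {n} → I n σ₀ → Run (while e loop P) σ₀ (suc (cost e) + n * (suc (cost e) + d)) (I 0)
run-loop {e} {P} {σ₀} {d} I stop step {n} i =
  run-while {Q = I 0} I′ step′ (n , i , refl)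
  where
  c = suc (cost e)
  I′ : ℕ → State → Set
  I′ b σ = ∃ λ n → I n σ × b ≡ c + n * (c + d)
  step′ : ∀ {b σ} → Same P σ₀ σ → I′ b σ → _
  step′ s (zero , i , eq)  = inj₁ (stop s i , i , ≤-reflexive (trans (sym (+-identityʳ c)) (sym eq)))
  step′ {b} s (suc n , i , eq) with step s i
  ... | nz , r = inj₂ (nz , d , weaken ≤-refl r λ _ j → _ , (n , j , refl) , ≤-reflexive (trans (eq₁ c d (n * (c + d))) (sym eq)))
    where
    eq₁ : ∀ c d x → c + d + (c + x) ≡ c + (c + d + x)
    eq₁ = solve-∀

run-upto : ∀ {limit x B σ₀ n d} (I : ℕ → State → Set) →
  (∀ {σ} → Same B σ₀ σ → eval σ limit ≡ n) →
  (∀ {k σ} → k < n → Same B σ₀ σ → scalar σ x ≡ k → I k σ → Run B σ d (λ τ → scalar τ x ≡ suc k × I (suc k) τ)) →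
  scalar σ₀ x ≡ 0 → I 0 σ₀ →
  let c = 3 + cost limit in Run (while limit ⊖ var x loop B) σ₀ (c + n * (c + d)) (I n)
run-upto {limit} {x} {B} {σ₀} {n} {d} I limit≡ step x≡0 i₀ =
  weaken (≤-reflexive (cong (λ c → c + n * (c + d)) (guard (cost limit))))
    (run-loop I′ stop body {n} (0 , x≡0 , refl , i₀))
    λ _ (k , _ , k+0≡n , i) → subst (λ k → I k _) (trans (sym (+-identityʳ k)) k+0≡n) i
  where
  guard : ∀ c → 2 + (c + 1) ≡ 3 + c
  guard = solve-∀
  I′ : ℕ → State → Set
  I′ l σ = ∃ λ k → scalar σ x ≡ k × k + l ≡ n × I k σ
  stop : ∀ {σ} → Same B σ₀ σ → I′ 0 σ → eval σ limit ∸ scalar σ x ≡ 0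
  stop s (k , x≡ , k+0≡n , _) = trans (cong₂ _∸_ (limit≡ s) x≡) (m≤n⇒m∸n≡0 (≤-reflexive (trans (sym k+0≡n) (+-identityʳ k))))
  body : ∀ {l σ} → Same B σ₀ σ → I′ (suc l) σ → eval σ limit ∸ scalar σ x ≢ 0 × Run B σ d (I′ l)
  body {l} s (k , x≡ , k+l≡n , i) =
    (λ z → <⇒≱ k<n (m∸n≡0⇒m≤n (trans (sym (cong₂ _∸_ (limit≡ s) x≡)) z))) ,
    weaken ≤-refl (step k<n s x≡ i) λ _ (x≡′ , i′) → suc k , x≡′ , trans (sym (+-suc k l)) k+l≡n , i′
    where
    k<n : k < n
    k<n = ≤-trans (≤-trans (s≤s (m≤m+n k l)) (≤-reflexive (sym (+-suc k l)))) (≤-reflexive k+l≡n)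

-- Registers and arrays

-- The tables %adj, %row, %in, %cost and %msg are two-dimensional: entry x of row i is at address i + S · x, where
-- the stride S = N + #v + 1 exceeds every row number.  Bag N is an additional empty bag, the parent of the root.

$V $E $N $M $S $q $e $u $x $y $h $t $i $j $ptr $lo $k $c $p $r $a $b $d $carry $go $z $n $v : Name
$V = 0
$E = 1
$N = 2
$M = 3
$S = 4
$q = 5
$e = 6
$u = 7
$x = 8
$y = 9
$h = 10
$t = 11
$i = 12
$j = 13
$ptr = 14
$lo = 15
$k = 16
$c = 17
$p = 18
$r = 19
$a = 20
$b = 21
$d = 22
$carry = 23
$go = 24
$z = 25
$n = 26
$v = 27

%end₁ %end₂ %weight %tree₁ %tree₂ %size %bag %adj %off %queue %pos %parent %mul %row %in %cost %msg %bit %fixed %load : Name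
%end₁ = 0
%end₂ = 1
%weight = 2
%tree₁ = 3
%tree₂ = 4
%size = 5
%bag = 6
%adj = 8
%off = 9
%queue = 10
%pos = 11
%parent = 12
%mul = 13
%row = 14
%in = 15
%cost = 16
%msg = 17
%bit = 18
%fixed = 19
%load = 20

at≡ : ∀ {A B : ℕ → ℕ} {i j} → A ≡ B → i ≡ j → A i ≡ B j
at≡ refl refl = refl

≡ᵇ-refl : ∀ i → (i ≡ᵇ i) ≡ true
≡ᵇ-refl zero    = refl
≡ᵇ-refl (suc i) = ≡ᵇ-refl i

≢⇒≡ᵇ-false : ∀ {i j} → i ≢ j → (i ≡ᵇ j) ≡ false
≢⇒≡ᵇ-false {zero}  {zero}  i≢j = ⊥-elim (i≢j refl)
≢⇒≡ᵇ-false {zero}  {suc j} _   = refl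
≢⇒≡ᵇ-false {suc i} {zero}  _   = refl
≢⇒≡ᵇ-false {suc i} {suc j} i≢j = ≢⇒≡ᵇ-false (i≢j ∘ cong suc)

module _ {A : Set} where

  update-eq : ∀ (f : ℕ → A) i {j} x → i ≡ j → update f i x j ≡ x
  update-eq f i x refl rewrite ≡ᵇ-refl i = refl

  update-neq : ∀ (f : ℕ → A) {i} {j} x → i ≢ j → update f i x j ≡ f j
  update-neq f x i≢j rewrite ≢⇒≡ᵇ-false i≢j = refl

cells-∷ʳ-last : ∀ xs x → cells (xs ∷ʳ x) (length xs) ≡ x
cells-∷ʳ-last []       x = refl
cells-∷ʳ-last (_ ∷ xs) x = cells-∷ʳ-last xs x

cells-∷ʳ-other : ∀ xs x {j} → length xs ≢ j → cells (xs ∷ʳ x) j ≡ cells xs j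
cells-∷ʳ-other []       x {zero}  n = ⊥-elim (n refl)
cells-∷ʳ-other []       x {suc j} n = refl
cells-∷ʳ-other (_ ∷ xs) x {zero}  n = refl
cells-∷ʳ-other (_ ∷ xs) x {suc j} n = cells-∷ʳ-other xs x (n ∘ cong suc)

length-∷ʳ : ∀ {A : Set} (xs : List A) x → length (xs ∷ʳ x) ≡ suc (length xs)
length-∷ʳ []       x = refl
length-∷ʳ (_ ∷ xs) x = cong suc (length-∷ʳ xs x)

-- Row A S u xs: the cells u, u + S, u + 2S, … hold the elements of xs, each raised by one, followed by zeros.
Row : (ℕ → ℕ) → ℕ → ℕ → List ℕ → Set
Row A S u xs = ∀ j → A (u + S * j) ≡ cells (map suc xs) j

Rows : (ℕ → ℕ) → ℕ → (ℕ → List ℕ) → Set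
Rows A S R = ∀ u → u < S → Row A S u (R u)

-- The row is the remainder of the address modulo the stride; cancelling it leaves the column.
address-injective : ∀ {S u u′ j j′} → u < S → u′ < S → u + S * j ≡ u′ + S * j′ → u ≡ u′ × j ≡ j′
address-injective {suc S} {u} {u′} {j} {j′} u< u′< eq = u≡ , j≡
  where
  u≡ : u ≡ u′
  u≡ = begin
    u                          ≡⟨ m<n⇒m%n≡m u< ⟨
    u % suc S                  ≡⟨ [m+kn]%n≡m%n u j (suc S) ⟨
    (u + j * suc S) % suc S    ≡⟨ cong (λ x → (u + x) % suc S) (*-comm j (suc S)) ⟩
    (u + suc S * j) % suc S    ≡⟨ cong (_% suc S) eq ⟩
    (u′ + suc S * j′) % suc S  ≡⟨ cong (λ x → (u′ + x) % suc S) (*-comm (suc S) j′) ⟩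
    (u′ + j′ * suc S) % suc S  ≡⟨ [m+kn]%n≡m%n u′ j′ (suc S) ⟩
    u′ % suc S                 ≡⟨ m<n⇒m%n≡m u′< ⟩
    u′                         ∎
    where open ≡-Reasoning
  j≡ : j ≡ j′
  j≡ = *-cancelˡ-≡ j j′ (suc S) (+-cancelˡ-≡ u _ _ (trans eq (cong (_+ suc S * j′) (sym u≡))))

row-append : ∀ {A S R u} x → Rows A S R → u < S →
             Rows (update A (u + S * length (R u)) (suc x)) S (update R u (R u ∷ʳ x))
row-append {A} {S} {R} {u} x rows u<S v v<S j with u ≟ v
... | no u≢v rewrite ≢⇒≡ᵇ-false u≢v =
  trans (update-neq A _ (u≢v ∘ proj₁ ∘ address-injective u<S v<S)) (rows v v<S j)
... | yes refl rewrite ≡ᵇ-refl u | map-++ suc (R u) (x ∷ []) with length (R u) ≟ j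
...   | yes refl = trans (update-eq A (u + S * length (R u)) _ refl)
                         (sym (trans (cong (cells (map suc (R u) ∷ʳ suc x)) (sym (length-map suc (R u))))
                                     (cells-∷ʳ-last (map suc (R u)) (suc x))))
...   | no l≢j   = trans (update-neq A _ (l≢j ∘ proj₂ ∘ address-injective u<S u<S))
                         (trans (rows u u<S j) (sym (cells-∷ʳ-other (map suc (R u)) (suc x) (l≢j ∘ trans (sym (length-map suc (R u)))))))

-- The zero after the raised entries ends the loop, so it needs no stored row length; moving by the
-- stride avoids multiplication.
forRow : Name → Expr → Program → Program
forRow A r B = $q ≔ r ⨟ (while A [ var $q ] loop (B ⨟ $q ≔ var $q ⊕ var $S))

rowTime : ℕ → ℕ → ℕ → ℕ
rowTime c n d = 4 + c + n * (7 + d)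

-- `J` is indexed by the entries visited so far. Since `$q` moves after each round, `J` must be
-- insensitive to it, which is `stable`.
run-row : ∀ {A r B σ₀ d S u xs} (J : List ℕ → State → Set)
  {_ : T (not (writesArray B A))} {_ : T (not (writesScalar B $q))} {_ : T (not (writesScalar (forRow A r B) $S))} →
  scalar σ₀ $S ≡ S → eval σ₀ r ≡ u → Row (array σ₀ A) S u xs →
  (∀ {ts σ} v → J ts σ → J ts (setScalar σ $q v)) →
  (∀ {ts x rs σ} → xs ≡ ts ++ x ∷ rs → Same (forRow A r B) σ₀ σ → array σ A (scalar σ $q) ≡ suc x → J ts σ →
     Run B σ d (J (ts ∷ʳ x))) →
  J [] σ₀ → Run (forRow A r B) σ₀ (rowTime (cost r) (length xs) d) (J xs)
run-row {A} {r} {B} {σ₀} {d} {S} {u} {xs} J {wA} {wq} {wS} stride start row stable step j₀ =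
  slower (≤-reflexive (time-eq (cost r) (length xs) d))
   (straight-then λ s₁ →
     weaken ≤-refl
       (run-loop I (λ _ → stop) (λ s → body (same-trans (same-⨟ˡ {Q = while A [ var $q ] loop (B ⨟ $q ≔ var $q ⊕ var $S)} s₁) (same-⨟ʳ {$q ≔ r} (same (λ x {w} → scalars s x {w}) (λ a {w} → arrays s a {w})))))
         {length xs} ([] , xs , refl , refl , trans start (sym (trans (cong (u +_) (*-zeroʳ S)) (+-identityʳ u))) , refl , stable _ j₀))
       λ _ (ts , rs , eq , len , _ , _ , j) → subst (λ l → J l _) (sym (trans eq (nil ts rs len))) j)
  where
  time-eq : ∀ c n d → 1 + c + (3 + n * (3 + (d + 4))) ≡ 4 + c + n * (7 + d)
  time-eq = solve-∀
  nil : ∀ ts rs → 0 ≡ length rs → ts ++ rs ≡ ts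
  nil ts [] refl = ++-identityʳ ts
  I : ℕ → State → Set
  I n σ = ∃ λ ts → ∃ λ rs → xs ≡ ts ++ rs × n ≡ length rs × scalar σ $q ≡ u + S * length ts ×
          array σ A ≡ array σ₀ A × J ts σ
  at-q : ∀ {n σ} → ((ts , rs , _) : I n σ) → array σ A (scalar σ $q) ≡ cells (map suc rs) 0
  at-q {n} {σ} (ts , rs , refl , len , q≡ , A≡ , j) = begin
    array σ A (scalar σ $q)             ≡⟨ at≡ A≡ q≡ ⟩
    array σ₀ A (u + S * length ts)      ≡⟨ row (length ts) ⟩
    cells (map suc (ts ++ rs)) (length ts)  ≡⟨ drop-prefix ts ⟩
    cells (map suc rs) 0                ∎
    where
    open ≡-Reasoning
    drop-prefix : ∀ ts → cells (map suc (ts ++ rs)) (length ts) ≡ cells (map suc rs) 0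
    drop-prefix []       = refl
    drop-prefix (_ ∷ ts) = drop-prefix ts
  stop : ∀ {σ} → I 0 σ → array σ A (scalar σ $q) ≡ 0
  stop i@(ts , [] , _) = at-q i
  body : ∀ {n σ} → Same (forRow A r B) σ₀ σ → I (suc n) σ →
         array σ A (scalar σ $q) ≢ 0 × Run (B ⨟ $q ≔ var $q ⊕ var $S) σ (d + 4) (I n)
  body {n} {σ} s i@(ts , x ∷ rs , eq , len , q≡ , A≡ , j) =
    (λ z → case trans (sym z) (at-q i) of λ ()) ,
    (step eq s (at-q i) j then-run λ {τ} sB j′ → run-straight
      (ts ∷ʳ x , rs , trans eq (sym (++-assoc ts (x ∷ []) rs)) , suc-injective len ,
       trans (cong₂ _+_ (trans (scalars sB $q {wq}) q≡)
                        (trans (scalars sB $S {∨-falseˡ wS}) (trans (scalars s $S {wS}) stride)))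
             (trans (next u S (length ts)) (cong (λ l → u + S * l) (sym (length-∷ʳ ts x)))) ,
       trans (arrays sB A {wA}) A≡ , stable _ j′))
    where
    next : ∀ u S l → u + S * l + S ≡ u + S * suc l
    next = solve-∀

-- Orientations of finitely many edges, their codes and loads

bit : Bool → ℕ
bit b = if b then 1 else 0

-- A choice selects an end of every edge: false stands for the first one, true for the second.
Choice : Set
Choice = ℕ → Bool

Agree : List ℕ → Choice → Choice → Set
Agree es α β = ∀ {e} → e ∈ es → α e ≡ β e

-- A binary numeral with the least significant bit at the head of the list, the end from which
-- `propagate` carries.
code : List ℕ → Choice → ℕ
code []       α = 0
code (e ∷ es) α = bit (α e) + 2 * code es α

code-cong : ∀ es {α β} → Agree es α β → code es α ≡ code es β
code-cong []       _  = refl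
code-cong (e ∷ es) eq = cong₂ (λ a c → bit a + 2 * c) (eq (here refl)) (code-cong es (eq ∘ there))

odd-or-even : ∀ a b m n → bit a + 2 * m ≡ bit b + 2 * n → a ≡ b × m ≡ n
odd-or-even false false m n eq = refl , *-cancelˡ-≡ m n 2 eq
odd-or-even true  true  m n eq = refl , *-cancelˡ-≡ m n 2 (suc-injective eq)
odd-or-even false true  m n eq = ⊥-elim (even≢odd m n eq)
odd-or-even true  false m n eq = ⊥-elim (even≢odd n m (sym eq))

code-injective : ∀ es {α β} → code es α ≡ code es β → Agree es α β
code-injective (x ∷ es) {α} {β} eq (here refl) = proj₁ (odd-or-even (α x) (β x) (code es α) (code es β) eq)
code-injective (x ∷ es) {α} {β} eq (there e∈)  = code-injective es (proj₂ (odd-or-even (α x) (β x) (code es α) (code es β) eq)) e∈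

code-bound : ∀ es α → code es α < 2 ^ length es
code-bound []       α = s≤s z≤n
code-bound (e ∷ es) α = begin-strict
  bit (α e) + 2 * code es α  <⟨ +-monoˡ-< (2 * code es α) (bit< (α e)) ⟩
  2 + 2 * code es α          ≡⟨ *-suc 2 (code es α) ⟨
  2 * suc (code es α)        ≤⟨ *-monoʳ-≤ 2 (code-bound es α) ⟩
  2 * 2 ^ length es          ∎
  where
  open ≤-Reasoning
  bit< : ∀ b → bit b < 2
  bit< false = s≤s z≤n
  bit< true  = s≤s (s≤s z≤n)

code-none : ∀ es → code es (λ _ → false) ≡ 0
code-none []       = refl
code-none (_ ∷ es) = cong (2 *_) (code-none es)

-- `encode` reads the row from the front, and the bit that it meets after `es` has place value
-- `2 ^ length es`.
code-∷ʳ : ∀ es e α → code (es ∷ʳ e) α ≡ code es α + 2 ^ length es * bit (α e)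
code-∷ʳ []       e α = refl₁ (bit (α e))
  where
  refl₁ : ∀ b → b + 2 * 0 ≡ 0 + 1 * b
  refl₁ = solve-∀
code-∷ʳ (x ∷ es) e α = trans (cong (λ c → bit (α x) + 2 * c) (code-∷ʳ es e α))
                             (distr (bit (α x)) (code es α) (2 ^ length es) (bit (α e)))
  where
  distr : ∀ a c p b → a + 2 * (c + p * b) ≡ a + 2 * c + 2 * p * b
  distr = solve-∀

unique-middle : ∀ ts {x rs} → Unique {A = ℕ} (ts ++ x ∷ rs) → x ∉ ts × x ∉ rs
unique-middle []       (fresh ∷ _)  = (λ ()) , λ x∈ → All.lookup fresh x∈ refl
unique-middle (t ∷ ts) {x} (fresh ∷ u) with unique-middle ts u
... | x∉ts , x∉rs = (λ { (here refl) → All.lookup fresh (∈-++⁺ʳ ts (here refl)) refl ; (there x∈) → x∉ts x∈ }) , x∉rs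

-- Changing one bit changes the code by its place value; uniqueness guarantees that no other
-- position reads the same edge. The terms are arranged so that nothing is subtracted.
code-update : ∀ ts {x rs} α b → Unique (ts ++ x ∷ rs) →
              code (ts ++ x ∷ rs) (update α x b) + 2 ^ length ts * bit (α x) ≡
              code (ts ++ x ∷ rs) α + 2 ^ length ts * bit b
code-update [] {x} {rs} α b u rewrite ≡ᵇ-refl x =
  trans (cong (λ c → bit b + 2 * c + 1 * bit (α x)) (code-cong rs {update α x b} {α} λ {e} e∈ → update-neq α {x} {e} b λ { refl → proj₂ (unique-middle [] u) e∈ }))
        (swap (bit b) (bit (α x)) (code rs α))
  where
  swap : ∀ a b c → a + 2 * c + 1 * b ≡ b + 2 * c + 1 * a
  swap = solve-∀
code-update (t ∷ ts) {x} {rs} α b u@(_ ∷ u′)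
  rewrite ≢⇒≡ᵇ-false {x} {t} (λ { refl → proj₁ (unique-middle (t ∷ ts) u) (here refl) }) =
  double (bit (α t)) _ (2 ^ length ts) (bit (α x)) _ (bit b) (code-update ts α b u′)
  where
  double : ∀ t c p a c′ b → c + p * a ≡ c′ + p * b → t + 2 * c + 2 * p * a ≡ t + 2 * c′ + 2 * p * b
  double t c p a c′ b eq = trans (out t c p a) (trans (cong (λ z → t + 2 * z) eq) (sym (out t c′ p b)))
    where
    out : ∀ t c p a → t + 2 * c + 2 * p * a ≡ t + 2 * (c + p * a)
    out = solve-∀

module Loads (first second weight : ℕ → ℕ) (#v : ℕ) where

  target : Choice → ℕ → ℕ
  target α e = if α e then second e else first e

  load : List ℕ → Choice → ℕ → ℕ
  load []       α v = 0
  load (e ∷ es) α v = (if target α e ≡ᵇ v then weight e else 0) + load es α v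

  load-∷ʳ : ∀ es e α v → load (es ∷ʳ e) α v ≡ load es α v + (if target α e ≡ᵇ v then weight e else 0)
  load-∷ʳ []       e α v = +-identityʳ _
  load-∷ʳ (x ∷ es) e α v = trans (cong (_ +_) (load-∷ʳ es e α v)) (sym (+-assoc (if target α x ≡ᵇ v then weight x else 0) (load es α v) (if target α e ≡ᵇ v then weight e else 0)))

  load-cong : ∀ es {α β} → Agree es α β → ∀ v → load es α v ≡ load es β v
  load-cong []       _  v = refl
  load-cong (e ∷ es) eq v = cong₂ _+_ (cong (λ b → if (if b then second e else first e) ≡ᵇ v then weight e else 0) (eq (here refl)))
                                      (load-cong es (eq ∘ there) v)

  peak : List ℕ → Choice → ℕ
  peak es α = max 0 (map (load es α) (upTo #v))

  load≤peak : ∀ es α {v} → v < #v → load es α v ≤ peak es α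
  load≤peak es α v< = All.lookup (xs≤max 0 _) (∈-map⁺ (load es α) (∈-upTo⁺ v<))

  peak-least : ∀ es α {B} → (∀ v → v < #v → load es α v ≤ B) → peak es α ≤ B
  peak-least es α below = max≤v⁺ z≤n (Allₚ.map⁺ (All.tabulate λ v∈ → below _ (∈-upTo⁻ v∈)))

  peak-cong : ∀ es {α β} → Agree es α β → peak es α ≡ peak es β
  peak-cong es eq = cong (max 0) (map-cong (load-cong es eq) (upTo #v))

-- Enumerating the orientations of the edges in a row

-- Cells are raised by one like the entries of rows, so that a row entry is itself the index of its
-- bit.
Holds : (ℕ → ℕ) → Choice → Set
Holds A α = ∀ e → A (suc e) ≡ bit (α e)

none : Choice
none _ = false

holds-update : ∀ {A α} x b → Holds A α → Holds (update A (suc x) (bit b)) (update α x b)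
holds-update x b h e with x ≡ᵇ e
... | true  = refl
... | false = h e

bit≢0 : ∀ {b n} → n ≡ bit b → n ≢ 0 → b ≡ true
bit≢0 {true}  _  _  = refl
bit≢0 {false} n≡ nz = ⊥-elim (nz n≡)

bit≡0 : ∀ {b n} → n ≡ bit b → n ≡ 0 → b ≡ false
bit≡0 {false} _  _ = refl
bit≡0 {true}  n≡ z = case trans (sym n≡) z of λ ()

-- `$y` runs through `S`, `2 * S`, `4 * S` and so on, so `$a` ends as the address of a table entry,
-- `r` plus `S` times the code, without any multiplication.
encode : Expr → Expr → Program
encode r test =
  $a ≔ r ⨟
  $y ≔ var $S ⨟
  forRow %row (var $a)
    ((if′ test then $a ≔ var $a ⊕ var $y else skip) ⨟
     $y ≔ var $y ⊕ var $y)

encodeTime : Expr → Expr → ℕ → ℕ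
encodeTime r test n = 1 + cost r + (2 + rowTime 1 n (1 + cost test + 5 + 4))

-- The choice `β` need not be stored in an array: it only has to be what `test` evaluates to, so the
-- lemma serves full codes and masked keys alike.
run-encode : ∀ {r test σ₀ S i es} β → scalar σ₀ $S ≡ S → eval σ₀ r ≡ i → Row (array σ₀ %row) S i es →
  (∀ {e σ} → e ∈ es → Same (encode r test) σ₀ σ → array σ %row (scalar σ $q) ≡ suc e → eval σ test ≡ bit (β e)) →
  Run (encode r test) σ₀ (encodeTime r test (length es)) (λ τ → scalar τ $a ≡ i + S * code es β)
run-encode {r} {test} {σ₀} {S} {i} {es} β stride start row tests =
  straight-then λ s₁ →
  straight-then λ s₂ →
  weaken ≤-refl
    (run-row J stride start row (λ _ j → j)
      (λ {_} {_} {_} {σ} eq s → body {σ = σ} eq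
         (same-trans (same-⨟ˡ {Q = $y ≔ var $S ⨟ loop} s₁) (same-⨟ʳ {$a ≔ r} (same-trans (same-⨟ˡ {Q = loop} s₂) (same-⨟ʳ {$y ≔ var $S} s)))))
      (trans stride (sym (*-identityʳ S)) , trans start (sym (trans (cong (i +_) (*-zeroʳ S)) (+-identityʳ i)))))
    λ _ → proj₂
  where
  loop = forRow %row (var $a) ((if′ test then $a ≔ var $a ⊕ var $y else skip) ⨟ $y ≔ var $y ⊕ var $y)
  J : List ℕ → State → Set
  J ts σ = scalar σ $y ≡ S * 2 ^ length ts × scalar σ $a ≡ i + S * code ts β
  doubled : ∀ S p → S * p + S * p ≡ S * (2 * p)
  doubled = solve-∀
  added : ∀ i S c p b → i + S * c + S * p * b ≡ i + S * (c + p * b)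
  added = solve-∀
  body : ∀ {ts x rs σ} → es ≡ ts ++ x ∷ rs → Same (encode r test) σ₀ σ → array σ %row (scalar σ $q) ≡ suc x → J ts σ →
         Run ((if′ test then $a ≔ var $a ⊕ var $y else skip) ⨟ $y ≔ var $y ⊕ var $y) σ (1 + cost test + 5 + 4) (J (ts ∷ʳ x))
  body {ts} {x} {rs} {σ} refl s at (y≡ , a≡) =
    run-if {Q = λ τ → scalar τ $a ≡ i + S * code (ts ∷ʳ x) β}
      (λ nz → run-straight (grow true (bit≢0 test≡ nz)))
      (λ z  → run-straight (trans (sym (+-identityʳ _)) (trans (cong (scalar σ $a +_) (sym (*-zeroʳ (scalar σ $y)))) (grow false (bit≡0 test≡ z)))))
    then-run λ s a′≡ → run-straight
      (trans (cong₂ _+_ (trans (scalars s $y) y≡) (trans (scalars s $y) y≡))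
             (trans (doubled S (2 ^ length ts)) (cong (λ l → S * 2 ^ l) (sym (length-∷ʳ ts x)))) , a′≡)
    where
    test≡ : eval σ test ≡ bit (β x)
    test≡ = tests (∈-++⁺ʳ ts (here refl)) s at
    grow : ∀ b → β x ≡ b → scalar σ $a + (if b then scalar σ $y else scalar σ $y * 0) ≡ i + S * code (ts ∷ʳ x) β
    grow b refl = begin
      scalar σ $a + (if β x then scalar σ $y else scalar σ $y * 0)  ≡⟨ cong (scalar σ $a +_) (times (β x)) ⟩
      scalar σ $a + scalar σ $y * bit (β x)                         ≡⟨ cong₂ (λ a y → a + y * bit (β x)) a≡ y≡ ⟩
      i + S * code ts β + S * 2 ^ length ts * bit (β x)             ≡⟨ added i S (code ts β) (2 ^ length ts) (bit (β x)) ⟩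
      i + S * (code ts β + 2 ^ length ts * bit (β x))               ≡⟨ cong (λ c → i + S * c) (code-∷ʳ ts x β) ⟨
      i + S * code (ts ∷ʳ x) β                                      ∎
      where
      open ≡-Reasoning
      times : ∀ b → (if b then scalar σ $y else scalar σ $y * 0) ≡ scalar σ $y * bit b
      times true  = sym (*-identityʳ _)
      times false = refl

-- The scan goes on after the carry has settled; the other work for an orientation is linear in the
-- row anyway.
propagate : Program
propagate =
  forRow %row (var $r)
    (if′ var $carry
     then (if′ %bit [ %row [ var $q ] ]
           then %bit [ %row [ var $q ] ]≔ lit 0
           else (%bit [ %row [ var $q ] ]≔ lit 1 ⨟ $carry ≔ lit 0))
     else skip)

increment : Program
increment = $carry ≔ lit 1 ⨟ propagate ⨟ $go ≔ lit 1 ⊖ var $carry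

incrementTime : ℕ → ℕ
incrementTime n = 2 + (rowTime 1 n 17 + 4)

-- With no bits set outside the row, overflow leaves the whole bit array zero, ready for the
-- enumeration of another row.
Off : List ℕ → Choice → Set
Off es α = ∀ e → e ∉ es → α e ≡ false

Next : List ℕ → ℕ → State → Set
Next es s τ =
  (scalar τ $go ≡ 1 × ∃ λ β → Holds (array τ %bit) β × Off es β × code es β ≡ suc s) ⊎
  (scalar τ $go ≡ 0 × Holds (array τ %bit) none × suc s ≡ 2 ^ length es)

run-increment : ∀ {σ₀ S i es α} → scalar σ₀ $S ≡ S → scalar σ₀ $r ≡ i → Row (array σ₀ %row) S i es → Unique es →
  Holds (array σ₀ %bit) α → Off es α →
  Run increment σ₀ (incrementTime (length es)) (Next es (code es α))
run-increment {σ₀} {S} {i} {es} {α} stride r≡ row unique bits off =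
  straight-then λ _ →
  run-row J stride r≡ row (λ _ j → j) (λ {_} {_} {_} {σ} eq s at → step {σ = σ} eq at)
    (α , true , refl , bits , off , +-comm (code es α) 1) then-run λ {σ} _ j → run-straight (end {σ} j)
  where
  -- A pending carry counts as `2 ^ length ts`, the place value of the next bit; counted in this
  -- way, the number is already one higher.
  J : List ℕ → State → Set
  J ts σ = ∃ λ β → ∃ λ κ → scalar σ $carry ≡ bit κ × Holds (array σ %bit) β × Off es β ×
           code es β + 2 ^ length ts * bit κ ≡ suc (code es α)
  off-update : ∀ {β x} b → x ∈ es → Off es β → Off es (update β x b)
  off-update {β} {x} b x∈ off′ e e∉ = trans (update-neq β {x} {e} b λ { refl → e∉ x∈ }) (off′ e e∉)
  step : ∀ {ts x rs σ} → es ≡ ts ++ x ∷ rs → array σ %row (scalar σ $q) ≡ suc x → J ts σ →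
         Run _ σ 17 (J (ts ∷ʳ x))
  step {ts} {x} {rs} {σ} refl at (β , κ , carry≡ , h , off′ , sum≡) =
    run-if
      (λ nz → run-if
         (λ b≢0 → run-straight (carried nz b≢0))
         (λ b≡0 → run-straight (settled nz b≡0)))
      (λ z → run-straight (idle z))
    where
    x∈ : x ∈ ts ++ x ∷ rs
    x∈ = ∈-++⁺ʳ ts (here refl)
    bit≡ : array σ %bit (array σ %row (scalar σ $q)) ≡ bit (β x)
    bit≡ = trans (cong (array σ %bit) at) (h x)
    updated : ∀ b → Holds (update (array σ %bit) (array σ %row (scalar σ $q)) (bit b)) (update β x b)
    updated b rewrite at = holds-update {array σ %bit} x b h
    carried : scalar σ $carry ≢ 0 → array σ %bit (array σ %row (scalar σ $q)) ≢ 0 → _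
    carried nz b≢0 = update β x false , true , trans carry≡ (cong bit (bit≢0 carry≡ nz)) , updated false , off-update false x∈ off′ , (begin
      c′ + 2 ^ length (ts ∷ʳ x) * 1              ≡⟨ cong (λ l → c′ + 2 ^ l * 1) (length-∷ʳ ts x) ⟩
      c′ + 2 * P * 1                             ≡⟨ split c′ P ⟩
      (c′ + P * 1) + P * 1                       ≡⟨ cong (λ b → c′ + P * bit b + P * 1) (bit≢0 bit≡ b≢0) ⟨
      (c′ + P * bit (β x)) + P * 1               ≡⟨ cong (_+ P * 1) (code-update ts β false unique) ⟩
      code es β + P * 0 + P * 1                  ≡⟨ cong (_+ P * 1) (trans (cong (code es β +_) (*-zeroʳ P)) (+-identityʳ _)) ⟩
      code es β + P * 1                          ≡⟨ cong (λ b → code es β + P * bit b) (bit≢0 carry≡ nz) ⟨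
      code es β + P * bit κ                      ≡⟨ sum≡ ⟩
      suc (code es α)                            ∎)
      where
      open ≡-Reasoning
      P = 2 ^ length ts
      c′ = code es (update β x false)
      split : ∀ c p → c + 2 * p * 1 ≡ c + p * 1 + p * 1
      split = solve-∀
    settled : scalar σ $carry ≢ 0 → array σ %bit (array σ %row (scalar σ $q)) ≡ 0 → _
    settled nz b≡0 = update β x true , false , refl , updated true , off-update true x∈ off′ , (begin
      c′ + 2 ^ length (ts ∷ʳ x) * 0   ≡⟨ cong (c′ +_) (*-zeroʳ (2 ^ length (ts ∷ʳ x))) ⟩
      c′ + 0                          ≡⟨ cong (c′ +_) (*-zeroʳ P) ⟨
      c′ + P * 0                      ≡⟨ cong (λ b → c′ + P * bit b) (bit≡0 bit≡ b≡0) ⟨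
      c′ + P * bit (β x)              ≡⟨ code-update ts β true unique ⟩
      code es β + P * 1               ≡⟨ cong (λ b → code es β + P * bit b) (bit≢0 carry≡ nz) ⟨
      code es β + P * bit κ           ≡⟨ sum≡ ⟩
      suc (code es α)                 ∎)
      where
      open ≡-Reasoning
      P = 2 ^ length ts
      c′ = code es (update β x true)
    idle : scalar σ $carry ≡ 0 → J (ts ∷ʳ x) σ
    idle z = β , false , z , h , off′ , trans (cong (code es β +_) (trans (*-zeroʳ (2 ^ length (ts ∷ʳ x))) (sym (*-zeroʳ (2 ^ length ts)))))
                                             (trans (cong (λ b → code es β + 2 ^ length ts * bit b) (sym (bit≡0 carry≡ z))) sum≡)
  end : ∀ {σ} → J es σ → Next es (code es α) (setScalar σ $go (1 ∸ scalar σ $carry))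
  end (β , false , carry≡ , h , off′ , sum≡) =
    inj₁ (cong (1 ∸_) carry≡ , β , h , off′ , trans (sym (trans (cong (code es β +_) (*-zeroʳ (2 ^ length es))) (+-identityʳ _))) sum≡)
  end {σ} (β , true , carry≡ , h , off′ , sum≡) =
    inj₂ (cong (1 ∸_) carry≡ , all-zero , trans (sym sum≡) (trans (cong (_+ 2 ^ length es * 1) code≡0) (*-identityʳ _)))
    where
    -- A carry out of the row is worth `2 ^ length es`, while the old code plus one is at most that;
    -- so nothing is left in the row.
    code≡0 : code es β ≡ 0
    code≡0 = n≤0⇒n≡0 (+-cancelʳ-≤ (2 ^ length es * 1) (code es β) 0
      (≤-trans (≤-reflexive sum≡) (≤-trans (code-bound es α) (≤-reflexive (sym (*-identityʳ _))))))
    all-zero : Holds (array σ %bit) none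
    all-zero e with e ∈? es
    ... | yes e∈ = trans (h e) (cong bit (code-injective es {β} {none} (trans code≡0 (sym (code-none es))) e∈))
    ... | no e∉  = trans (h e) (cong bit (off′ e e∉))

enumerate : Program → Program
enumerate B = $go ≔ lit 1 ⨟ (while var $go loop (B ⨟ increment))

enumerateTime : ℕ → ℕ → ℕ
enumerateTime n d = 2 + (2 + 2 ^ n * (2 + (d + incrementTime n)))

-- `J` is indexed by the number of codes handled, which come in increasing order. The counter is
-- back at zero in the end, so enumerations can follow each other without clearing.
run-enumerate : ∀ {B σ₀ S i es d} (J : ℕ → State → Set)
  {_ : T (not (writesArray B %bit))} {_ : T (not (writesArray (enumerate B) %row))}
  {_ : T (not (writesScalar (enumerate B) $r))} {_ : T (not (writesScalar (enumerate B) $S))} →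
  scalar σ₀ $S ≡ S → scalar σ₀ $r ≡ i → Row (array σ₀ %row) S i es → Unique es → Holds (array σ₀ %bit) none →
  (∀ {s σ τ} → Same increment σ τ → J s σ → J s τ) →
  (∀ {σ} α → Same (enumerate B) σ₀ σ → Holds (array σ %bit) α → J (code es α) σ → Run B σ d (J (suc (code es α)))) →
  J 0 σ₀ → Run (enumerate B) σ₀ (enumerateTime (length es) d) (λ τ → J (2 ^ length es) τ × Holds (array τ %bit) none)
run-enumerate {B} {σ₀} {S} {i} {es} {d} J {wbit} {wrow} {wr} {wS} stride r≡ row unique zeros stable body j₀ =
  straight-then λ s₁ →
  weaken ≤-refl
    (run-loop I (λ _ → proj₁) (λ s → step (same-trans (same-⨟ˡ s₁) (same-⨟ʳ {$go ≔ lit 1} (same (λ x {w} → scalars s x {w}) (λ a {w} → arrays s a {w})))))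
      (start L refl (stable going j₀)))
    λ _ → proj₂
  where
  L = 2 ^ length es
  I : ℕ → State → Set
  I zero    σ = scalar σ $go ≡ 0 × J L σ × Holds (array σ %bit) none
  I (suc n) σ = scalar σ $go ≡ 1 × ∃ λ α → Holds (array σ %bit) α × Off es α × code es α + suc n ≡ L × J (code es α) σ
  going : Same increment σ₀ (setScalar σ₀ $go 1)
  going = same (λ x {w} → scalars (exec-same {$go ≔ lit 1} {σ₀} ⇓set) x {∨-falseʳ (writesScalar propagate x) (∨-falseʳ ($carry ≡ᵇ x) w)}) (λ _ → refl)
  start : ∀ n → n ≡ L → J 0 (setScalar σ₀ $go 1) → I n (setScalar σ₀ $go 1)
  start zero    eq j = ⊥-elim (<⇒≢ (m^n>0 2 (length es)) eq)
  start (suc n) eq j = refl , none , zeros , (λ _ _ → refl) , trans (cong (_+ suc n) (code-none es)) eq ,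
                       subst (λ s → J s _) (sym (code-none es)) j
  step : ∀ {n σ} → Same (enumerate B) σ₀ σ → I (suc n) σ → scalar σ $go ≢ 0 × Run (B ⨟ increment) σ (d + incrementTime (length es)) (I n)
  step {n} {σ} s (go≡ , α , h , off , sum≡ , j) = (λ z → case trans (sym go≡) z of λ ()) ,
    (body α s h j then-run λ sB j′ →
      weaken ≤-refl
        (run-increment (trans (scalars sB $S {∨-falseˡ wS}) (trans (scalars s $S {wS}) stride)) (trans (scalars sB $r {∨-falseˡ wr}) (trans (scalars s $r {wr}) r≡))
           (subst (λ A → Row A S i es) (sym (trans (arrays sB %row {∨-falseˡ wrow}) (arrays s %row {wrow}))) row) unique
           (subst (λ A → Holds A α) (sym (arrays sB %bit {wbit})) h) off)
        λ sI → next n sum≡ sI j′)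
    where
    next : ∀ {σ τ} n → code es α + suc n ≡ L → Same increment σ τ → J (suc (code es α)) σ → Next es (code es α) τ → I n τ
    next zero    sum≡ sI j′ (inj₁ (go , β , h′ , off′ , c≡)) = ⊥-elim (<-irrefl (trans c≡ (trans (+-comm 1 _) sum≡)) (code-bound es β))
    next (suc n) sum≡ sI j′ (inj₁ (go , β , h′ , off′ , c≡)) =
      go , β , h′ , off′ , trans (cong (_+ suc n) c≡) (trans (sym (+-suc (code es α) (suc n))) sum≡) , subst (λ s → J s _) (sym c≡) (stable sI j′)
    next zero    sum≡ sI j′ (inj₂ (stop , h′ , last)) = stop , subst (λ s → J s _) last (stable sI j′) , h′
    next (suc n) sum≡ sI j′ (inj₂ (stop , h′ , last)) =
      ⊥-elim (m≢1+m+n (suc (code es α)) (trans last (trans (sym sum≡) (trans (+-suc (code es α) (suc n)) (cong suc (+-suc (code es α) n))))))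

-- Measuring the peak load of an orientation

loadStep : Program
loadStep =
  $e ≔ (%row [ var $q ]) ⊖ lit 1 ⨟
  (if′ %bit [ %row [ var $q ] ]
   then $h ≔ var $n ⊕ (%end₂ [ var $e ])
   else ($h ≔ var $n ⊕ (%end₁ [ var $e ]))) ⨟
  %load [ var $h ]≔ (%load [ var $h ]) ⊕ (%weight [ var $e ]) ⨟
  (if′ (%load [ var $h ]) ⊖ var $z then $z ≔ %load [ var $h ] else skip)

-- The array of loads is not reset; instead the base $n moves on to fresh cells.
measureLoad : Program
measureLoad =
  $z ≔ lit 0 ⨟
  forRow %row (var $c) loadStep ⨟
  $n ≔ var $n ⊕ var $V

measureLoadTime : ℕ → ℕ
measureLoadTime n = 2 + (rowTime 1 n 35 + 4)

FreshLoads : State → Set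
FreshLoads σ = ∀ x → scalar σ $n ≤ x → array σ %load x ≡ 0

module Measuring (first second weight : ℕ → ℕ) (#v : ℕ) where
  open Loads first second weight #v

  record Instance (σ : State) : Set where
    field
      first≡  : array σ %end₁ ≡ first
      second≡ : array σ %end₂ ≡ second
      weight≡ : array σ %weight ≡ weight
      #v≡     : scalar σ $V ≡ #v

  -- Loads only grow, so the peak is the largest value ever written, or zero. This avoids a pass
  -- over all vertices, which the time bound does not allow.
  run-measureLoad : ∀ {σ₀ S i es} α → scalar σ₀ $S ≡ S → scalar σ₀ $c ≡ i → Row (array σ₀ %row) S i es →
    Instance σ₀ → Holds (array σ₀ %bit) α → FreshLoads σ₀ → (∀ {e} → e ∈ es → target α e < #v) →
    Run measureLoad σ₀ (measureLoadTime (length es)) (λ τ → scalar τ $z ≡ peak es α × FreshLoads τ)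
  run-measureLoad {σ₀} {S} {i} {es} α stride c≡ row inst bits fresh targets =
    straight-then λ _ →
    run-row {xs = es} J stride c≡ row (λ _ j → j) (λ {_} {_} {_} {σ} eq s at → step {σ = σ} eq s at)
      ((λ v v< → fresh (n₀ + v) (m≤m+n n₀ v)) , (λ x le → fresh x (≤-trans (m≤m+n n₀ #v) le)) , (λ _ _ → z≤n) , λ _ _ → z≤n) then-run λ s (loads , rest , above , least) →
    run-straight (≤-antisym (least _ (λ v → load≤peak es α)) (peak-least es α above) ,
      λ x le → rest x (≤-trans (≤-reflexive (sym (cong₂ _+_ (scalars s $n) (trans (scalars s $V) #v≡)))) le))
    where
    open Instance inst
    n₀ = scalar σ₀ $n
    -- The last two clauses make `$z` the least upper bound of the loads so far; in the end this
    -- identifies it with `peak` by antisymmetry.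
    J : List ℕ → State → Set
    J ts σ = (∀ v → v < #v → array σ %load (n₀ + v) ≡ load ts α v) ×
             (∀ x → n₀ + #v ≤ x → array σ %load x ≡ 0) ×
             (∀ v → v < #v → load ts α v ≤ scalar σ $z) ×
             (∀ B → (∀ v → v < #v → load ts α v ≤ B) → scalar σ $z ≤ B)
    step : ∀ {ts x rs σ} → es ≡ ts ++ x ∷ rs → Same (forRow %row (var $c) loadStep) (setScalar σ₀ $z 0) σ →
           array σ %row (scalar σ $q) ≡ suc x → J ts σ → Run loadStep σ 35 (J (ts ∷ʳ x))
    step {ts} {x} {rs} {σ} eq s at (loads , rest , above , least) =
      straight-then λ _ →
      run-if {Q = λ τ → τ ≡ setScalar (setScalar σ $e E) $h (n₀ + t)}
        (λ nz → run-straight (cong (setScalar (setScalar σ $e E) $h) (cong₂ _+_ n≡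
           (trans (at≡ (trans (arrays s %end₂) second≡) E≡) (cong (λ b → if b then second x else first x) (sym (bit≢0 bit≡ nz)))))))
        (λ z → run-straight (cong (setScalar (setScalar σ $e E) $h) (cong₂ _+_ n≡
           (trans (at≡ (trans (arrays s %end₁) first≡) E≡) (cong (λ b → if b then second x else first x) (sym (bit≡0 bit≡ z)))))))
      then-run λ { _ refl →
      run-straight {P = %load [ var $h ]≔ (%load [ var $h ]) ⊕ (%weight [ var $e ])}
                   {Q = λ τ → array τ %load ≡ A′ × scalar τ $h ≡ n₀ + t × scalar τ $z ≡ scalar σ $z} (refl , refl , refl) then-run λ { {τ} _ (A≡ , h≡ , z≡) →
      run-if
        (λ nz → run-straight (finish {τ} (array τ %load (scalar τ $h)) A≡ (<⇒≤ (m∸n≢0⇒n<m nz)) (≤-reflexive (sym (new≡ {τ} A≡ h≡)))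
                                (λ B _ le → ≤-trans (≤-reflexive (new≡ {τ} A≡ h≡)) le) z≡))
        (λ z → run-straight (finish {τ} (scalar τ $z) A≡ ≤-refl (≤-trans (≤-reflexive (sym (new≡ {τ} A≡ h≡))) (m∸n≡0⇒m≤n z)) (λ B le _ → le) z≡)) } }
      where
      E = array σ %row (scalar σ $q) ∸ 1
      E≡ : E ≡ x
      E≡ = cong (_∸ 1) at
      t = target α x
      t< : t < #v
      t< = targets (subst (x ∈_) (sym eq) (∈-++⁺ʳ ts (here refl)))
      A = array σ %load
      n≡ : scalar σ $n ≡ n₀
      n≡ = scalars s $n
      bit≡ : array σ %bit (array σ %row (scalar σ $q)) ≡ bit (α x)
      bit≡ = trans (at≡ (arrays s %bit) at) (bits x)
      A′ = update A (n₀ + t) (A (n₀ + t) + array σ %weight E)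
      new = load (ts ∷ʳ x) α t
      load′ : ∀ v → v < #v → A′ (n₀ + v) ≡ load (ts ∷ʳ x) α v
      load′ v v< with t ≟ v
      ... | yes refl = trans (update-eq A (n₀ + t) _ refl) (trans (cong₂ _+_ (loads t t<) weight′) (sym (load-∷ʳ ts x α t)))
        where
        weight′ : array σ %weight E ≡ (if t ≡ᵇ t then weight x else 0)
        weight′ rewrite ≡ᵇ-refl t = at≡ (trans (arrays s %weight) weight≡) E≡
      ... | no t≢v = trans (update-neq A _ (t≢v ∘ +-cancelˡ-≡ n₀ t v)) (trans (loads v v<) (sym (trans (load-∷ʳ ts x α v) unchanged)))
        where
        unchanged : load ts α v + (if t ≡ᵇ v then weight x else 0) ≡ load ts α v
        unchanged rewrite ≢⇒≡ᵇ-false t≢v = +-identityʳ _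
      new≡ : ∀ {τ} → array τ %load ≡ A′ → scalar τ $h ≡ n₀ + t → array τ %load (scalar τ $h) ≡ new
      new≡ A≡ h≡ = trans (at≡ A≡ h≡) (load′ t t<)
      grows : ∀ v → load ts α v ≤ load (ts ∷ʳ x) α v
      grows v = ≤-trans (m≤m+n _ _) (≤-reflexive (sym (load-∷ʳ ts x α v)))
      above′ : ∀ z → scalar σ $z ≤ z → new ≤ z → ∀ v → v < #v → load (ts ∷ʳ x) α v ≤ z
      above′ z z≥ new≤ v v< with t ≟ v
      ... | yes refl = new≤
      ... | no t≢v = ≤-trans (≤-reflexive (trans (load-∷ʳ ts x α v) unchanged)) (≤-trans (above v v<) z≥)
        where
        unchanged : load ts α v + (if t ≡ᵇ v then weight x else 0) ≡ load ts α v
        unchanged rewrite ≢⇒≡ᵇ-false t≢v = +-identityʳ _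
      finish : ∀ {τ} z → array τ %load ≡ A′ → scalar τ $z ≤ z → new ≤ z → (∀ B → scalar τ $z ≤ B → new ≤ B → z ≤ B) →
               scalar τ $z ≡ scalar σ $z → J (ts ∷ʳ x) (setScalar τ $z z)
      finish {τ} z A≡ z≥ new≤ z≤ z≡ =
        (λ v v< → trans (cong-app A≡ (n₀ + v)) (load′ v v<)) ,
        (λ y le → trans (cong-app A≡ y) (trans (update-neq A _ (<⇒≢ (<-≤-trans (+-monoʳ-< n₀ t<) le))) (rest y le))) ,
        above′ z (≤-trans (≤-reflexive (sym z≡)) z≥) new≤ ,
        λ B below → z≤ B (≤-trans (≤-reflexive z≡) (least B λ v v< → ≤-trans (grows v) (below v v<))) (below t t<)

-- The dynamic program

-- Stated cell by cell: where the program writes nothing, the table equals the updated one only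
-- pointwise.
record Raised (F F′ : ℕ → ℕ) (a z : ℕ) : Set where
  constructor raised
  field
    cell : ∀ x → F′ x ≡ update F a (F a ⊔ z) x

raised-at : ∀ {F F′ a z} → Raised F F′ a z → F′ a ≡ F a ⊔ z
raised-at {F} {a = a} (raised up) = trans (up a) (update-eq F a _ refl)

raised-off : ∀ {F F′ a z x} → Raised F F′ a z → a ≢ x → F′ x ≡ F x
raised-off {F} {x = x} (raised up) a≢x = trans (up x) (update-neq F _ a≢x)

raised-≤ : ∀ {F F′ a z} → Raised F F′ a z → ∀ x → F x ≤ F′ x
raised-≤ {F} {F′} {a} {z} up x with a ≟ x
... | yes refl = ≤-trans (m≤m⊔n (F a) z) (≤-reflexive (sym (raised-at {F} up)))
... | no a≢x   = ≤-reflexive (sym (raised-off {F} up a≢x))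

-- Zero is the value of an unset message.
record Lowered (G G′ : ℕ → ℕ) (b v : ℕ) : Set where
  field
    elsewhere : ∀ x → b ≢ x → G′ x ≡ G x
    set       : G′ b ≢ 0
    below     : G′ b ≤ v
    decreases : G b ≢ 0 → G′ b ≤ G b
    origin    : G′ b ≡ v ⊎ (G b ≢ 0 × G′ b ≡ G b)

-- In a table of costs F, entry code (es i) β of row i stands for the least peak load known to be forced on the
-- processed part of the tree by the orientation β of the edges at bag i.  In a table of messages G, entry
-- key c p β of row c is one more than the least cost at bag c of an orientation that agrees with β on the edges
-- at both c and p.
module Tables (first second weight : ℕ → ℕ) (#v : ℕ) (S N : ℕ) (N<S : N < S) (es : ℕ → List ℕ) where
  open Loads first second weight #v public

  mask : ℕ → Choice → Choice
  mask i α e = does (e ∈? es i) ∧ α e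

  -- Two choices have the same key exactly if they agree on the edges at both bags. Masking leaves
  -- the numbering of `es c` in place, so `encode` computes keys as well.
  key : ℕ → ℕ → Choice → ℕ
  key c p α = code (es c) (mask p α)

  Good : Choice → ℕ → Set
  Good α B = ∀ i → i < N → peak (es i) α ≤ B

  -- This replaces the exact value of an entry: whatever has been recorded so far is forced on every
  -- global choice with that code. Hence it makes sense for half-filled tables and holds initially
  -- for zeros.
  LowerBound : (ℕ → ℕ) → Set
  LowerBound F = ∀ i → i ≤ N → ∀ β B → Good β B → F (i + S * code (es i) β) ≤ B

  mask-true : ∀ {i e} α → e ∈ es i → mask i α e ≡ α e
  mask-true {i} {e} α e∈ with e ∈? es i
  ... | yes _ = refl
  ... | no e∉ = ⊥-elim (e∉ e∈)

  mask-cong : ∀ i {α β} → Agree (es i) α β → ∀ e → mask i α e ≡ mask i β e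
  mask-cong i eq e with e ∈? es i
  ... | yes e∈ = eq e∈
  ... | no _   = refl

  key-cong : ∀ c {p α β} → Agree (es p) α β → key c p α ≡ key c p β
  key-cong c {p} eq = code-cong (es c) λ {e} _ → mask-cong p eq e

  key-congˡ : ∀ c {p α β} → Agree (es c) α β → key c p α ≡ key c p β
  key-congˡ c {p} eq = code-cong (es c) λ {e} e∈ → cong (does (e ∈? es p) ∧_) (eq e∈)

  column-≢ : ∀ {i x y} → i ≤ N → x ≢ y → i + S * x ≢ i + S * y
  column-≢ i≤ x≢y eq = x≢y (proj₂ (address-injective (≤-<-trans i≤ N<S) (≤-<-trans i≤ N<S) eq))

  row-≢ : ∀ {i j x y} → i ≤ N → j ≤ N → i ≢ j → i + S * x ≢ j + S * y
  row-≢ i≤ j≤ i≢j eq = i≢j (proj₁ (address-injective (≤-<-trans i≤ N<S) (≤-<-trans j≤ N<S) eq))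

  -- Up to the shift by one, the message is at most the cost of each orientation seen, and by
  -- `Attained` at least that of one of them; together this makes it the minimum.
  Treated : (c p : ℕ) (F G : ℕ → ℕ) → Choice → Set
  Treated c p F G β = peak (es c) β ≤ F (c + S * code (es c) β) ×
                      G (c + S * key c p β) ≢ 0 ×
                      G (c + S * key c p β) ≤ suc (F (c + S * code (es c) β))

  Attained : (c p : ℕ) (F G : ℕ → ℕ) → ℕ → ℕ → Set
  Attained c p F G s x =
    ∃ λ β → code (es c) β < s × key c p β ≡ x × suc (F (c + S * code (es c) β)) ≤ G (c + S * x)

  -- The entry at `α` is shared only by choices that agree with `α` on `es i`, so the new value has
  -- to be justified for these alone.
  raised-sound : ∀ {F F′ i z} α → i ≤ N → LowerBound F → Raised F F′ (i + S * code (es i) α) z →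
                 (∀ β B → Good β B → Agree (es i) α β → z ≤ B) → LowerBound F′
  raised-sound {F} {F′} {i} {z} α i≤ sound up below j j≤ β B good with i + S * code (es i) α ≟ j + S * code (es j) β
  ... | no a≢ = ≤-trans (≤-reflexive (raised-off {F} up a≢)) (sound j j≤ β B good)
  ... | yes a≡ with address-injective (≤-<-trans i≤ N<S) (≤-<-trans j≤ N<S) a≡
  ...   | refl , code≡ = ≤-trans (≤-reflexive (trans (cong F′ (sym a≡)) (raised-at {F} up)))
            (⊔-lub (≤-trans (≤-reflexive (cong F a≡)) (sound j j≤ β B good)) (below β B good (code-injective (es j) {α} {β} code≡)))

  record Swept (c p : ℕ) (F₀ G₀ : ℕ → ℕ) (s : ℕ) (F G : ℕ → ℕ) : Set where
    field
      treated  : ∀ β → code (es c) β < s → Treated c p F G β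
      attained : ∀ x → G (c + S * x) ≢ 0 → Attained c p F G s x
      growsF   : ∀ x → F₀ x ≤ F x
      keepsF   : ∀ i x → i ≤ N → c ≢ i → F (i + S * x) ≡ F₀ (i + S * x)
      keepsG   : ∀ i x → i ≤ N → c ≢ i → G (i + S * x) ≡ G₀ (i + S * x)
      sound    : LowerBound F

  swept-start : ∀ {c p F G} → (∀ x → G (c + S * x) ≡ 0) → LowerBound F → Swept c p F G 0 F G
  swept-start unset lb = record
    { treated  = λ _ ()
    ; attained = λ x set → ⊥-elim (set (unset x))
    ; growsF   = λ _ → ≤-refl
    ; keepsF   = λ _ _ _ _ → refl
    ; keepsG   = λ _ _ _ _ → refl
    ; sound    = lb
    }

  -- An orientation seen earlier may share its message with `α` but not its cost entry, as the codes
  -- differ. Messages only fall once set, which preserves `treated`; by `origin`, a message is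
  -- either new and witnessed by `α` or keeps its old witness.
  swept-step : ∀ {c p F₀ G₀ F G F′ G′} α → c < N → let a = c + S * code (es c) α in
    Swept c p F₀ G₀ (code (es c) α) F G →
    Raised F F′ a (peak (es c) α) → Lowered G G′ (c + S * key c p α) (suc (F′ a)) →
    Swept c p F₀ G₀ (suc (code (es c) α)) F′ G′
  swept-step {c} {p} {F₀} {G₀} {F} {G} {F′} {G′} α c<N sw up low = record
    { treated  = treated′
    ; attained = attained′
    ; growsF   = λ x → ≤-trans (growsF x) (raised-≤ {F} up x)
    ; keepsF   = λ i x i≤ c≢i → trans (raised-off {F} up (row-≢ c≤ i≤ c≢i)) (keepsF i x i≤ c≢i)
    ; keepsG   = λ i x i≤ c≢i → trans (elsewhere _ (row-≢ c≤ i≤ c≢i)) (keepsG i x i≤ c≢i)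
    ; sound    = raised-sound α c≤ sound up λ β B good agree → ≤-trans (≤-reflexive (peak-cong (es c) agree)) (good c c<N)
    }
    where
    open Swept sw
    open Lowered low
    c≤ : c ≤ N
    c≤ = <⇒≤ c<N
    Fa≡ : F′ (c + S * code (es c) α) ≡ F (c + S * code (es c) α) ⊔ peak (es c) α
    Fa≡ = raised-at {F} up
    earlier : ∀ β → code (es c) β < code (es c) α → F′ (c + S * code (es c) β) ≡ F (c + S * code (es c) β)
    earlier β lt = raised-off {F} up (column-≢ c≤ (<⇒≢ lt ∘ sym))
    treated′ : ∀ β → code (es c) β < suc (code (es c) α) → Treated c p F′ G′ β
    treated′ β (s≤s le) with m≤n⇒m<n∨m≡n le
    ... | inj₂ eq rewrite key-congˡ c {p} (code-injective (es c) {β} {α} eq) | peak-cong (es c) (code-injective (es c) {β} {α} eq) | eq =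
      ≤-trans (m≤n⊔m _ _) (≤-reflexive (sym Fa≡)) , set , below
    ... | inj₁ lt with treated β lt | key c p α ≟ key c p β
    ...   | pk , nz , le′ | yes keq rewrite earlier β lt | sym keq = pk , set , ≤-trans (decreases nz) le′
    ...   | pk , nz , le′ | no k≢ rewrite earlier β lt | elsewhere _ (column-≢ c≤ k≢) = pk , nz , le′
    attained′ : ∀ x → G′ (c + S * x) ≢ 0 → Attained c p F′ G′ (suc (code (es c) α)) x
    attained′ x nz with key c p α ≟ x
    attained′ x nz | yes refl with origin
    ... | inj₁ v≡ = α , ≤-refl , refl , ≤-reflexive (sym v≡)
    ... | inj₂ (G≢0 , G≡) with attained x G≢0
    ...   | β , lt , keq , le = β , m<n⇒m<1+n lt , keq , ≤-trans (s≤s (≤-reflexive (earlier β lt))) (≤-trans le (≤-reflexive (sym G≡)))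
    attained′ x nz | no k≢ with attained x (nz ∘ trans (elsewhere _ (column-≢ c≤ k≢)))
    ... | β , lt , keq , le = β , m<n⇒m<1+n lt , keq ,
          ≤-trans (s≤s (≤-reflexive (earlier β lt))) (≤-trans le (≤-reflexive (sym (elsewhere _ (column-≢ c≤ k≢)))))

  record Pushed (c p : ℕ) (G F₀ : ℕ → ℕ) (s : ℕ) (F : ℕ → ℕ) : Set where
    field
      covers : ∀ β → code (es p) β < s → G (c + S * key c p β) ≤ suc (F (p + S * code (es p) β))
      growsF : ∀ x → F₀ x ≤ F x
      keepsF : ∀ i x → i ≤ N → p ≢ i → F (i + S * x) ≡ F₀ (i + S * x)
      sound  : LowerBound F

  pushed-start : ∀ {c p G F} → LowerBound F → Pushed c p G F 0 F
  pushed-start lb = record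
    { covers = λ _ ()
    ; growsF = λ _ → ≤-refl
    ; keepsF = λ _ _ _ _ → refl
    ; sound  = lb
    }

  -- The push is sound because the message exceeds no achievable bound by more than one; the
  -- subtraction undoes this shift.
  pushed-step : ∀ {c p G F₀ F F′} α → p ≤ N →
    (∀ β B → Good β B → G (c + S * key c p β) ≤ suc B) →
    Pushed c p G F₀ (code (es p) α) F →
    Raised F F′ (p + S * code (es p) α) (G (c + S * key c p α) ∸ 1) →
    Pushed c p G F₀ (suc (code (es p) α)) F′
  pushed-step {c} {p} {G} {F₀} {F} {F′} α p≤ valid pu up = record
    { covers = covers′
    ; growsF = λ x → ≤-trans (growsF x) (raised-≤ {F} up x)
    ; keepsF = λ i x i≤ p≢i → trans (raised-off {F} up (row-≢ p≤ i≤ p≢i)) (keepsF i x i≤ p≢i)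
    ; sound  = raised-sound α p≤ sound up λ β B good agree →
        ∸-monoˡ-≤ 1 (≤-trans (≤-reflexive (cong (λ x → G (c + S * x)) (key-cong c {p} agree))) (valid β B good))
    }
    where
    open Pushed pu
    Fa≡ : F′ (p + S * code (es p) α) ≡ F (p + S * code (es p) α) ⊔ (G (c + S * key c p α) ∸ 1)
    Fa≡ = raised-at {F} up
    covers′ : ∀ β → code (es p) β < suc (code (es p) α) → G (c + S * key c p β) ≤ suc (F′ (p + S * code (es p) β))
    covers′ β (s≤s le) with m≤n⇒m<n∨m≡n le
    ... | inj₁ lt = ≤-trans (covers β lt) (s≤s (raised-≤ {F} up _))
    ... | inj₂ eq rewrite key-cong c {p} (code-injective (es p) {β} {α} eq) | eq =
      ≤-trans (m≤n+m∸n _ 1) (s≤s (≤-trans (m≤n⊔m _ _) (≤-reflexive (sym Fa≡))))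

  module Elimination (t : ℕ) (node : ℕ → ℕ) (parent : ℕ → ℕ) where

    -- What the way down needs from a finished bag: `attained` provides an orientation to choose,
    -- `covers` bounds its cost through the parent, `heavy` passes from costs to loads, and `valid`
    -- serves at the root to compare with arbitrary choices.
    record Eliminated (F G : ℕ → ℕ) (c : ℕ) : Set where
      p = parent c
      field
        heavy    : ∀ β → peak (es c) β ≤ F (c + S * code (es c) β)
        covers   : ∀ β → G (c + S * key c p β) ≤ suc (F (p + S * code (es p) β))
        attained : ∀ β → ∃ λ β′ → key c p β′ ≡ key c p β × suc (F (c + S * code (es c) β′)) ≤ G (c + S * key c p β)
        valid    : ∀ β B → Good β B → G (c + S * key c p β) ≤ suc B

    record Forward (k : ℕ) (F G : ℕ → ℕ) : Set where
      field
        sound      : LowerBound F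
        unset      : ∀ j → j < k → ∀ x → G (node j + S * x) ≡ 0
        eliminated : ∀ j → k ≤ j → j < t → Eliminated F G (node j)

    -- Finished bags stay eliminated: neither `c` nor its parent is among them, so their own rows
    -- are untouched, and the cost rows of their parents can only grow, which preserves `covers`.
    forward-step : ∀ {k F₀ G₀ F₁ G₁ F₂} → let c = node k ; p = parent c in k < t → c < N → p ≤ N → p ≢ c →
      (∀ j → j < t → j ≢ k → node j ≢ c) → (∀ j → j < t → node j < N) → (∀ j → k < j → j < t → node j ≢ p) →
      Forward (suc k) F₀ G₀ → Swept c p F₀ G₀ (2 ^ length (es c)) F₁ G₁ → Pushed c p G₁ F₁ (2 ^ length (es p)) F₂ →
      Forward k F₂ G₁
    forward-step {k} {F₀} {G₀} {F₁} {G₁} {F₂} k<t c<N p≤N p≢c distinct bags later fw sw pu = record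
      { sound      = Pushed.sound pu
      ; unset      = λ j j<k x → trans (keepsG (node j) x (<⇒≤ (bags j (<-trans j<k k<t))) (distinct j (<-trans j<k k<t) (<⇒≢ j<k) ∘ sym))
                                       (Forward.unset fw j (m<n⇒m<1+n j<k) x)
      ; eliminated = λ j k≤j j<t → elim j j<t (m≤n⇒m<n∨m≡n k≤j)
      }
      where
      open Swept sw
      c = node k
      p = parent c
      F₁≤F₂ : ∀ x → F₁ x ≤ F₂ x
      F₁≤F₂ = Pushed.growsF pu
      F₀≤F₂ : ∀ x → F₀ x ≤ F₂ x
      F₀≤F₂ x = ≤-trans (growsF x) (F₁≤F₂ x)
      F₂c : ∀ x → F₂ (c + S * x) ≡ F₁ (c + S * x)
      F₂c x = Pushed.keepsF pu c x (<⇒≤ c<N) p≢c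
      elim : ∀ j → j < t → k < j ⊎ k ≡ j → Eliminated F₂ G₁ (node j)
      elim j j<t (inj₂ refl) = record
        { heavy    = λ β → ≤-trans (proj₁ (treated β (code-bound (es c) β))) (F₁≤F₂ _)
        ; covers   = λ β → Pushed.covers pu β (code-bound (es p) β)
        ; attained = λ β → let β′ , _ , keq , le = attained (key c p β) (proj₁ (proj₂ (treated β (code-bound (es c) β)))) in
                           β′ , keq , ≤-trans (s≤s (≤-reflexive (F₂c _))) le
        ; valid    = λ β B good → ≤-trans (proj₂ (proj₂ (treated β (code-bound (es c) β)))) (s≤s (sound c (<⇒≤ c<N) β B good))
        }
      elim j j<t (inj₁ k<j) = record
        { heavy    = λ β → ≤-trans (E.heavy β) (F₀≤F₂ _)
        ; covers   = λ β → ≤-trans (≤-reflexive (G≡ _)) (≤-trans (E.covers β) (s≤s (F₀≤F₂ _)))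
        ; attained = λ β → let β′ , keq , le = E.attained β in
                           β′ , keq , ≤-trans (s≤s (≤-reflexive (F≡ _))) (≤-trans le (≤-reflexive (sym (G≡ _))))
        ; valid    = λ β B good → ≤-trans (≤-reflexive (G≡ _)) (E.valid β B good)
        }
        where
        module E = Eliminated (Forward.eliminated fw j k<j j<t)
        d = node j
        d≤ : d ≤ N
        d≤ = <⇒≤ (bags j j<t)
        c≢d : c ≢ d
        c≢d = distinct j j<t (λ { refl → <-irrefl refl k<j }) ∘ sym
        G≡ : ∀ x → G₁ (d + S * x) ≡ G₀ (d + S * x)
        G≡ x = keepsG d x d≤ c≢d
        F≡ : ∀ x → F₂ (d + S * x) ≡ F₀ (d + S * x)
        F≡ x = trans (Pushed.keepsF pu d x d≤ (later j k<j j<t ∘ sym)) (keepsF d x d≤ c≢d)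

-- Programs for the messages: sweeps at a bag and pushes at its parent

chosen : Expr
chosen = %bit [ %row [ var $q ] ]

-- On bits, `x + y - 1` with truncated subtraction is conjunction.
masked : Name → Expr
masked A = (A [ %row [ var $q ] ]) ⊕ (%in [ var $p ⊕ (%mul [ %row [ var $q ] ]) ]) ⊖ lit 1

-- `$r` is the row being enumerated, the parent in a push and the bag itself otherwise; `$b` and
-- `$a` become the addresses of the message and of the cost entry.
locate : Program
locate = encode (var $c) (masked %bit) ⨟ $b ≔ var $a ⨟ encode (var $r) chosen

raise : Expr → Program
raise e = if′ e ⊖ (%cost [ var $a ]) then %cost [ var $a ]≔ e else skip

-- The sum acts as a disjunction: its first summand detects an unset message, the second one a
-- message that can be improved.
lower : Program
lower =
  if′ (lit 1 ⊖ (%msg [ var $b ])) ⊕ ((%msg [ var $b ]) ⊖ (lit 1 ⊕ (%cost [ var $a ])))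
  then %msg [ var $b ]≔ lit 1 ⊕ (%cost [ var $a ])
  else skip

sweepStep : Program
sweepStep = locate ⨟ measureLoad ⨟ raise (var $z) ⨟ lower

sweep : Program
sweep = $r ≔ var $c ⨟ enumerate sweepStep

pushStep : Program
pushStep = locate ⨟ raise ((%msg [ var $b ]) ⊖ lit 1)

push : Program
push = $r ≔ var $p ⨟ enumerate pushStep

locateTime : ℕ → ℕ
locateTime K = encodeTime (var $c) (masked %bit) K + (2 + encodeTime (var $r) chosen K)

sweepStepTime : ℕ → ℕ
sweepStepTime K = locateTime K + (measureLoadTime K + (9 + 20))

pushStepTime : ℕ → ℕ
pushStepTime K = locateTime K + 15

rowTime-mono : ∀ c {n m} d → n ≤ m → rowTime c n d ≤ rowTime c m d
rowTime-mono c d n≤m = +-monoʳ-≤ (4 + c) (*-monoˡ-≤ (7 + d) n≤m)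

enumerateTime-mono : ∀ {n m d} → n ≤ m → enumerateTime n d ≤ enumerateTime m d
enumerateTime-mono {n} {m} {d} n≤m = +-monoʳ-≤ 4 (*-mono-≤ (^-monoʳ-≤ 2 n≤m) (+-monoʳ-≤ (2 + d) (+-monoʳ-≤ 2 (+-monoˡ-≤ 4 (rowTime-mono 1 17 n≤m)))))

run-raise : ∀ e {σ} → Run (raise e) σ (1 + (1 + cost e + 2) + ((2 + cost e) + 1))
            (λ τ → Raised (array σ %cost) (array τ %cost) (scalar σ $a) (eval σ e))
run-raise e {σ} = run-if
  (λ nz → run-straight (raised λ x → cong (λ v → update F a v x) (sym (m≤n⇒m⊔n≡n (<⇒≤ (m∸n≢0⇒n<m nz))))))
  (λ z  → run-straight (raised λ x → still x (m∸n≡0⇒m≤n z)))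
  where
  F = array σ %cost
  a = scalar σ $a
  still : ∀ x → eval σ e ≤ F a → F x ≡ update F a (F a ⊔ eval σ e) x
  still x le with a ≟ x
  ... | yes refl = sym (trans (update-eq F a _ refl) (m≥n⇒m⊔n≡m le))
  ... | no a≢x   = sym (update-neq F _ a≢x)

run-lower : ∀ {σ} → Run lower σ 20
            (λ τ → Lowered (array σ %msg) (array τ %msg) (scalar σ $b) (suc (array σ %cost (scalar σ $a))))
run-lower {σ} = slower (≤ᵇ⇒≤ _ _ tt) (run-if
  (λ nz → run-straight record
    { elsewhere = λ x b≢x → update-neq G _ b≢x
    ; set       = λ eq → case trans (sym new) eq of λ ()
    ; below     = ≤-reflexive new
    ; decreases = λ G≢0 → ≤-trans (≤-reflexive new) (improves (G b) G≢0 nz)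
    ; origin    = inj₁ new
    })
  (λ z → run-straight record
    { elsewhere = λ _ _ → refl
    ; set       = λ eq → case trans (sym z) (cong (λ g → (1 ∸ g) + (g ∸ v)) eq) of λ ()
    ; below     = m∸n≡0⇒m≤n (m+n≡0⇒n≡0 (1 ∸ G b) z)
    ; decreases = λ _ → ≤-refl
    ; origin    = inj₂ ((λ eq → case trans (sym z) (cong (λ g → (1 ∸ g) + (g ∸ v)) eq) of λ ()) , refl)
    }))
  where
  G = array σ %msg
  b = scalar σ $b
  v = suc (array σ %cost (scalar σ $a))
  new : update G b v b ≡ v
  new = update-eq G b v refl
  improves : ∀ g → g ≢ 0 → (1 ∸ g) + (g ∸ v) ≢ 0 → v ≤ g
  improves zero    g≢0 _  = ⊥-elim (g≢0 refl)
  improves (suc g) _   nz = <⇒≤ (m∸n≢0⇒n<m (nz ∘ trans (cong (_+ (suc g ∸ v)) (0∸n≡0 g))))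

module Solving (first second weight : ℕ → ℕ) (#v S N #e K : ℕ) (N<S : N < S) (es : ℕ → List ℕ)
  (unique : ∀ i → i ≤ N → Unique (es i)) (short : ∀ i → i ≤ N → length (es i) ≤ K)
  (edges  : ∀ i → i ≤ N → ∀ e → e ∈ es i → e < #e)
  (ends   : ∀ e → e < #e → first e < #v × second e < #v) where

  open Tables first second weight #v S N N<S es public
  open Measuring first second weight #v public

  record Ready (σ : State) : Set where
    field
      inst    : Instance σ
      stride  : scalar σ $S ≡ S
      rows    : ∀ i → i ≤ N → Row (array σ %row) S i (es i)
      mul     : ∀ e → e < #e → array σ %mul (suc e) ≡ S * suc e
      member : ∀ i → i ≤ N → ∀ e → e < #e → array σ %in (i + S * suc e) ≡ bit (does (e ∈? es i))

  ready-same : ∀ {P σ τ} {w : T (spares P ($V ∷ $S ∷ []) (%end₁ ∷ %end₂ ∷ %weight ∷ %row ∷ %mul ∷ %in ∷ []))} →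
               Same P σ τ → Ready σ → Ready τ
  ready-same {w = w} s ready with kept ($V ∷ $S ∷ []) (%end₁ ∷ %end₂ ∷ %weight ∷ %row ∷ %mul ∷ %in ∷ []) s w
  ... | V≡ ∷ S≡ ∷ [] , A₁ ∷ A₂ ∷ A₃ ∷ row≡ ∷ mul≡ ∷ in≡ ∷ [] = record
    { inst    = record { first≡ = trans A₁ first≡ ; second≡ = trans A₂ second≡ ; weight≡ = trans A₃ weight≡ ; #v≡ = trans V≡ #v≡ }
    ; stride  = trans S≡ stride
    ; rows    = λ i i≤ → subst (λ A → Row A S i (es i)) (sym row≡) (rows i i≤)
    ; mul     = λ e e< → trans (cong-app mul≡ (suc e)) (mul e e<)
    ; member  = λ i i≤ e e< → trans (cong-app in≡ (i + S * suc e)) (member i i≤ e e<)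
    }
    where
    open Ready ready
    open Instance inst

  eval-masked : ∀ A {σ p α e} → Ready σ → scalar σ $p ≡ p → p ≤ N → e < #e → Holds (array σ A) α →
                array σ %row (scalar σ $q) ≡ suc e → eval σ (masked A) ≡ bit (mask p α e)
  eval-masked A {σ} {p} {α} {e} ready p≡ p≤ e< h at = begin
    (array σ A (array σ %row (scalar σ $q)) + array σ %in (scalar σ $p + array σ %mul (array σ %row (scalar σ $q)))) ∸ 1
      ≡⟨ cong₂ (λ r p → (array σ A r + array σ %in (p + array σ %mul r)) ∸ 1) at p≡ ⟩
    (array σ A (suc e) + array σ %in (p + array σ %mul (suc e))) ∸ 1
      ≡⟨ cong₂ (λ a m → (a + array σ %in (p + m)) ∸ 1) (h e) (mul e e<) ⟩
    (bit (α e) + array σ %in (p + S * suc e)) ∸ 1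
      ≡⟨ cong (λ i → (bit (α e) + i) ∸ 1) (member p p≤ e e<) ⟩
    (bit (α e) + bit (does (e ∈? es p))) ∸ 1
      ≡⟨ both (α e) (does (e ∈? es p)) ⟩
    bit (mask p α e) ∎
    where
    open ≡-Reasoning
    open Ready ready
    both : ∀ a m → (bit a + bit m) ∸ 1 ≡ bit (m ∧ a)
    both false false = refl
    both false true  = refl
    both true  false = refl
    both true  true  = refl

  encodeTime-mono : ∀ r test {i} → i ≤ N → encodeTime r test (length (es i)) ≤ encodeTime r test K
  encodeTime-mono r test i≤ = +-monoʳ-≤ (1 + cost r) (+-monoʳ-≤ 2 (rowTime-mono 1 (1 + cost test + 5 + 4) (short _ i≤)))

  run-encode-masked : ∀ A {σ c p α} → {_ : T (not (writesArray (encode (var $c) (masked A)) A))} → Ready σ →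
    scalar σ $c ≡ c → scalar σ $p ≡ p → c ≤ N → p ≤ N → Holds (array σ A) α →
    Run (encode (var $c) (masked A)) σ (encodeTime (var $c) (masked A) K) (λ τ → scalar τ $a ≡ c + S * key c p α)
  run-encode-masked A {σ} {c} {p} {α} {wA} ready c≡ p≡ c≤ p≤ h =
    slower (encodeTime-mono (var $c) (masked A) c≤)
      (run-encode (mask p α) stride c≡ (rows c c≤) λ e∈ s at →
        eval-masked A (ready-same s ready) (trans (scalars s $p) p≡) p≤ (edges c c≤ _ e∈)
          (subst (λ B → Holds B α) (sym (arrays s A {wA})) h) at)
    where open Ready ready

  run-encode-chosen : ∀ {σ r α} → Ready σ → scalar σ $r ≡ r → r ≤ N → Holds (array σ %bit) α →
    Run (encode (var $r) chosen) σ (encodeTime (var $r) chosen K) (λ τ → scalar τ $a ≡ r + S * code (es r) α)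
  run-encode-chosen {σ} {r} {α} ready r≡ r≤ h =
    slower (encodeTime-mono (var $r) chosen r≤)
      (run-encode {es = es r} α stride r≡ (rows r r≤) λ e∈ s at → trans (at≡ (arrays s %bit) at) (h _))
    where open Ready ready

  run-locate : ∀ {σ c p r α} → Ready σ → scalar σ $c ≡ c → scalar σ $p ≡ p → scalar σ $r ≡ r → c ≤ N → p ≤ N → r ≤ N →
    Holds (array σ %bit) α →
    Run locate σ (locateTime K) (λ τ → scalar τ $b ≡ c + S * key c p α × scalar τ $a ≡ r + S * code (es r) α)
  run-locate {α = α} ready c≡ p≡ r≡ c≤ p≤ r≤ h =
    run-encode-masked %bit ready c≡ p≡ c≤ p≤ h then-run λ s₁ a≡ →
    straight-then λ s₂ →
    let r₂ = s₁ ▹ s₂ in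
    weaken ≤-refl (run-encode-chosen {α = α} (ready-same r₂ ready) (trans (scalars r₂ $r) r≡) r≤
      (subst (λ B → Holds B α) (sym (arrays r₂ %bit)) h))
      λ s₃ a≡′ → trans (scalars s₃ $b) a≡ , a≡′

  fresh-same : ∀ {P σ τ} {_ : T (not (writesScalar P $n))} {_ : T (not (writesArray P %load))} →
               Same P σ τ → FreshLoads σ → FreshLoads τ
  fresh-same {P} {σ} {τ} {wn} {wl} s fresh x le =
    trans (cong-app (arrays s %load {wl}) x) (fresh x (≤-trans (≤-reflexive (sym (scalars s $n {wn}))) le))

  run-sweep : ∀ {σ₀ c p} → Ready σ₀ → scalar σ₀ $c ≡ c → scalar σ₀ $p ≡ p → c < N → p ≤ N →
    Holds (array σ₀ %bit) none → FreshLoads σ₀ →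
    (∀ x → array σ₀ %msg (c + S * x) ≡ 0) → LowerBound (array σ₀ %cost) →
    Run sweep σ₀ (2 + enumerateTime K (sweepStepTime K))
      (λ τ → (Swept c p (array σ₀ %cost) (array σ₀ %msg) (2 ^ length (es c)) (array τ %cost) (array τ %msg) × FreshLoads τ) ×
             Holds (array τ %bit) none)
  run-sweep {σ₀} {c} {p} ready₀ c≡ p≡ c<N p≤ zeros fresh unset lb =
    straight-then λ s₁ →
    slower (enumerateTime-mono {d = sweepStepTime K} (short c c≤))
      (run-enumerate {i = c} J (Ready.stride ready₀) c≡ (Ready.rows ready₀ c c≤) (unique c c≤) zeros
        (λ s (sw , fr) → subst₂ (Swept c p F₀ G₀ _) (sym (arrays s %cost)) (sym (arrays s %msg)) sw , fresh-same s fr)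
        (λ α s h (sw , fr) → body α (ready-same (s₁ ▹ s) ready₀) (trans (scalars s $c) c≡) (trans (scalars s $p) p≡) (trans (scalars s $r) c≡) h sw fr)
        (swept-start unset lb , fresh))
    where
    c≤ = <⇒≤ c<N
    F₀ = array σ₀ %cost
    G₀ = array σ₀ %msg
    J : ℕ → State → Set
    J s σ = Swept c p F₀ G₀ s (array σ %cost) (array σ %msg) × FreshLoads σ
    body : ∀ {σ} α → Ready σ → scalar σ $c ≡ c → scalar σ $p ≡ p → scalar σ $r ≡ c → Holds (array σ %bit) α →
           Swept c p F₀ G₀ (code (es c) α) (array σ %cost) (array σ %msg) → FreshLoads σ →
           Run sweepStep σ (sweepStepTime K) (J (suc (code (es c) α)))
    body {σ} α ready c≡ p≡ r≡ h sw fr =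
      run-locate {α = α} ready c≡ p≡ r≡ c≤ p≤ c≤ h then-run λ {σ₁} s₁ (b≡ , a≡) →
      slower (+-monoʳ-≤ 2 (+-monoˡ-≤ 4 (rowTime-mono 1 35 (short c c≤))))
        (run-measureLoad α (Ready.stride (ready-same s₁ ready)) (trans (scalars s₁ $c) c≡) (Ready.rows (ready-same s₁ ready) c c≤)
          (Ready.inst (ready-same s₁ ready)) (subst (λ B → Holds B α) (sym (arrays s₁ %bit)) h) (fresh-same s₁ fr) targets)
      then-run λ {σ₂} s₂ (z≡ , fr₂) →
      run-raise (var $z) then-run λ {σ₃} s₃ up →
      weaken ≤-refl run-lower λ {τ} s₄ low →
        (let a₂ = trans (scalars s₂ $a) a≡
             b₃ = trans (scalars (s₂ ▹ s₃) $b) b≡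
             a₃ = trans (scalars s₃ $a) a₂
             F≡ = sym (arrays (s₁ ▹ s₂) %cost)
             G≡ = sym (arrays (s₁ ▹ s₂ ▹ s₃) %msg)
         in swept-step {c} {p} {F = array σ₂ %cost} {G = array σ₃ %msg} {F′ = array τ %cost} {G′ = array τ %msg} α c<N
              (subst₂ (Swept c p F₀ G₀ _) F≡ G≡ sw)
              (subst (λ F → Raised (array σ₂ %cost) F _ _) (sym (arrays s₄ %cost)) (subst₂ (Raised (array σ₂ %cost) (array σ₃ %cost)) a₂ z≡ up))
              (subst₂ (Lowered (array σ₃ %msg) (array τ %msg)) b₃ (cong suc (at≡ (sym (arrays s₄ %cost)) a₃)) low)) ,
        fresh-same s₄ (fresh-same s₃ fr₂)
      where
      targets : ∀ {e} → e ∈ es c → target α e < #v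
      targets {e} e∈ with α e
      ... | true  = proj₂ (ends e (edges c c≤ e e∈))
      ... | false = proj₁ (ends e (edges c c≤ e e∈))

  run-push : ∀ {σ₀ c p} → Ready σ₀ → scalar σ₀ $c ≡ c → scalar σ₀ $p ≡ p → c ≤ N → p ≤ N →
    Holds (array σ₀ %bit) none → (∀ β B → Good β B → array σ₀ %msg (c + S * key c p β) ≤ suc B) → LowerBound (array σ₀ %cost) →
    Run push σ₀ (2 + enumerateTime K (pushStepTime K))
      (λ τ → Pushed c p (array σ₀ %msg) (array σ₀ %cost) (2 ^ length (es p)) (array τ %cost) × Holds (array τ %bit) none)
  run-push {σ₀} {c} {p} ready₀ c≡ p≡ c≤ p≤ zeros valid lb =
    straight-then λ s₁ →
    slower (enumerateTime-mono {d = pushStepTime K} (short p p≤))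
      (run-enumerate {i = p} J (Ready.stride ready₀) p≡ (Ready.rows ready₀ p p≤) (unique p p≤) zeros
        (λ s → subst (Pushed c p G F₀ _) (sym (arrays s %cost)))
        (λ α s h → body α (ready-same (s₁ ▹ s) ready₀) (trans (scalars s $c) c≡) (trans (scalars s $p) p≡) (trans (scalars s $r) p≡)
                     (arrays s %msg) h)
        (pushed-start lb))
    where
    F₀ = array σ₀ %cost
    G  = array σ₀ %msg
    J : ℕ → State → Set
    J s σ = Pushed c p G F₀ s (array σ %cost)
    body : ∀ {σ} α → Ready σ → scalar σ $c ≡ c → scalar σ $p ≡ p → scalar σ $r ≡ p → array σ %msg ≡ G → Holds (array σ %bit) α →
           J (code (es p) α) σ → Run pushStep σ (pushStepTime K) (J (suc (code (es p) α)))
    body {σ} α ready c≡ p≡ r≡ G≡ h pu =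
      run-locate {α = α} ready c≡ p≡ r≡ c≤ p≤ p≤ h then-run λ {σ₁} s₁ (b≡ , a≡) →
      weaken (≤ᵇ⇒≤ _ _ tt) (run-raise ((%msg [ var $b ]) ⊖ lit 1)) λ {τ} s₂ up →
        pushed-step {c} {p} {F = array σ₁ %cost} α p≤ valid
          (subst (Pushed c p G F₀ _) (sym (arrays s₁ %cost)) pu)
          (subst₂ (Raised (array σ₁ %cost) (array τ %cost)) a≡ (cong₂ (λ f i → f i ∸ 1) (trans (arrays s₁ %msg) G≡) b≡) up)

-- Choosing an orientation on the way down

copy : Program
copy = forRow %row (var $c) (%fixed [ %row [ var $q ] ]≔ %bit [ %row [ var $q ] ])

-- `$d` addresses the key of the orientation fixed so far, `$b` that of the candidate; the test is
-- nonzero if the candidate costs more than its message allows or if the keys differ. A later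
-- candidate may overwrite an earlier one: edges shared with the parent keep their orientation, so
-- the value of `$d` is the same in all rounds.
fixStep : Program
fixStep =
  encode (var $c) (masked %fixed) ⨟
  $d ≔ var $a ⨟
  locate ⨟
  (if′ ((lit 1 ⊕ (%cost [ var $a ])) ⊖ (%msg [ var $b ])) ⊕ ((var $b ⊖ var $d) ⊕ (var $d ⊖ var $b))
   then skip
   else copy)

fix : Program
fix = $r ≔ var $c ⨟ enumerate fixStep

forwardStep : Program
forwardStep =
  $k ≔ var $k ⊖ lit 1 ⨟
  $c ≔ %queue [ var $k ] ⨟
  $p ≔ %parent [ var $c ] ⨟
  sweep ⨟
  push

forward : Program
forward = $k ≔ var $t ⨟ (while var $k loop forwardStep)

backwardStep : Program
backwardStep =
  $c ≔ %queue [ var $k ] ⨟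
  $p ≔ %parent [ var $c ] ⨟
  fix ⨟
  $k ≔ var $k ⊕ lit 1

backward : Program
backward = $k ≔ lit 0 ⨟ (while var $t ⊖ var $k loop backwardStep)

fixStepTime : ℕ → ℕ
fixStepTime K = encodeTime (var $c) (masked %fixed) K + (2 + (locateTime K + (16 + (1 + rowTime 1 K 6))))

forwardStepTime : ℕ → ℕ
forwardStepTime K = 4 + (3 + (3 + ((2 + enumerateTime K (sweepStepTime K)) + (2 + enumerateTime K (pushStepTime K)))))

backwardStepTime : ℕ → ℕ
backwardStepTime K = 3 + (3 + ((2 + enumerateTime K (fixStepTime K)) + 4))

-- `separated` is the running intersection property of the edge sets in search order, through which
-- the tree decomposition enters the way down.
module Search (first second weight : ℕ → ℕ) (#v S N #e K : ℕ) (N<S : N < S) (es : ℕ → List ℕ)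
  (unique : ∀ i → i ≤ N → Unique (es i)) (short : ∀ i → i ≤ N → length (es i) ≤ K)
  (edges  : ∀ i → i ≤ N → ∀ e → e ∈ es i → e < #e)
  (ends   : ∀ e → e < #e → first e < #v × second e < #v)
  (es-N : es N ≡ [])
  (t : ℕ) (node parent : ℕ → ℕ)
  (node< : ∀ j → j < t → node j < N)
  (node-injective : ∀ i j → i < t → j < t → node i ≡ node j → i ≡ j)
  (parent-root : parent (node 0) ≡ N)
  (parent-node : ∀ k → k < t → k ≢ 0 → ∃ λ j → j < k × parent (node k) ≡ node j)
  (separated : ∀ j k → j < k → k < t → ∀ e → e ∈ es (node k) → e ∈ es (node j) → e ∈ es (parent (node k)))
  where

  open Solving first second weight #v S N #e K N<S es unique short edges ends public
  open Elimination t node parent public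

  parent≤ : ∀ k → k < t → parent (node k) ≤ N
  parent≤ k k<t with k ≟ 0
  ... | yes refl = ≤-reflexive parent-root
  ... | no k≢0 with parent-node k k<t k≢0
  ...   | j , j<k , p≡ = ≤-trans (≤-reflexive p≡) (<⇒≤ (node< j (<-trans j<k k<t)))

  parent-earlier : ∀ j k → k ≤ j → j < t → parent (node k) ≢ node j
  parent-earlier j k k≤j j<t eq with k ≟ 0
  ... | yes refl = <⇒≢ (node< j j<t) (trans (sym eq) parent-root)
  ... | no k≢0 with parent-node k (≤-<-trans k≤j j<t) k≢0
  ...   | i , i<k , p≡ = <⇒≢ (<-≤-trans i<k k≤j) (node-injective i j (<-trans i<k (≤-<-trans k≤j j<t)) j<t (trans (sym p≡) eq))

  record Env (σ : State) : Set where
    field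
      ready   : Ready σ
      t≡      : scalar σ $t ≡ t
      queue≡  : array σ %queue ≡ node
      parent≡ : array σ %parent ≡ parent

  env-same : ∀ {P σ τ} {w : T (spares P ($V ∷ $S ∷ []) (%end₁ ∷ %end₂ ∷ %weight ∷ %row ∷ %mul ∷ %in ∷ []))}
             {w′ : T (spares P ($t ∷ []) (%queue ∷ %parent ∷ []))} → Same P σ τ → Env σ → Env τ
  env-same {w = w} {w′} s env with kept ($t ∷ []) (%queue ∷ %parent ∷ []) s w′
  ... | T≡ ∷ [] , Q≡ ∷ F≡ ∷ [] = record
    { ready = ready-same {w = w} s ready ; t≡ = trans T≡ t≡ ; queue≡ = trans Q≡ queue≡ ; parent≡ = trans F≡ parent≡ }
    where open Env env

  run-forward : ∀ {σ₀} → Env σ₀ → Holds (array σ₀ %bit) none → FreshLoads σ₀ →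
    (∀ x → array σ₀ %cost x ≡ 0) → (∀ x → array σ₀ %msg x ≡ 0) →
    Run forward σ₀ (2 + (2 + t * (2 + forwardStepTime K)))
      (λ τ → Forward 0 (array τ %cost) (array τ %msg) × Holds (array τ %bit) none)
  run-forward {σ₀} env₀ zeros fresh no-cost no-msg =
    straight-then λ s₁ →
    weaken ≤-refl (run-loop I (λ _ → proj₁) (λ s → body (env-same (s₁ ▹ s) env₀))
      (Env.t≡ env₀ , ≤-refl , record { sound = λ _ _ _ _ _ → ≤-trans (≤-reflexive (no-cost _)) z≤n ; unset = λ _ _ _ → no-msg _
                            ; eliminated = λ j t≤j j<t → ⊥-elim (<-irrefl refl (≤-<-trans t≤j j<t)) } , zeros , fresh))
      λ _ (_ , _ , fw , z , _) → fw , z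
    where
    I : ℕ → State → Set
    I n σ = scalar σ $k ≡ n × n ≤ t × Forward n (array σ %cost) (array σ %msg) × Holds (array σ %bit) none × FreshLoads σ
    body : ∀ {k σ} → Env σ → I (suc k) σ → scalar σ $k ≢ 0 × Run forwardStep σ (forwardStepTime K) (I k)
    body {k} {σ} env (k≡ , k<t , fw , zeros , fresh) = (λ z → case trans (sym k≡) z of λ ()) , (
      straight-then λ r₁ →
      straight-then λ r₂ →
      straight-then λ r₃ →
      let ready = Env.ready (env-same (r₁ ▹ r₂ ▹ r₃) env) in
      run-sweep ready c≡ p≡ c<N p≤N zeros fresh
        (λ x → Forward.unset fw k ≤-refl x) (Forward.sound fw) then-run λ {σ₂} s₂ ((sw , fresh₂) , zeros₂) →
      weaken ≤-refl
        (run-push (ready-same s₂ ready) (trans (scalars s₂ $c) c≡) (trans (scalars s₂ $p) p≡) (<⇒≤ c<N) p≤N zeros₂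
          (λ β B good → ≤-trans (proj₂ (proj₂ (Swept.treated sw β (code-bound (es c) β)))) (s≤s (Swept.sound sw c (<⇒≤ c<N) β B good)))
          (Swept.sound sw))
        λ {τ} s₃ (pu , zeros₃) →
          trans (scalars s₃ $k) (trans (scalars s₂ $k) (cong (_∸ 1) k≡)) , <⇒≤ k<t ,
          subst (Forward k _) (sym (arrays s₃ %msg))
            (forward-step k<t c<N p≤N (parent-earlier k k ≤-refl k<t) (λ j j<t j≢k → j≢k ∘ node-injective j k j<t k<t) node<
              (λ j k<j j<t → parent-earlier j k (<⇒≤ k<j) j<t ∘ sym) fw sw pu) ,
          zeros₃ , fresh-same s₃ fresh₂)
      where
      c = node k
      p = parent c
      c≡ : array σ %queue (scalar σ $k ∸ 1) ≡ c
      c≡ = at≡ (Env.queue≡ env) (cong (_∸ 1) k≡)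
      p≡ : array σ %parent (array σ %queue (scalar σ $k ∸ 1)) ≡ p
      p≡ = at≡ (Env.parent≡ env) c≡
      c<N : c < N
      c<N = node< k k<t
      p≤N : p ≤ N
      p≤N = parent≤ k k<t

  run-copy : ∀ {σ₀ c α ω₀} → Ready σ₀ → scalar σ₀ $c ≡ c → c ≤ N → Holds (array σ₀ %bit) α → Holds (array σ₀ %fixed) ω₀ →
    Run copy σ₀ (rowTime 1 K 6) (λ τ → ∃ λ ω → Holds (array τ %fixed) ω × Agree (es c) ω α × (∀ e → e ∉ es c → ω e ≡ ω₀ e))
  run-copy {σ₀} {c} {α} {ω₀} ready c≡ c≤ bits fixed =
    slower (rowTime-mono 1 6 (short c c≤))
      (run-row {xs = es c} J (Ready.stride ready) c≡ (Ready.rows ready c c≤) (λ _ j → j)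
        (λ {ts} {x} {_} {σ} _ s at (ω , h , agree , other) → run-straight
          (update ω x (α x) ,
           subst₂ (λ i b → Holds (update (array σ %fixed) i b) (update ω x (α x))) (sym at)
             (sym (trans (at≡ (arrays s %bit) at) (bits x))) (holds-update {array σ %fixed} x (α x) h) ,
           (λ {e} e∈ → agree′ ts x ω agree (∈-++⁻ ts e∈)) ,
           λ e e∉ → trans (update-neq ω {x} {e} (α x) λ { refl → e∉ (∈-++⁺ʳ ts (here refl)) }) (other e (e∉ ∘ ∈-++⁺ˡ))))
        (ω₀ , fixed , (λ ()) , λ _ _ → refl))
    where
    J : List ℕ → State → Set
    J ts σ = ∃ λ ω → Holds (array σ %fixed) ω × Agree ts ω α × (∀ e → e ∉ ts → ω e ≡ ω₀ e)
    agree′ : ∀ ts x ω → Agree ts ω α → ∀ {e} → e ∈ ts ⊎ e ∈ (x ∷ []) → update ω x (α x) e ≡ α e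
    agree′ ts x ω agree (inj₂ (here refl)) = update-eq ω x _ refl
    agree′ ts x ω agree {e} (inj₁ e∈) with x ≟ e
    ... | yes refl = update-eq ω x _ refl
    ... | no x≢e   = trans (update-neq ω _ x≢e) (agree e∈)

  -- `cheap` is conditional, so that it holds before any candidate has been tried; after the last
  -- one, `attained` supplies a `β` that meets the condition.
  record Refixed (c p : ℕ) (F G : ℕ → ℕ) (ω₀ : Choice) (s : ℕ) (ω : Choice) : Set where
    field
      outside : ∀ e → e ∉ es c → ω e ≡ ω₀ e
      shared  : ∀ e → e ∈ es c → e ∈ es p → ω e ≡ ω₀ e
      cheap   : ∀ β → code (es c) β < s → key c p β ≡ key c p ω₀ → suc (F (c + S * code (es c) β)) ≤ G (c + S * key c p ω₀) →
                suc (F (c + S * code (es c) ω)) ≤ G (c + S * key c p ω₀)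

  refixed-key : ∀ {c p F G ω₀ s ω} → Refixed c p F G ω₀ s ω → key c p ω ≡ key c p ω₀
  refixed-key {c} {p} {ω₀ = ω₀} {ω = ω} re = code-cong (es c) eq
    where
    eq : Agree (es c) (mask p ω) (mask p ω₀)
    eq {e} e∈ with e ∈? es p
    ... | yes e∈p = Refixed.shared re e e∈ e∈p
    ... | no _    = refl

  run-fix : ∀ {σ₀ c p ω₀} → Ready σ₀ → scalar σ₀ $c ≡ c → scalar σ₀ $p ≡ p → c ≤ N → p ≤ N →
    Holds (array σ₀ %bit) none → Holds (array σ₀ %fixed) ω₀ →
    Run fix σ₀ (2 + enumerateTime K (fixStepTime K))
      (λ τ → (∃ λ ω → Holds (array τ %fixed) ω × Refixed c p (array σ₀ %cost) (array σ₀ %msg) ω₀ (2 ^ length (es c)) ω) ×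
             Holds (array τ %bit) none)
  run-fix {σ₀} {c} {p} {ω₀} ready₀ c≡ p≡ c≤ p≤ zeros fixed =
    straight-then λ s₁ →
    slower (enumerateTime-mono {d = fixStepTime K} (short c c≤))
      (run-enumerate {i = c} J (Ready.stride ready₀) c≡ (Ready.rows ready₀ c c≤) (unique c c≤) zeros
        (λ s (ω , h , re) → ω , subst (λ A → Holds A ω) (sym (arrays s %fixed)) h , re)
        (λ α s h (ω , fx , re) → body α (ready-same (s₁ ▹ s) ready₀) (trans (scalars s $c) c≡) (trans (scalars s $p) p≡) (trans (scalars s $r) c≡)
                       (arrays s %cost) (arrays s %msg) h fx re)
        (ω₀ , fixed , record { outside = λ _ _ → refl ; shared = λ _ _ _ → refl ; cheap = λ _ () }))
    where
    F = array σ₀ %cost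
    G = array σ₀ %msg
    J : ℕ → State → Set
    J s σ = ∃ λ ω → Holds (array σ %fixed) ω × Refixed c p F G ω₀ s ω
    body : ∀ {σ ω} α → Ready σ → scalar σ $c ≡ c → scalar σ $p ≡ p → scalar σ $r ≡ c →
           array σ %cost ≡ F → array σ %msg ≡ G → Holds (array σ %bit) α → Holds (array σ %fixed) ω →
           Refixed c p F G ω₀ (code (es c) α) ω → Run fixStep σ (fixStepTime K) (J (suc (code (es c) α)))
    body {σ} {ω} α ready c≡ p≡ r≡ F≡ G≡ h fx re =
      run-encode-masked %fixed {α = ω} ready c≡ p≡ c≤ p≤ fx then-run λ {σ₁} s₁ a≡ →
      straight-then λ s₂ →
      let r₂ = s₁ ▹ s₂ in
      run-locate {α = α} (ready-same r₂ ready) (trans (scalars r₂ $c) c≡) (trans (scalars r₂ $p) p≡) (trans (scalars r₂ $r) r≡)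
        c≤ p≤ c≤ (subst (λ A → Holds A α) (sym (arrays r₂ %bit)) h) then-run λ {σ₃} s₃ (b≡ , a₃≡) →
      let r₃ = r₂ ▹ s₃ in
      decide σ₃ (trans (arrays r₃ %cost) F≡) (trans (arrays r₃ %msg) G≡) a₃≡ b≡ (trans (scalars s₃ $d) a≡)
        (ready-same r₃ ready) (trans (scalars r₃ $c) c≡)
        (subst (λ A → Holds A α) (sym (arrays r₃ %bit)) h) (subst (λ A → Holds A ω) (sym (arrays r₃ %fixed)) fx)
      where
      open Refixed re
      a = c + S * code (es c) α
      b = c + S * key c p α
      d = c + S * key c p ω
      test : ℕ
      test = (suc (F a) ∸ G b) + ((b ∸ d) + (d ∸ b))
      key-ω : key c p ω ≡ key c p ω₀
      key-ω = refixed-key {F = F} {G} re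
      skipped : test ≢ 0 → Refixed c p F G ω₀ (suc (code (es c) α)) ω
      skipped nz = record { outside = outside ; shared = shared ; cheap = cheap′ }
        where
        cheap′ : ∀ β → code (es c) β < suc (code (es c) α) → key c p β ≡ key c p ω₀ → suc (F (c + S * code (es c) β)) ≤ G (c + S * key c p ω₀) → _
        cheap′ β (s≤s le) keq fits with m≤n⇒m<n∨m≡n le
        ... | inj₁ lt = cheap β lt keq fits
        ... | inj₂ eq = ⊥-elim (nz (cong₂ _+_
                (trans (cong₂ (λ x y → suc (F (c + S * x)) ∸ G (c + S * y)) (sym eq) key-α) (m≤n⇒m∸n≡0 fits))
                (cong₂ _+_ (m≤n⇒m∸n≡0 (≤-reflexive b≡d)) (m≤n⇒m∸n≡0 (≤-reflexive (sym b≡d))))))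
          where
          key-α : key c p α ≡ key c p ω₀
          key-α = trans (sym (key-congˡ c {p} (code-injective (es c) {β} {α} eq))) keq
          b≡d : b ≡ d
          b≡d = cong (λ x → c + S * x) (trans key-α (sym key-ω))
      copied : ∀ {ω′} → test ≡ 0 → Agree (es c) ω′ α → (∀ e → e ∉ es c → ω′ e ≡ ω e) → Refixed c p F G ω₀ (suc (code (es c) α)) ω′
      copied {ω′} z agree other = record
        { outside = λ e e∉ → trans (other e e∉) (outside e e∉)
        ; shared  = λ e e∈c e∈p → trans (agree e∈c) (trans (sym (mask-true α e∈p))
                      (trans (code-injective (es c) {mask p α} {mask p ω} key≡ e∈c) (trans (mask-true ω e∈p) (shared e e∈c e∈p))))
        ; cheap   = λ _ _ _ _ → ≤-trans (≤-reflexive (cong (λ x → suc (F (c + S * x))) (code-cong (es c) agree)))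
                      (≤-trans (m∸n≡0⇒m≤n (m+n≡0⇒m≡0 (suc (F a) ∸ G b) z))
                               (≤-reflexive (cong (λ x → G (c + S * x)) (trans key≡ key-ω))))
        }
        where
        rest : (b ∸ d) + (d ∸ b) ≡ 0
        rest = m+n≡0⇒n≡0 (suc (F a) ∸ G b) z
        key≡ : key c p α ≡ key c p ω
        key≡ = proj₂ (address-injective (≤-<-trans c≤ N<S) (≤-<-trans c≤ N<S)
                 (≤-antisym (m∸n≡0⇒m≤n (m+n≡0⇒m≡0 (b ∸ d) rest)) (m∸n≡0⇒m≤n (m+n≡0⇒n≡0 (b ∸ d) rest))))
      decide : ∀ σ → array σ %cost ≡ F → array σ %msg ≡ G → scalar σ $a ≡ a → scalar σ $b ≡ b → scalar σ $d ≡ d →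
               Ready σ → scalar σ $c ≡ c → Holds (array σ %bit) α → Holds (array σ %fixed) ω →
               Run (if′ ((lit 1 ⊕ (%cost [ var $a ])) ⊖ (%msg [ var $b ])) ⊕ ((var $b ⊖ var $d) ⊕ (var $d ⊖ var $b)) then skip else copy)
                   σ (16 + (1 + rowTime 1 K 6)) (J (suc (code (es c) α)))
      decide σ F≡ G≡ a≡ b≡ d≡ ready c≡ h fx = run-if
        (λ nz → run-straight (ω , fx , skipped (nz ∘ trans test≡)))
        (λ z → weaken ≤-refl (run-copy {α = α} {ω} ready c≡ c≤ h fx) λ _ (ω′ , h′ , agree , other) →
                 ω′ , h′ , copied (trans (sym test≡) z) agree other)
        where
        test≡ : (suc (array σ %cost (scalar σ $a)) ∸ array σ %msg (scalar σ $b)) + ((scalar σ $b ∸ scalar σ $d) + (scalar σ $d ∸ scalar σ $b)) ≡ test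
        test≡ = cong₂ _+_ (cong₂ (λ x y → suc x ∸ y) (at≡ F≡ a≡) (at≡ G≡ b≡))
                          (cong₂ (λ x y → (x ∸ y) + (y ∸ x)) b≡ d≡)

  -- The message of the root without its shift. Bag `N` has no edges, so all choices have the same
  -- key there and `none` stands for any of them.
  bottleneck : (ℕ → ℕ) → ℕ
  bottleneck G = G (node 0 + S * key (node 0) N none) ∸ 1

  Within : (F : ℕ → ℕ) (X k : ℕ) → Choice → Set
  Within F X k ω = ∀ j → j < k → F (node j + S * code (es (node j)) ω) ≤ X

  -- The cost at the new bag is at most its message, which `covers` bounds by the cost already fixed
  -- at the parent; at the root the message itself is the bound.
  backward-step : ∀ {k F G ω₀ ω} → k < t → Forward 0 F G → Within F (bottleneck G) k ω₀ →
    Refixed (node k) (parent (node k)) F G ω₀ (2 ^ length (es (node k))) ω → Within F (bottleneck G) (suc k) ω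
  backward-step {k} {F} {G} {ω₀} {ω} k<t fw within re j (s≤s j≤k) with m≤n⇒m<n∨m≡n j≤k
  ... | inj₁ j<k = ≤-trans (≤-reflexive (cong (λ x → F (node j + S * x)) (code-cong (es (node j)) unchanged))) (within j j<k)
    where
    open Refixed re
    unchanged : Agree (es (node j)) ω ω₀
    unchanged {e} e∈j with e ∈? es (node k)
    ... | yes e∈k = shared e e∈k (separated j k j<k k<t e e∈k e∈j)
    ... | no e∉k  = outside e e∉k
  ... | inj₂ refl = s≤s⁻¹ (≤-trans fits (target≤ (k ≟ 0)))
    where
    open Refixed re
    c = node k
    p = parent c
    open Eliminated (Forward.eliminated fw k z≤n k<t) hiding (p)
    fits : suc (F (c + S * code (es c) ω)) ≤ G (c + S * key c p ω₀)
    fits = let β , keq , le = attained ω₀ in cheap β (code-bound (es c) β) keq le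
    root-key : ∀ {p} → p ≡ N → key c p ω₀ ≡ key c N none
    root-key refl = key-cong c {N} (λ {e} e∈ → case subst (e ∈_) es-N e∈ of λ ())
    target≤ : Dec (k ≡ 0) → G (c + S * key c p ω₀) ≤ suc (bottleneck G)
    target≤ (yes refl) = ≤-trans (m≤n+m∸n _ 1) (≤-reflexive (cong (λ x → suc (G (c + S * x) ∸ 1)) (root-key parent-root)))
    target≤ (no k≢0) with parent-node k k<t k≢0
    ... | i , i<k , p≡ = ≤-trans (covers ω₀) (s≤s (≤-trans (≤-reflexive (cong (λ d → F (d + S * code (es d) ω₀)) p≡)) (within i i<k)))

  -- Optimality against all choices at once, without naming the optimum: a bound that some choice
  -- respects at all bags is also respected by `ω`.
  Solution : Choice → Set
  Solution ω = ∀ β B → Good β B → ∀ j → j < t → peak (es (node j)) ω ≤ B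

  run-backward : ∀ {σ₀} → Env σ₀ → 0 < t → Forward 0 (array σ₀ %cost) (array σ₀ %msg) →
    Holds (array σ₀ %bit) none → (∀ x → array σ₀ %fixed x ≡ 0) →
    Run backward σ₀ (2 + (4 + t * (4 + backwardStepTime K))) (λ τ → ∃ λ ω → Holds (array τ %fixed) ω × Solution ω)
  run-backward {σ₀} env₀ 0<t fw zeros no-fixed =
    straight-then λ s₁ →
    weaken ≤-refl
      (run-upto I (λ s → Env.t≡ (env-same (s₁ ▹ s) env₀))
        (λ k<t s → body k<t (env-same (s₁ ▹ s) env₀) (arrays s %cost) (arrays s %msg))
        refl ((none , (λ _ → no-fixed _) , λ _ ()) , zeros))
      λ _ ((ω , h , within) , _) → ω , h , λ β B good j j<t →
        ≤-trans (Eliminated.heavy (Forward.eliminated fw j z≤n j<t) ω) (≤-trans (within j j<t) (bottleneck≤ β B good))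
    where
    F = array σ₀ %cost
    G = array σ₀ %msg
    bottleneck≤ : ∀ β B → Good β B → bottleneck G ≤ B
    bottleneck≤ β B good = ∸-monoˡ-≤ 1 (≤-trans (≤-reflexive (cong (λ x → G (node 0 + S * x)) (root-key parent-root)))
                                                 (Eliminated.valid (Forward.eliminated fw 0 z≤n 0<t) β B good))
      where
      root-key : ∀ {p} → p ≡ N → key (node 0) N none ≡ key (node 0) p β
      root-key refl = key-cong (node 0) {N} (λ {e} e∈ → case subst (e ∈_) es-N e∈ of λ ())
    I : ℕ → State → Set
    I k σ = (∃ λ ω → Holds (array σ %fixed) ω × Within F (bottleneck G) k ω) × Holds (array σ %bit) none
    body : ∀ {k σ} → k < t → Env σ → array σ %cost ≡ F → array σ %msg ≡ G → scalar σ $k ≡ k → I k σ →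
           Run backwardStep σ (backwardStepTime K) (λ τ → scalar τ $k ≡ suc k × I (suc k) τ)
    body {k} {σ} k<t env F≡ G≡ k≡ ((ω₀ , fixed , within) , zeros) =
      straight-then λ s₁ →
      straight-then λ s₂ →
      run-fix {c = c} {p} (Env.ready (env-same (s₁ ▹ s₂) env)) c≡ p≡
        (<⇒≤ (node< k k<t)) (parent≤ k k<t) zeros fixed then-run λ s₃ ((ω , h , re) , zeros₃) →
      run-straight
        (trans (cong (_+ 1) (trans (scalars s₃ $k) k≡)) (+-comm k 1) ,
         (ω , h , backward-step k<t fw within (subst₂ (λ F G → Refixed c p F G ω₀ (2 ^ length (es c)) ω) F≡ G≡ re)) , zeros₃)
      where
      c = node k
      p = parent c
      c≡ : array σ %queue (scalar σ $k) ≡ c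
      c≡ = at≡ (Env.queue≡ env) k≡
      p≡ : array σ %parent (array σ %queue (scalar σ $k)) ≡ p
      p≡ = at≡ (Env.parent≡ env) c≡

-- Adjacency lists

-- `%off` holds the length of each row times the stride, so that appending takes no multiplication.
link : Program
link =
  %adj [ var $u ⊕ (%off [ var $u ]) ]≔ var $e ⨟
  %off [ var $u ]≔ (%off [ var $u ]) ⊕ var $S

-- `$e` is raised before it is stored, as row entries are edge numbers plus one. The second `link`
-- is skipped for a loop, which thus occurs once in its row.
linkStep : Expr → Name → Name → Program
linkStep base A B =
  $u ≔ base ⊕ (A [ var $e ]) ⨟
  $v ≔ base ⊕ (B [ var $e ]) ⨟
  $e ≔ var $e ⊕ lit 1 ⨟
  link ⨟
  (if′ (var $u ⊖ var $v) ⊕ (var $v ⊖ var $u) then ($u ≔ var $v ⨟ link) else skip)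

linkAll : Name → Expr → Name → Name → Program
linkAll m base A B = $e ≔ lit 0 ⨟ (while var m ⊖ var $e loop linkStep base A B)

linkStepTime : ℕ → ℕ
linkStepTime b = (4 + b) + ((4 + b) + (4 + (12 + 23)))

linkAllTime : ℕ → ℕ → ℕ
linkAllTime b m = 2 + (4 + m * (4 + linkStepTime b))

record Linked (S : ℕ) (A O : ℕ → ℕ) (R : ℕ → List ℕ) : Set where
  field
    rows : Rows A S R
    ends : ∀ u → u < S → O u ≡ S * length (R u)

linked-cong : ∀ {S A O R R′} → (∀ u → u < S → R u ≡ R′ u) → Linked S A O R → Linked S A O R′
linked-cong {S} {A} R≡ l = record
  { rows = λ u u< → subst (Row A S u) (R≡ u u<) (rows u u<)
  ; ends = λ u u< → trans (ends u u<) (cong (λ r → S * length r) (R≡ u u<))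
  }
  where open Linked l

linked-insert : ∀ {S A O R u} x → Linked S A O R → u < S →
                Linked S (update A (u + O u) (suc x)) (update O u (O u + S)) (update R u (R u ∷ʳ x))
linked-insert {S} {A} {O} {R} {u} x l u<S = record
  { rows = subst (λ o → Rows (update A (u + o) (suc x)) S (update R u (R u ∷ʳ x))) (sym (ends u u<S)) (row-append {A} {R = R} x rows u<S)
  ; ends = ends′
  }
  where
  open Linked l
  ends′ : ∀ v → v < S → update O u (O u + S) v ≡ S * length (update R u (R u ∷ʳ x) v)
  ends′ v v<S with u ≟ v
  ... | no u≢v rewrite ≢⇒≡ᵇ-false u≢v = ends v v<S
  ... | yes refl rewrite ≡ᵇ-refl u = trans (cong (_+ S) (ends u u<S)) (trans (+-comm _ S) (trans (sym (*-suc S _)) (cong (S *_) (sym (length-∷ʳ (R u) x)))))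

run-link : ∀ {σ S R w k} → scalar σ $u ≡ w → w < S → scalar σ $e ≡ suc k → scalar σ $S ≡ S →
           Linked S (array σ %adj) (array σ %off) R →
           Run link σ 12 (λ τ → Linked S (array τ %adj) (array τ %off) (update R w (R w ∷ʳ k)))
run-link {σ} {S} {R} {w} {k} u≡ w<S e≡ S≡ l = run-straight (insert u≡ e≡ S≡)
  where
  A = array σ %adj
  O = array σ %off
  insert : ∀ {u e s} → u ≡ w → e ≡ suc k → s ≡ S → Linked S (update A (u + O u) e) (update O u (O u + s)) (update R w (R w ∷ʳ k))
  insert refl refl refl = linked-insert k l w<S

module _ (f g : ℕ → ℕ) where

  hit? : ∀ u e → Dec (f e ≡ u ⊎ g e ≡ u)
  hit? u e = (f e ≟ u) ⊎-dec (g e ≟ u)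

  hits : ℕ → ℕ → List ℕ
  hits k u = filter (hit? u) (upTo k)

  hits-suc : ∀ k u → hits (suc k) u ≡ hits k u ++ filter (hit? u) (k ∷ [])
  hits-suc k u = trans (cong (filter (hit? u)) (sym (upTo-∷ʳ k))) (filter-++ (hit? u) (upTo k) (k ∷ []))

  hits-yes : ∀ k {u} → f k ≡ u ⊎ g k ≡ u → hits (suc k) u ≡ hits k u ∷ʳ k
  hits-yes k {u} yes′ = trans (hits-suc k u) (cong (hits k u ++_) (filter-accept (hit? u) yes′))

  hits-no : ∀ k {u} → ¬ (f k ≡ u ⊎ g k ≡ u) → hits (suc k) u ≡ hits k u
  hits-no k {u} no′ = trans (hits-suc k u) (trans (cong (hits k u ++_) (filter-reject (hit? u) no′)) (++-identityʳ _))

  ∈-hits⁻ : ∀ {k u e} → e ∈ hits k u → e < k × (f e ≡ u ⊎ g e ≡ u)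
  ∈-hits⁻ {u = u} e∈ with ∈-filter⁻ (hit? u) e∈
  ... | e∈upTo , h = ∈-upTo⁻ e∈upTo , h

  ∈-hits⁺ : ∀ {k u e} → e < k → f e ≡ u ⊎ g e ≡ u → e ∈ hits k u
  ∈-hits⁺ {u = u} e< h = ∈-filter⁺ (hit? u) (∈-upTo⁺ e<) h

  unique-hits : ∀ k u → Unique (hits k u)
  unique-hits k u = Uniqueₚ.filter⁺ (hit? u) (Uniqueₚ.upTo⁺ k)

module _ {m : Name} {base : Expr} {A B : Name} where

  -- `R` records what the rows contain beforehand: the program runs once for `G` and once for the
  -- tree, on the same table.
  run-linkAll : ∀ {σ₀ S M} (f g : ℕ → ℕ) (R : ℕ → List ℕ)
    {_ : T (not (writesScalar (linkAll m base A B) m))} →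
    scalar σ₀ $S ≡ S → scalar σ₀ m ≡ M →
    (∀ {σ} → Same (linkAll m base A B) σ₀ σ → ∀ e → e < M →
       eval σ base + array σ A e ≡ f e × (∀ x → eval (setScalar σ $u x) base + array σ B e ≡ g e)) →
    (∀ e → e < M → f e < S × g e < S) →
    Linked S (array σ₀ %adj) (array σ₀ %off) R →
    Run (linkAll m base A B) σ₀ (linkAllTime (cost base) M)
        (λ τ → Linked S (array τ %adj) (array τ %off) (λ u → R u ++ hits f g M u))
  run-linkAll {σ₀} {S} {M} f g R {wm} stride m≡ ends bounds linked =
    straight-then λ s₁ →
    run-upto I (λ s → trans (scalars (enter s₁ s) m {wm}) m≡) (λ k<M s → body k<M (enter s₁ s))
      refl (linked-cong (λ u _ → sym (++-identityʳ (R u))) linked)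
    where
    I : ℕ → State → Set
    I k σ = Linked S (array σ %adj) (array σ %off) (λ u → R u ++ hits f g k u)
    enter : ∀ {σ τ} → Same ($e ≔ lit 0) σ₀ σ → Same (linkStep base A B) σ τ → Same (linkAll m base A B) σ₀ τ
    enter s s′ = same-trans (same-⨟ˡ s) (same-⨟ʳ {$e ≔ lit 0} (same (λ x {w} → scalars s′ x {w}) (λ a {w} → arrays s′ a {w})))
    body : ∀ {k σ} → k < M → Same (linkAll m base A B) σ₀ σ → scalar σ $e ≡ k → I k σ →
           Run (linkStep base A B) σ (linkStepTime (cost base)) (λ τ → scalar τ $e ≡ suc k × I (suc k) τ)
    body {k} {σ} k<M s refl l =
      slower (≤-reflexive time-eq)
       (straight-then λ _ →
        straight-then λ _ →
        straight-then λ _ →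
        run-link {w = f k} (proj₁ (ends s k k<M)) (proj₁ (bounds k k<M)) (+-comm k 1) (trans (scalars s $S) stride) l then-run λ s₄ l₁ →
        second (trans (scalars s₄ $u) (proj₁ (ends s k k<M))) (trans (scalars s₄ $v) (proj₂ (ends s k k<M) _)) (trans (scalars s₄ $e) (+-comm k 1))
               (trans (scalars s₄ $S) (trans (scalars s $S) stride)) l₁)
      where
      R₀ R₁ : ℕ → List ℕ
      R₀ u = R u ++ hits f g k u
      R₁ = update R₀ (f k) (R₀ (f k) ∷ʳ k)
      time-eq : (1 + suc (cost base + 2)) + ((1 + suc (cost base + 2)) + (4 + (12 + 23))) ≡ linkStepTime (cost base)
      time-eq rewrite +-comm (cost base) 2 = refl
      u≢v : ℕ
      u≢v = (f k ∸ g k) + (g k ∸ f k)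
      different : u≢v ≢ 0 → f k ≢ g k
      different nz eq = nz (cong₂ _+_ (m≤n⇒m∸n≡0 (≤-reflexive eq)) (m≤n⇒m∸n≡0 (≤-reflexive (sym eq))))
      coincide : u≢v ≡ 0 → f k ≡ g k
      coincide z = ≤-antisym (m∸n≡0⇒m≤n (m+n≡0⇒m≡0 (f k ∸ g k) z)) (m∸n≡0⇒m≤n (m+n≡0⇒n≡0 (f k ∸ g k) z))
      both : f k ≢ g k → ∀ u → u < S → update R₁ (g k) (R₁ (g k) ∷ʳ k) u ≡ R u ++ hits f g (suc k) u
      both f≢g u _ with g k ≟ u
      ... | yes refl = trans (update-eq R₁ (g k) _ refl) (trans (cong (_∷ʳ k) (update-neq R₀ _ f≢g))
                         (trans (++-assoc (R u) _ _) (cong (R u ++_) (sym (hits-yes f g k (inj₂ refl))))))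
      ... | no g≢u with f k ≟ u
      ...   | yes refl = trans (update-neq R₁ _ g≢u) (trans (update-eq R₀ (f k) _ refl)
                           (trans (++-assoc (R u) _ _) (cong (R u ++_) (sym (hits-yes f g k (inj₁ refl))))))
      ...   | no f≢u   = trans (update-neq R₁ _ g≢u) (trans (update-neq R₀ _ f≢u)
                           (cong (R u ++_) (sym (hits-no f g k [ f≢u , g≢u ]′))))
      one : f k ≡ g k → ∀ u → u < S → R₁ u ≡ R u ++ hits f g (suc k) u
      one f≡g u _ with f k ≟ u
      ... | yes refl = trans (update-eq R₀ (f k) _ refl)
                         (trans (++-assoc (R u) _ _) (cong (R u ++_) (sym (hits-yes f g k (inj₁ refl)))))
      ... | no f≢u   = trans (update-neq R₀ _ f≢u) (cong (R u ++_) (sym (hits-no f g k [ f≢u , f≢u ∘ trans f≡g ]′)))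
      second : ∀ {τ} → scalar τ $u ≡ f k → scalar τ $v ≡ g k → scalar τ $e ≡ suc k → scalar τ $S ≡ S → Linked S (array τ %adj) (array τ %off) R₁ →
               Run (if′ (var $u ⊖ var $v) ⊕ (var $v ⊖ var $u) then ($u ≔ var $v ⨟ link) else skip) τ 23 (λ τ → scalar τ $e ≡ suc k × I (suc k) τ)
      second {τ} u≡ v≡ e≡ S≡ l₁ = run-if
        (λ nz → straight-then λ _ →
                weaken ≤-refl (run-link v≡ (proj₂ (bounds k k<M)) e≡ S≡ l₁) λ s l₂ →
                  trans (scalars s $e) e≡ , linked-cong (both (different (nz ∘ trans test≡))) l₂)
        (λ z → run-straight (e≡ , linked-cong (one (coincide (trans (sym test≡) z))) l₁))
        where
        test≡ : (scalar τ $u ∸ scalar τ $v) + (scalar τ $v ∸ scalar τ $u) ≡ u≢v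
        test≡ = cong₂ (λ x y → (x ∸ y) + (y ∸ x)) u≡ v≡

-- Rooting the tree

-- The other end of an edge is the sum of its ends minus `$x`. As `$t` is raised before it is
-- stored, `%pos` holds queue positions plus one, and zero means not yet found.
discover : Program
discover =
  $e ≔ (%adj [ var $q ]) ⊖ lit 1 ⨟
  $y ≔ (%tree₁ [ var $e ]) ⊕ (%tree₂ [ var $e ]) ⊖ var $x ⨟
  (if′ %pos [ var $y ]
   then skip
   else (%queue [ var $t ]≔ var $y ⨟
         $t ≔ var $t ⊕ lit 1 ⨟
         %pos [ var $y ]≔ var $t ⨟
         %parent [ var $y ]≔ var $x))

visit : Program
visit =
  $x ≔ %queue [ var $h ] ⨟
  forRow %adj (var $x) discover ⨟
  $h ≔ var $h ⊕ lit 1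

-- Breadth-first search of the tree from node 0, which is already in the queue as all cells are zero at the start.
explore : Program
explore =
  %pos [ lit 0 ]≔ lit 1 ⨟
  %parent [ lit 0 ]≔ var $N ⨟
  $t ≔ lit 1 ⨟
  $h ≔ lit 0 ⨟
  (while var $t ⊖ var $h loop visit)

-- Paid per node and per row entry: 16 for taking a node from the queue and 37 for each entry of its
-- row, of which there are at most `m + m` in all.
exploreTime : ℕ → ℕ → ℕ
exploreTime N m = 14 + (N * 16 + (m + m) * 37)

injective-bound : ∀ {t N} (Q : ℕ → ℕ) → (∀ k → k < t → Q k < N) →
                  (∀ i j → i < t → j < t → Q i ≡ Q j → i ≡ j) → t ≤ N
injective-bound Q Q< inj = Finₚ.injective⇒≤ {f = λ i → fromℕ< (Q< (toℕ i) (Finₚ.toℕ<n i))}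
  λ {i} {j} eq → Finₚ.toℕ-injective (inj _ _ (Finₚ.toℕ<n i) (Finₚ.toℕ<n j) (Finₚ.fromℕ<-injective _ _ (Q< _ (Finₚ.toℕ<n i)) (Q< _ (Finₚ.toℕ<n j)) eq))

module Exploring (N m : ℕ) (f g : ℕ → ℕ) (bounds : ∀ e → e < m → f e < N × g e < N) where

  Ends : ℕ → ℕ → ℕ → Set
  Ends e x y = (f e ≡ x × g e ≡ y) ⊎ (f e ≡ y × g e ≡ x)

  record Explored (t : ℕ) (Q pos par : ℕ → ℕ) : Set where
    field
      nonempty : 0 < t
      root     : Q 0 ≡ 0
      top      : par 0 ≡ N
      queue    : ∀ k → k < t → Q k < N × pos (Q k) ≡ suc k
      visited  : ∀ x → pos x ≢ 0 → ∃ λ k → k < t × Q k ≡ x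
      parents  : ∀ k → k < t → k ≢ 0 → ∃ λ j → j < k × par (Q k) ≡ Q j × ∃ λ e → e < m × Ends e (Q j) (Q k)

    queue-injective : ∀ i j → i < t → j < t → Q i ≡ Q j → i ≡ j
    queue-injective i j i<t j<t eq = suc-injective (trans (sym (proj₂ (queue i i<t))) (trans (cong pos eq) (proj₂ (queue j j<t))))

    t≤N : t ≤ N
    t≤N = injective-bound Q (λ k k<t → proj₁ (queue k k<t)) queue-injective

  Seen : (ℕ → ℕ) → ℕ → Set
  Seen pos e = pos (f e) ≢ 0 × pos (g e) ≢ 0

  -- Once the whole queue has been scanned, this says that neighbours of found nodes are found;
  -- connectedness then yields every node.
  Closed : ℕ → (ℕ → ℕ) → (ℕ → ℕ) → Set
  Closed h Q pos = ∀ k → k < h → ∀ e → e < m → f e ≡ Q k ⊎ g e ≡ Q k → Seen pos e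

  update-visited : ∀ {pos y v x} → v ≢ 0 → pos x ≢ 0 → update pos y v x ≢ 0
  update-visited {pos} {y} {v} {x} v≢0 nz with y ≟ x
  ... | yes refl = v≢0 ∘ trans (sym (update-eq pos y v refl))
  ... | no y≢x   = nz ∘ trans (sym (update-neq pos v y≢x))

  explored-insert : ∀ {t Q pos par h y} e → Explored t Q pos par → h < t → y < N → pos y ≡ 0 → e < m → Ends e (Q h) y →
    Explored (suc t) (update Q t y) (update pos y (suc t)) (update par y (Q h))
  explored-insert {t} {Q} {pos} {par} {h} {y} e ex h<t y<N new e<m between = record
    { nonempty = s≤s z≤n
    ; root     = trans (old nonempty) root
    ; top      = trans (update-neq par _ λ y≡0 → case trans (sym new) (trans (cong pos (trans y≡0 (sym root))) (proj₂ (queue 0 nonempty))) of λ ()) top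
    ; queue    = queue′
    ; visited  = visited′
    ; parents  = parents′
    }
    where
    open Explored ex
    old : ∀ {k} → k < t → update Q t y k ≡ Q k
    old k<t = update-neq Q y (<⇒≢ k<t ∘ sym)
    y≢ : ∀ {k} → k < t → y ≢ Q k
    y≢ {k} k<t eq = case trans (sym new) (trans (cong pos eq) (proj₂ (queue k k<t))) of λ ()
    queue′ : ∀ k → k < suc t → update Q t y k < N × update pos y (suc t) (update Q t y k) ≡ suc k
    queue′ k (s≤s k≤t) with m≤n⇒m<n∨m≡n k≤t
    ... | inj₁ k<t rewrite old k<t = proj₁ (queue k k<t) , trans (update-neq pos _ (y≢ k<t)) (proj₂ (queue k k<t))
    ... | inj₂ refl rewrite update-eq Q t y refl = y<N , update-eq pos y _ refl
    visited′ : ∀ x → update pos y (suc t) x ≢ 0 → ∃ λ k → k < suc t × update Q t y k ≡ x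
    visited′ x nz with y ≟ x
    ... | yes refl = t , ≤-refl , update-eq Q t y refl
    ... | no y≢x with visited x (nz ∘ trans (update-neq pos _ y≢x))
    ...   | k , k<t , eq = k , m<n⇒m<1+n k<t , trans (old k<t) eq
    parents′ : ∀ k → k < suc t → k ≢ 0 → ∃ λ j → j < k × update par y (Q h) (update Q t y k) ≡ update Q t y j ×
               ∃ λ e → e < m × Ends e (update Q t y j) (update Q t y k)
    parents′ k (s≤s k≤t) k≢0 with m≤n⇒m<n∨m≡n k≤t
    ... | inj₂ refl rewrite update-eq Q t y refl =
      h , h<t , trans (update-eq par y _ refl) (sym (old h<t)) , e , e<m , subst (λ x → Ends e x y) (sym (old h<t)) between
    ... | inj₁ k<t rewrite old k<t with parents k k<t k≢0
    ...   | j , j<k , p≡ , e′ , e′<m , b = j , j<k , trans (update-neq par _ (y≢ k<t)) (trans p≡ (sym (old (<-trans j<k k<t)))) ,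
            e′ , e′<m , subst (λ x → Ends e′ x (Q k)) (sym (old (<-trans j<k k<t))) b

  used : ℕ → (ℕ → ℕ) → ℕ → ℕ
  used m Q zero    = 0
  used m Q (suc h) = used m Q h + length (hits f g m (Q h))

  used-cong : ∀ m {Q Q′} h → (∀ k → k < h → Q k ≡ Q′ k) → used m Q h ≡ used m Q′ h
  used-cong m zero    eq = refl
  used-cong m (suc h) eq = cong₂ _+_ (used-cong m h λ k k<h → eq k (m<n⇒m<1+n k<h)) (cong (length ∘ hits f g m) (eq h ≤-refl))

  occurrences : ℕ → (ℕ → ℕ) → ℕ → ℕ
  occurrences u Q zero    = 0
  occurrences u Q (suc h) = occurrences u Q h + bit (u ≡ᵇ Q h)

  occurrences-none : ∀ u Q h → (∀ k → k < h → u ≢ Q k) → occurrences u Q h ≡ 0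
  occurrences-none u Q zero    _ = refl
  occurrences-none u Q (suc h) d rewrite ≢⇒≡ᵇ-false (d h ≤-refl) =
    trans (+-identityʳ _) (occurrences-none u Q h λ k k<h → d k (m<n⇒m<1+n k<h))

  occurrences≤1 : ∀ u Q h → (∀ i j → i < h → j < h → Q i ≡ Q j → i ≡ j) → occurrences u Q h ≤ 1
  occurrences≤1 u Q zero    _   = z≤n
  occurrences≤1 u Q (suc h) inj with u ≟ Q h
  ... | yes refl rewrite ≡ᵇ-refl (Q h) | occurrences-none (Q h) Q h (λ k k<h eq → <⇒≢ k<h (inj k h (m<n⇒m<1+n k<h) ≤-refl (sym eq))) = ≤-refl
  ... | no u≢ rewrite ≢⇒≡ᵇ-false u≢ | +-identityʳ (occurrences u Q h) =
    occurrences≤1 u Q h λ i j i<h j<h → inj i j (m<n⇒m<1+n i<h) (m<n⇒m<1+n j<h)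

  used-suc : ∀ m Q h → used (suc m) Q h ≤ used m Q h + (occurrences (f m) Q h + occurrences (g m) Q h)
  used-suc m Q zero    = z≤n
  used-suc m Q (suc h) = begin
    used (suc m) Q h + length (hits f g (suc m) (Q h))
      ≤⟨ +-mono-≤ (used-suc m Q h) hit ⟩
    used m Q h + (occurrences (f m) Q h + occurrences (g m) Q h) + (length (hits f g m (Q h)) + (bit (f m ≡ᵇ Q h) + bit (g m ≡ᵇ Q h)))
      ≡⟨ regroup (used m Q h) (occurrences (f m) Q h) (occurrences (g m) Q h) (length (hits f g m (Q h))) (bit (f m ≡ᵇ Q h)) (bit (g m ≡ᵇ Q h)) ⟩
    used m Q h + length (hits f g m (Q h)) + (occurrences (f m) Q h + bit (f m ≡ᵇ Q h) + (occurrences (g m) Q h + bit (g m ≡ᵇ Q h))) ∎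
    where
    open ≤-Reasoning
    regroup : ∀ u o p l a b → u + (o + p) + (l + (a + b)) ≡ u + l + (o + a + (p + b))
    regroup = solve-∀
    hit : length (hits f g (suc m) (Q h)) ≤ length (hits f g m (Q h)) + (bit (f m ≡ᵇ Q h) + bit (g m ≡ᵇ Q h))
    hit with f m ≟ Q h | g m ≟ Q h
    ... | yes f≡ | _ rewrite hits-yes f g m {Q h} (inj₁ f≡) | length-∷ʳ (hits f g m (Q h)) m | f≡ | ≡ᵇ-refl (Q h) =
      ≤-trans (≤-reflexive (+-comm 1 _)) (+-monoʳ-≤ (length (hits f g m (Q h))) (s≤s z≤n))
    ... | no f≢ | yes g≡ rewrite hits-yes f g m {Q h} (inj₂ g≡) | length-∷ʳ (hits f g m (Q h)) m | g≡ | ≡ᵇ-refl (Q h) =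
      ≤-trans (≤-reflexive (+-comm 1 _)) (+-monoʳ-≤ (length (hits f g m (Q h))) (m≤n+m 1 (bit (f m ≡ᵇ Q h))))
    ... | no f≢ | no g≢ rewrite hits-no f g m {Q h} [ f≢ , g≢ ]′ = m≤m+n _ _

  -- Induction on the edges rather than on the queue: one more edge lengthens only the rows of its
  -- ends, and each of these occurs at most once in the queue.
  used-bound : ∀ m Q h → (∀ i j → i < h → j < h → Q i ≡ Q j → i ≡ j) → used m Q h ≤ m + m
  used-bound zero    Q h inj = ≤-reflexive (nothing h)
    where
    nothing : ∀ h → used 0 Q h ≡ 0
    nothing zero    = refl
    nothing (suc h) = trans (+-identityʳ _) (nothing h)
  used-bound (suc m) Q h inj = ≤-trans (used-suc m Q h) (≤-trans
    (+-mono-≤ (used-bound m Q h inj) (+-mono-≤ (occurrences≤1 (f m) Q h inj) (occurrences≤1 (g m) Q h inj)))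
    (≤-reflexive (two m)))
    where
    two : ∀ m → m + m + (1 + 1) ≡ suc m + suc m
    two = solve-∀

  run-explore : ∀ {σ₀ S R} → scalar σ₀ $S ≡ S → scalar σ₀ $N ≡ N → 0 < N → N ≤ S → array σ₀ %tree₁ ≡ f → array σ₀ %tree₂ ≡ g →
    Rows (array σ₀ %adj) S R → (∀ x → x < N → R x ≡ hits f g m x) →
    (∀ x → array σ₀ %queue x ≡ 0) → (∀ x → array σ₀ %pos x ≡ 0) →
    Run explore σ₀ (exploreTime N m)
        (λ τ → Explored (scalar τ $t) (array τ %queue) (array τ %pos) (array τ %parent) ×
               Closed (scalar τ $t) (array τ %queue) (array τ %pos))
  run-explore {σ₀} {S} {R} stride N≡ 0<N N≤S f≡ g≡ rows R≡ no-queue no-pos =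
    slower (≤-reflexive (start-time (N * 16) ((m + m) * 37))) (
    straight-then λ _ →
    straight-then λ _ →
    straight-then λ _ →
    straight-then λ _ →
    run-while I step (0 , N , m + m , refl , refl , refl , refl , z≤n , started , λ _ ()))
    where
    σ₁ : State
    σ₁ = setScalar (setScalar (setCell (setCell σ₀ %pos 0 1) %parent 0 (scalar σ₀ $N)) $t 1) $h 0
    start-time : ∀ a b → 3 + (3 + (2 + (2 + (4 + (a + b))))) ≡ 14 + (a + b)
    start-time _ _ = refl
    State′ : State → Set
    State′ σ = Explored (scalar σ $t) (array σ %queue) (array σ %pos) (array σ %parent)
    started : State′ σ₁
    started = record
      { nonempty = s≤s z≤n
      ; root     = no-queue 0
      ; top      = N≡
      ; queue    = λ { zero (s≤s z≤n) → subst (_< N) (sym (no-queue 0)) 0<N , cong (update (array σ₀ %pos) 0 1) (no-queue 0) }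
      ; visited  = λ { zero _ → 0 , s≤s z≤n , no-queue 0 ; (suc x) nz → ⊥-elim (nz (no-pos (suc x))) }
      ; parents  = λ { zero _ k≢0 → ⊥-elim (k≢0 refl) ; (suc k) (s≤s ()) }
      }
    -- `r` counts the queue positions and `s` the row entries not yet paid for. The budget depends
    -- on these alone, so it requires no knowledge of how far the queue will grow.
    I : ℕ → State → Set
    I n σ = ∃ λ h → ∃ λ r → ∃ λ s → scalar σ $h ≡ h × N ≡ h + r × used m (array σ %queue) h + s ≡ m + m ×
            n ≡ 4 + (r * 16 + s * 37) × h ≤ scalar σ $t × State′ σ × Closed h (array σ %queue) (array σ %pos)
    J : ℕ → ℕ → State → List ℕ → State → Set
    J h x σ ts τ = h < scalar τ $t × State′ τ × (∀ k → k ≤ h → array τ %queue k ≡ array σ %queue k) ×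
                   Closed h (array τ %queue) (array τ %pos) × (∀ e → e ∈ ts → Seen (array τ %pos) e)
    step : ∀ {n σ} → Same visit σ₁ σ → I n σ →
           (scalar σ $t ∸ scalar σ $h ≡ 0 × (State′ σ × Closed (scalar σ $t) (array σ %queue) (array σ %pos)) × 4 ≤ n) ⊎
           (scalar σ $t ∸ scalar σ $h ≢ 0 × ∃ λ b → Run visit σ b (λ τ → ∃ λ n′ → I n′ τ × 4 + b + n′ ≤ n))
    step {n} {σ} sm (h , r , s , refl , N≡h+r , used≡ , refl , h≤t , ex , closed) with m≤n⇒m<n∨m≡n h≤t
    ... | inj₂ h≡t = inj₁ (m≤n⇒m∸n≡0 (≤-reflexive (sym h≡t)) , (ex , subst (λ h → Closed h (array σ %queue) (array σ %pos)) h≡t closed) , m≤m+n 4 _)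
    ... | inj₁ h<t = inj₂ ((λ z → <⇒≱ h<t (m∸n≡0⇒m≤n z)) , 3 + (rowTime 1 (length es) 30 + 4) ,
        (straight-then λ _ →
         run-row {xs = es} (J h x σ) (trans (scalars sm $S) stride) refl
           (subst₂ (λ A xs → Row A S x xs) (sym (arrays sm %adj)) (R≡ x x<N) (rows x (<-≤-trans x<N N≤S)))
           (λ _ j → j)
           (λ {ts} {e} eq s′ at j → discovered {ts} e eq s′ at j)
           (h<t , ex , (λ _ _ → refl) , closed , λ _ ()) then-run λ {τ} s′ (h<t′ , ex′ , Q≡ , closed′ , seen) →
         run-straight (4 + (proj₁ left * 16 + rest * 37) ,
           (suc h , proj₁ left , rest , trans (cong (_+ 1) (scalars s′ $h)) (+-comm h 1) , trans N≡h+r (trans (cong (h +_) (proj₂ left)) (+-suc h _)) ,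
            trans (cong (_+ rest) (used-cong m (suc h) λ k k<h → Q≡ k (s≤s⁻¹ k<h))) used′ , refl , h<t′ , ex′ ,
            λ k k<h → finished τ Q≡ closed′ seen k (m≤n⇒m<n∨m≡n (s≤s⁻¹ k<h))) ,
           ≤-reflexive (budget (length es) (proj₁ left) rest r s (proj₂ left) s≡))))
      where
      open Explored ex
      x = array σ %queue h
      x<N : x < N
      x<N = proj₁ (queue h h<t)
      σ₂ = setScalar σ $x x
      es = hits f g m x
      left : ∃ λ r′ → r ≡ suc r′
      left = positive r N≡h+r
        where
        positive : ∀ r → N ≡ h + r → ∃ λ r′ → r ≡ suc r′
        positive zero    eq = ⊥-elim (<⇒≱ (<-≤-trans h<t t≤N) (≤-reflexive (trans eq (+-identityʳ h))))
        positive (suc r) _  = r , refl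
      rest = (m + m) ∸ used m (array σ %queue) (suc h)
      used′ : used m (array σ %queue) (suc h) + rest ≡ m + m
      used′ = m+[n∸m]≡n (used-bound m (array σ %queue) (suc h) λ i j i≤ j≤ → queue-injective i j (<-≤-trans i≤ h<t) (<-≤-trans j≤ h<t))
      s≡ : s ≡ length es + rest
      s≡ = +-cancelˡ-≡ (used m (array σ %queue) h) s _ (trans used≡ (trans (sym used′) (+-assoc (used m (array σ %queue) h) _ _)))
      budget : ∀ l r′ rest r s → r ≡ suc r′ → s ≡ l + rest → 4 + (3 + (4 + 1 + l * 37 + 4)) + (4 + (r′ * 16 + rest * 37)) ≡ 4 + (r * 16 + s * 37)
      budget l r′ rest _ _ refl refl = balance l r′ rest
        where
        balance : ∀ l r′ rest → 4 + (3 + (4 + 1 + l * 37 + 4)) + (4 + (r′ * 16 + rest * 37)) ≡ 4 + (suc r′ * 16 + (l + rest) * 37)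
        balance = solve-∀
      finished : ∀ τ → (∀ k → k ≤ h → array τ %queue k ≡ array σ %queue k) → Closed h (array τ %queue) (array τ %pos) →
                 (∀ e → e ∈ es → Seen (array τ %pos) e) →
                 ∀ k → k < h ⊎ k ≡ h → ∀ e → e < m → f e ≡ array τ %queue k ⊎ g e ≡ array τ %queue k → Seen (array τ %pos) e
      finished τ Q≡ closed seen k (inj₁ k<h) = closed k k<h
      finished τ Q≡ closed seen k (inj₂ refl) e e<m touch rewrite Q≡ h ≤-refl = seen e (∈-hits⁺ f g e<m touch)
      discovered : ∀ {ts rs τ} e → es ≡ ts ++ e ∷ rs → Same (forRow %adj (var $x) discover) σ₂ τ →
                   array τ %adj (scalar τ $q) ≡ suc e → J h x σ ts τ → Run discover τ 30 (J h x σ (ts ∷ʳ e))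
      discovered {ts} {rs} {τ} e eq s′ at (h<t , ex , Q≡ , closed , seen) =
        straight-then λ _ →
        straight-then λ _ →
        run-if
          (λ nz → run-straight (h<t , ex , Q≡ , closed , λ e′ e′∈ → [ seen e′ , (λ { (here refl) → both-seen pos x-seen nz }) ]′ (∈-++⁻ ts e′∈)))
          (λ z → run-straight
            (<-≤-trans h<t (m≤m+n t 1) ,
             subst₂ (λ t′ x′ → Explored t′ (update Q t Y) (update pos Y t′) (update (array τ %parent) Y x′)) (+-comm 1 t) Qh≡x
               (explored-insert e ex h<t (subst (_< N) (sym Y≡) (other< touch)) z e<m (subst₂ (Ends e) (sym Qh≡) (sym Y≡) (ends touch))) ,
             (λ k k≤h → trans (update-neq Q Y (<⇒≢ (≤-<-trans k≤h h<t) ∘ sym)) (Q≡ k k≤h)) ,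
             (λ k k<h e′ e′<m touch′ → visited-seen e′
               (closed k k<h e′ e′<m (subst (λ v → f e′ ≡ v ⊎ g e′ ≡ v) (update-neq Q Y (<⇒≢ (<-trans k<h h<t) ∘ sym)) touch′))) ,
             λ e′ e′∈ → [ visited-seen e′ ∘ seen e′ ,
               (λ { (here refl) → both-seen (update pos Y (t + 1)) (update-visited {pos} {Y} t+1≢0 x-seen) (t+1≢0 ∘ trans (sym (update-eq pos Y (t + 1) refl))) }) ]′ (∈-++⁻ ts e′∈)))
        where
        t   = scalar τ $t
        Q   = array τ %queue
        pos = array τ %pos
        E   = array τ %adj (scalar τ $q) ∸ 1
        Y   = (array τ %tree₁ E + array τ %tree₂ E) ∸ scalar τ $x
        e∈ : e ∈ es
        e∈ = subst (e ∈_) (sym eq) (∈-++⁺ʳ ts (here refl))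
        e<m = proj₁ (∈-hits⁻ f g {m} {x} e∈)
        touch : f e ≡ x ⊎ g e ≡ x
        touch = proj₂ (∈-hits⁻ f g {m} {x} e∈)
        Qh≡ : Q h ≡ x
        Qh≡ = Q≡ h ≤-refl
        Qh≡x : Q h ≡ scalar τ $x
        Qh≡x = trans Qh≡ (sym (scalars s′ $x))
        x-seen : pos x ≢ 0
        x-seen z = case trans (sym z) (trans (cong pos (sym Qh≡)) (proj₂ (Explored.queue ex h h<t))) of λ ()
        other : f e ≡ x ⊎ g e ≡ x → ℕ
        other (inj₁ _) = g e
        other (inj₂ _) = f e
        other< : ∀ touch → other touch < N
        other< (inj₁ _) = proj₂ (bounds e e<m)
        other< (inj₂ _) = proj₁ (bounds e e<m)
        ends : ∀ touch → Ends e x (other touch)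
        ends (inj₁ f≡) = inj₁ (f≡ , refl)
        ends (inj₂ g≡) = inj₂ (refl , g≡)
        Y≡ : Y ≡ other touch
        Y≡ = trans (cong₂ _∸_ (cong₂ _+_ (at≡ tree₁≡ (cong (_∸ 1) at)) (at≡ tree₂≡ (cong (_∸ 1) at))) (scalars s′ $x))
                   (difference touch)
          where
          tree₁≡ : array τ %tree₁ ≡ f
          tree₁≡ = trans (arrays s′ %tree₁) (trans (arrays sm %tree₁) f≡)
          tree₂≡ : array τ %tree₂ ≡ g
          tree₂≡ = trans (arrays s′ %tree₂) (trans (arrays sm %tree₂) g≡)
          difference : ∀ touch → (f e + g e) ∸ x ≡ other touch
          difference (inj₁ f≡) = trans (cong (f e + g e ∸_) (sym f≡)) (m+n∸m≡n (f e) (g e))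
          difference (inj₂ g≡) = trans (cong (f e + g e ∸_) (sym g≡)) (m+n∸n≡m (f e) (g e))
        both-seen : ∀ P → P x ≢ 0 → P Y ≢ 0 → Seen P e
        both-seen P x≢ Y≢ = both touch (Y≢ ∘ trans (cong P Y≡))
          where
          both : ∀ touch → P (other touch) ≢ 0 → Seen P e
          both (inj₁ f≡) o≢ = x≢ ∘ trans (cong P (sym f≡)) , o≢
          both (inj₂ g≡) o≢ = o≢ , x≢ ∘ trans (cong P (sym g≡))
        t+1≢0 : t + 1 ≢ 0
        t+1≢0 z = case trans (+-comm 1 t) z of λ ()
        visited-seen : ∀ e′ → Seen pos e′ → Seen (update pos Y (t + 1)) e′
        visited-seen e′ (f≢ , g≢) = update-visited {pos} {Y} t+1≢0 f≢ , update-visited {pos} {Y} t+1≢0 g≢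

-- The edges at the bags

-- Tabulates the products of the stride with the raised edge numbers, which occur in the addresses
-- of the flags in `%in`.
multiples : Program
multiples =
  $e ≔ lit 0 ⨟
  $y ≔ var $S ⨟
  (while var $E ⊖ var $e loop
    ($e ≔ var $e ⊕ lit 1 ⨟
     %mul [ var $e ]≔ var $y ⨟
     $y ≔ var $y ⊕ var $S))

flag : Expr
flag = var $i ⊕ (%mul [ %adj [ var $q ] ])

append : Program
append =
  %in [ flag ]≔ lit 1 ⨟
  %row [ var $i ⊕ var $lo ]≔ %adj [ var $q ] ⨟
  $lo ≔ var $lo ⊕ var $S

-- The flags in `%in` serve twice: here they keep the rows free of repetitions, later they tell
-- `masked` which edges belong to a bag.
collectEdge : Program
collectEdge = if′ %in [ flag ] then skip else append

collectVertex : Program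
collectVertex =
  $u ≔ var $N ⊕ (%bag [ var $ptr ]) ⨟
  forRow %adj (var $u) collectEdge ⨟
  $ptr ≔ var $ptr ⊕ lit 1 ⨟
  $j ≔ var $j ⊖ lit 1

collectBag : Program
collectBag =
  $lo ≔ lit 0 ⨟
  $j ≔ %size [ var $i ] ⨟
  (while var $j loop collectVertex) ⨟
  $i ≔ var $i ⊕ lit 1

collect : Program
collect = $i ≔ lit 0 ⨟ $ptr ≔ lit 0 ⨟ (while var $N ⊖ var $i loop collectBag)

multiplesTime : ℕ → ℕ
multiplesTime #e = 8 + #e * 15

collectVertexTime : ℕ → ℕ
collectVertexTime D = 5 + (rowTime 1 D 25 + 8)

collectBagTime : ℕ → ℕ → ℕ
collectBagTime L D = 2 + (3 + ((2 + L * (2 + collectVertexTime D)) + 4))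

collectTime : ℕ → ℕ → ℕ → ℕ
collectTime N L D = 2 + (2 + (4 + N * (4 + collectBagTime L D)))

add : List ℕ → ℕ → List ℕ
add l e = if does (e ∈? l) then l else l ∷ʳ e

add-⊆ : ∀ l e {x} → x ∈ l → x ∈ add l e
add-⊆ l e x∈ with e ∈? l
... | yes _ = x∈
... | no _  = ∈-++⁺ˡ x∈

add-∋ : ∀ l e → e ∈ add l e
add-∋ l e with e ∈? l
... | yes e∈ = e∈
... | no _   = ∈-++⁺ʳ l (here refl)

∈-add⁻ : ∀ l e {x} → x ∈ add l e → x ∈ l ⊎ x ≡ e
∈-add⁻ l e x∈ with e ∈? l
... | yes _ = inj₁ x∈
... | no _ with ∈-++⁻ l x∈
...   | inj₁ x∈l        = inj₁ x∈l
...   | inj₂ (here x≡e) = inj₂ x≡e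

unique-add : ∀ l e → Unique l → Unique (add l e)
unique-add l e u with e ∈? l
... | yes _ = u
... | no e∉ = Uniqueₚ.++⁺ u ([] ∷ []) λ { (x∈ , here refl) → e∉ x∈ }

∈-foldl-add⁺ : ∀ l es {x} → x ∈ l ⊎ x ∈ es → x ∈ foldl add l es
∈-foldl-add⁺ l []       (inj₁ x∈)           = x∈
∈-foldl-add⁺ l (e ∷ es) (inj₁ x∈)           = ∈-foldl-add⁺ (add l e) es (inj₁ (add-⊆ l e x∈))
∈-foldl-add⁺ l (e ∷ es) (inj₂ (here refl))  = ∈-foldl-add⁺ (add l e) es (inj₁ (add-∋ l e))
∈-foldl-add⁺ l (e ∷ es) (inj₂ (there x∈))   = ∈-foldl-add⁺ (add l e) es (inj₂ x∈)

∈-foldl-add⁻ : ∀ l es {x} → x ∈ foldl add l es → x ∈ l ⊎ x ∈ es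
∈-foldl-add⁻ l []       x∈ = inj₁ x∈
∈-foldl-add⁻ l (e ∷ es) x∈ with ∈-foldl-add⁻ (add l e) es x∈
... | inj₂ x∈es = inj₂ (there x∈es)
... | inj₁ x∈add with ∈-add⁻ l e x∈add
...   | inj₁ x∈l  = inj₁ x∈l
...   | inj₂ refl = inj₂ (here refl)

unique-foldl-add : ∀ l es → Unique l → Unique (foldl add l es)
unique-foldl-add l []       u = u
unique-foldl-add l (e ∷ es) u = unique-foldl-add (add l e) es (unique-add l e u)

module BagEdges (inc : ℕ → List ℕ) where

  addRow : List ℕ → ℕ → List ℕ
  addRow l v = foldl add l (inc v)

  bagEdges : List ℕ → List ℕ
  bagEdges = foldl addRow []

  private
    ∈-foldl⁺ : ∀ l vs {x} → x ∈ l ⊎ (∃ λ v → v ∈ vs × x ∈ inc v) → x ∈ foldl addRow l vs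
    ∈-foldl⁺ l []       (inj₁ x∈) = x∈
    ∈-foldl⁺ l (v ∷ vs) (inj₁ x∈) = ∈-foldl⁺ (addRow l v) vs (inj₁ (∈-foldl-add⁺ l (inc v) (inj₁ x∈)))
    ∈-foldl⁺ l (v ∷ vs) (inj₂ (_ , here refl , x∈)) = ∈-foldl⁺ (addRow l v) vs (inj₁ (∈-foldl-add⁺ l (inc v) (inj₂ x∈)))
    ∈-foldl⁺ l (v ∷ vs) (inj₂ (w , there w∈ , x∈))  = ∈-foldl⁺ (addRow l v) vs (inj₂ (w , w∈ , x∈))

    ∈-foldl⁻ : ∀ l vs {x} → x ∈ foldl addRow l vs → x ∈ l ⊎ (∃ λ v → v ∈ vs × x ∈ inc v)
    ∈-foldl⁻ l []       x∈ = inj₁ x∈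
    ∈-foldl⁻ l (v ∷ vs) x∈ with ∈-foldl⁻ (addRow l v) vs x∈
    ... | inj₂ (w , w∈ , x∈w) = inj₂ (w , there w∈ , x∈w)
    ... | inj₁ x∈row with ∈-foldl-add⁻ l (inc v) x∈row
    ...   | inj₁ x∈l = inj₁ x∈l
    ...   | inj₂ x∈v = inj₂ (v , here refl , x∈v)

    unique-foldl : ∀ l vs → Unique l → Unique (foldl addRow l vs)
    unique-foldl l []       u = u
    unique-foldl l (v ∷ vs) u = unique-foldl (addRow l v) vs (unique-foldl-add l (inc v) u)

  ∈-bagEdges⁺ : ∀ vs {x v} → v ∈ vs → x ∈ inc v → x ∈ bagEdges vs
  ∈-bagEdges⁺ vs v∈ x∈ = ∈-foldl⁺ [] vs (inj₂ (_ , v∈ , x∈))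

  ∈-bagEdges⁻ : ∀ vs {x} → x ∈ bagEdges vs → ∃ λ v → v ∈ vs × x ∈ inc v
  ∈-bagEdges⁻ vs x∈ with ∈-foldl⁻ [] vs x∈
  ... | inj₂ found = found

  unique-bagEdges : ∀ vs → Unique (bagEdges vs)
  unique-bagEdges vs = unique-foldl [] vs []

does-∷ʳ : ∀ l {e x} → e ≢ x → does (x ∈? (l ∷ʳ e)) ≡ does (x ∈? l)
does-∷ʳ l {e} {x} e≢x with x ∈? (l ∷ʳ e) | x ∈? l
... | yes _  | yes _  = refl
... | no _   | no _   = refl
... | no x∉  | yes x∈ = ⊥-elim (x∉ (∈-++⁺ˡ x∈))
... | yes x∈ | no x∉ with ∈-++⁻ l x∈
...   | inj₁ x∈l         = ⊥-elim (x∉ x∈l)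
...   | inj₂ (here refl) = ⊥-elim (e≢x refl)

does-last : ∀ l e → does (e ∈? (l ∷ʳ e)) ≡ true
does-last l e with e ∈? (l ∷ʳ e)
... | yes _ = refl
... | no e∉ = ⊥-elim (e∉ (∈-++⁺ʳ l (here refl)))

record Table (S #e : ℕ) (A M : ℕ → ℕ) (ℓ : ℕ → List ℕ) : Set where
  field
    rows  : Rows A S ℓ
    flags : ∀ i → i < S → ∀ e → e < #e → M (i + S * suc e) ≡ bit (does (e ∈? ℓ i))

table-cong : ∀ {S #e A M ℓ ℓ′} → (∀ i → i < S → ℓ i ≡ ℓ′ i) → Table S #e A M ℓ → Table S #e A M ℓ′
table-cong {S} {A = A} ℓ≡ tab = record
  { rows  = λ i i< → subst (Row A S i) (ℓ≡ i i<) (rows i i<)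
  ; flags = λ i i< e e< → trans (flags i i< e e<) (cong (λ l → bit (does (e ∈? l))) (ℓ≡ i i<))
  }
  where open Table tab

table-insert : ∀ {S #e A M ℓ i e} → Table S #e A M ℓ → i < S →
  Table S #e (update A (i + S * length (ℓ i)) (suc e)) (update M (i + S * suc e) 1) (update ℓ i (ℓ i ∷ʳ e))
table-insert {S} {#e} {A} {M} {ℓ} {i} {e} tab i<S = record { rows = row-append {A} {R = ℓ} e rows i<S ; flags = flags′ }
  where
  open Table tab
  flags′ : ∀ j → j < S → ∀ x → x < #e → update M (i + S * suc e) 1 (j + S * suc x) ≡ bit (does (x ∈? update ℓ i (ℓ i ∷ʳ e) j))
  flags′ j j<S x x< with i ≟ j
  ... | no i≢j rewrite ≢⇒≡ᵇ-false i≢j = trans (update-neq M 1 (i≢j ∘ proj₁ ∘ address-injective i<S j<S)) (flags j j<S x x<)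
  ... | yes refl rewrite ≡ᵇ-refl i with e ≟ x
  ...   | yes refl rewrite does-last (ℓ i) e = update-eq M (i + S * suc e) 1 refl
  ...   | no e≢x   rewrite does-∷ʳ (ℓ i) e≢x =
    trans (update-neq M 1 (e≢x ∘ suc-injective ∘ proj₂ ∘ address-injective i<S i<S)) (flags i i<S x x<)

run-multiples : ∀ {σ₀ S #e} → scalar σ₀ $S ≡ S → scalar σ₀ $E ≡ #e →
  Run multiples σ₀ (multiplesTime #e) (λ τ → ∀ e → e < #e → array τ %mul (suc e) ≡ S * suc e)
run-multiples {σ₀} {S} {#e} stride E≡ =
  straight-then λ _ →
  straight-then λ _ →
  weaken ≤-refl
    (run-upto I (λ s → trans (scalars s $E) E≡) (λ _ s → body (trans (scalars s $S) stride)) refl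
      (trans stride (sym (*-identityʳ S)) , λ _ ()))
    λ _ → proj₂
  where
  I : ℕ → State → Set
  I k σ = scalar σ $y ≡ S * suc k × (∀ e → e < k → array σ %mul (suc e) ≡ S * suc e)
  body : ∀ {k σ} → scalar σ $S ≡ S → scalar σ $e ≡ k → I k σ → Run _ σ 11 (λ τ → scalar τ $e ≡ suc k × I (suc k) τ)
  body {k} {σ} S≡ refl (y≡ , muls) = run-straight {P = $e ≔ var $e ⊕ lit 1 ⨟ %mul [ var $e ]≔ var $y ⨟ $y ≔ var $y ⊕ var $S}
    (+-comm k 1 , trans (cong₂ _+_ y≡ S≡) (trans (+-comm _ S) (sym (*-suc S (suc k)))) , muls′)
    where
    muls′ : ∀ e → e < suc k → update (array σ %mul) (k + 1) (scalar σ $y) (suc e) ≡ S * suc e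
    muls′ e (s≤s e≤k) with m≤n⇒m<n∨m≡n e≤k
    ... | inj₁ e<k  = trans (update-neq (array σ %mul) _ λ eq → <⇒≢ (s≤s e<k) (trans (sym eq) (+-comm k 1))) (muls e e<k)
    ... | inj₂ refl = trans (update-eq (array σ %mul) (k + 1) _ (+-comm k 1)) y≡

module Collecting (S N #e #v L D : ℕ) (N<S : N < S) (R vs : ℕ → List ℕ) (B sizes : ℕ → ℕ)
  (in-row : ∀ v → v < #v → N + v < S) (short-row : ∀ v → v < #v → length (R (N + v)) ≤ D)
  (row-edges : ∀ v → v < #v → ∀ e → e ∈ R (N + v) → e < #e)
  (sizes≡ : ∀ i → i < N → sizes i ≡ length (vs i)) (short-bag : ∀ i → i < N → length (vs i) ≤ L)
  (bag-vertices : ∀ i → i < N → ∀ v → v ∈ vs i → v < #v) (no-bag : ∀ i → N ≤ i → vs i ≡ [])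
  where

  open BagEdges (λ v → R (N + v)) public

  edgesAt : ℕ → List ℕ
  edgesAt i = bagEdges (vs i)

  stream : ℕ → ℕ → List ℕ
  stream i zero    = []
  stream i (suc n) = vs i ++ stream (suc i) n

  record Inputs (σ : State) : Set where
    field
      stride : scalar σ $S ≡ S
      #bags≡ : scalar σ $N ≡ N
      adj    : Rows (array σ %adj) S R
      mul    : ∀ e → e < #e → array σ %mul (suc e) ≡ S * suc e
      bag≡   : array σ %bag ≡ B
      size≡  : array σ %size ≡ sizes

  inputs-same : ∀ {P σ τ} {w : T (spares P ($S ∷ $N ∷ []) (%adj ∷ %mul ∷ %bag ∷ %size ∷ []))} → Same P σ τ → Inputs σ → Inputs τ
  inputs-same {w = w} s inp with kept ($S ∷ $N ∷ []) (%adj ∷ %mul ∷ %bag ∷ %size ∷ []) s w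
  ... | S≡ ∷ N≡ ∷ [] , A≡ ∷ M≡ ∷ B≡ ∷ Z≡ ∷ [] = record
    { stride = trans S≡ stride
    ; #bags≡ = trans N≡ #bags≡
    ; adj    = subst (λ A → Rows A S R) (sym A≡) adj
    ; mul    = λ e e< → trans (cong-app M≡ (suc e)) (mul e e<)
    ; bag≡   = trans B≡ bag≡
    ; size≡  = trans Z≡ size≡
    }
    where open Inputs inp

  Building : ℕ → (ℕ → List ℕ) → List ℕ → State → Set
  Building i ℓ l σ = Table S #e (array σ %row) (array σ %in) (update ℓ i l) × scalar σ $lo ≡ S * length l

  run-collectEdge : ∀ {σ i ℓ l e} → Inputs σ → scalar σ $i ≡ i → i < S → e < #e → array σ %adj (scalar σ $q) ≡ suc e →
    Building i ℓ l σ → Run collectEdge σ 25 (Building i ℓ (add l e))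
  run-collectEdge {σ} {i} {ℓ} {l} {e} inp i≡ i<S e< at (tab , lo≡) = run-if
    (λ nz → run-straight (subst (λ b → Building i ℓ (if b then l else l ∷ʳ e) σ) (sym (bit≢0 flag≡ nz)) (tab , lo≡)))
    (λ z → run-straight (subst (λ b → Building i ℓ (if b then l else l ∷ʳ e) (effect append σ)) (sym (bit≡0 flag≡ z))
      (table-cong again
         (subst₂ (λ A M → Table S #e A M (update (update ℓ i l) i (update ℓ i l i ∷ʳ e)))
           (cong₂ (update A) (sym (cong₂ _+_ i≡ (trans lo≡ (cong (λ l → S * length l) (sym l≡))))) (sym at))
           (cong (λ x → update M x 1) (sym address≡))
           (table-insert {A = A} {M} tab i<S)) ,
       trans (cong₂ _+_ lo≡ stride) (trans (+-comm _ S) (trans (sym (*-suc S _)) (cong (S *_) (sym (length-∷ʳ l e))))))))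
    where
    open Inputs inp
    A = array σ %row
    M = array σ %in
    l≡ : update ℓ i l i ≡ l
    l≡ = update-eq ℓ i l refl
    address≡ : scalar σ $i + array σ %mul (array σ %adj (scalar σ $q)) ≡ i + S * suc e
    address≡ = cong₂ _+_ i≡ (trans (cong (array σ %mul) at) (mul e e<))
    flag≡ : M (scalar σ $i + array σ %mul (array σ %adj (scalar σ $q))) ≡ bit (does (e ∈? l))
    flag≡ = trans (cong M address≡) (trans (Table.flags tab i i<S e e<) (cong (λ l → bit (does (e ∈? l))) l≡))
    again : ∀ j → j < S → update (update ℓ i l) i (update ℓ i l i ∷ʳ e) j ≡ update ℓ i (l ∷ʳ e) j
    again j _ with i ≟ j
    ... | yes refl rewrite ≡ᵇ-refl i = refl
    ... | no i≢j rewrite ≢⇒≡ᵇ-false i≢j = refl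

  run-collectVertex : ∀ {σ i ℓ l v} → Inputs σ → scalar σ $i ≡ i → i < S → v < #v → B (scalar σ $ptr) ≡ v → Building i ℓ l σ →
    Run collectVertex σ (collectVertexTime D)
        (λ τ → Building i ℓ (addRow l v) τ × scalar τ $ptr ≡ suc (scalar σ $ptr) × scalar τ $j ≡ scalar σ $j ∸ 1)
  run-collectVertex {σ} {i} {ℓ} {l} {v} inp i≡ i<S v< at (tab , lo≡) =
    straight-then λ s₁ →
    slower (rowTime-mono 1 25 (short-row v v<))
      (run-row {xs = R (N + v)} (λ ts → Building i ℓ (foldl add l ts)) stride u≡
        (adj (N + v) (in-row v v<)) (λ _ b → b)
        (λ {ts} {e} {_} {σ′} eq s at′ b → subst (λ l′ → Run collectEdge σ′ 25 (Building i ℓ l′)) (sym (foldl-∷ʳ add l e ts))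
          (run-collectEdge (inputs-same (s₁ ▹ s) inp) (trans (scalars s $i) i≡) i<S
             (row-edges v v< e (subst (e ∈_) (sym eq) (∈-++⁺ʳ ts (here refl)))) at′ b))
        (tab , lo≡))
    then-run λ s₂ b → run-straight {P = $ptr ≔ var $ptr ⊕ lit 1 ⨟ $j ≔ var $j ⊖ lit 1}
      (b , trans (+-comm _ 1) (cong suc (scalars s₂ $ptr)) , cong (_∸ 1) (scalars s₂ $j))
    where
    open Inputs inp
    σ₁ = effect ($u ≔ var $N ⊕ (%bag [ var $ptr ])) σ
    u≡ : scalar σ₁ $u ≡ N + v
    u≡ = cong₂ _+_ #bags≡ (trans (cong-app bag≡ (scalar σ $ptr)) at)

  Filled : ℕ → ℕ → List ℕ
  Filled k i = if i <ᵇ k then edgesAt i else []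

  filled-below : ∀ {k i} → i < k → Filled k i ≡ edgesAt i
  filled-below {k} {i} i<k with i <ᵇ k | <⇒<ᵇ i<k
  ... | true | _ = refl

  filled-above : ∀ {k i} → k ≤ i → Filled k i ≡ []
  filled-above {k} {i} k≤i with i <ᵇ k | <ᵇ⇒< i k
  ... | false | _ = refl
  ... | true  | f = ⊥-elim (<⇒≱ (f tt) k≤i)

  filled-start : ∀ k i → Filled k i ≡ update (Filled k) k [] i
  filled-start k i with k ≟ i
  ... | yes refl rewrite ≡ᵇ-refl k = filled-above {k} ≤-refl
  ... | no k≢i rewrite ≢⇒≡ᵇ-false k≢i = refl

  filled-end : ∀ k i → update (Filled k) k (edgesAt k) i ≡ Filled (suc k) i
  filled-end k i with k ≟ i
  ... | yes refl rewrite ≡ᵇ-refl k = sym (filled-below {suc k} ≤-refl)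
  ... | no k≢i rewrite ≢⇒≡ᵇ-false k≢i with <-cmp i k
  ...   | tri< i<k _ _ = trans (filled-below i<k) (sym (filled-below (m<n⇒m<1+n i<k)))
  ...   | tri≈ _ i≡k _ = ⊥-elim (k≢i (sym i≡k))
  ...   | tri> _ _ k<i = trans (filled-above (<⇒≤ k<i)) (sym (filled-above k<i))

  -- `ahead` describes the unread part of the bag array: the bags lie one after the other, so `$ptr`
  -- only ever moves forward.
  record Collected (k : ℕ) (later : List ℕ) (σ : State) : Set where
    field
      table  : Table S #e (array σ %row) (array σ %in) (Filled k)
      ahead  : ∀ x → B (scalar σ $ptr + x) ≡ cells later x

  run-collectBag : ∀ {σ k later} → Inputs σ → scalar σ $i ≡ k → k < N → Collected k (vs k ++ later) σ →
    Run collectBag σ (collectBagTime L D) (λ τ → scalar τ $i ≡ suc k × Collected (suc k) later τ)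
  run-collectBag {σ} {k} {later} inp i≡ k<N col =
    straight-then λ s₁ →
    straight-then λ s₂ →
    slower (+-monoʳ-≤ 2 (*-monoˡ-≤ (2 + collectVertexTime D) (short-bag k k<N)))
      (run-loop I (λ _ (_ , _ , _ , _ , j≡ , _) → j≡) (λ s → body (inputs-same (s₁ ▹ s₂ ▹ s) inp) (trans (scalars s $i) i≡))
        {length (vs k)} ([] , vs k , refl , refl , trans (at≡ size≡ i≡) (sizes≡ k k<N) , ahead ,
                         table-cong (λ i _ → filled-start k i) table , sym (*-zeroʳ S)))
    then-run λ { s (done , [] , vs≡ , _ , _ , ahead′ , (tab , _)) → run-straight
      (trans (+-comm _ 1) (cong suc (trans (scalars s $i) i≡)) ,
       record { table = table-cong (λ i _ → trans (cong (λ l → update (Filled k) k (bagEdges l) i) (sym (trans vs≡ (++-identityʳ done)))) (filled-end k i)) tab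
              ; ahead = ahead′ }) }
    where
    open Inputs inp
    open Collected col
    σ₂ = setScalar (setScalar σ $lo 0) $j (array σ %size (scalar σ $i))
    I : ℕ → State → Set
    I n σ = ∃ λ done → ∃ λ rest → vs k ≡ done ++ rest × n ≡ length rest × scalar σ $j ≡ n ×
            (∀ x → B (scalar σ $ptr + x) ≡ cells (rest ++ later) x) × Building k (Filled k) (foldl addRow [] done) σ
    body : ∀ {n σ} → Inputs σ → scalar σ $i ≡ k → I (suc n) σ → scalar σ $j ≢ 0 × Run collectVertex σ (collectVertexTime D) (I n)
    body {n} {σ} inp i≡ (done , v ∷ rest , vs≡ , len , j≡ , ahead , b) =
      (λ z → case trans (sym j≡) z of λ ()) ,
      weaken ≤-refl
        (run-collectVertex inp i≡ (<-trans k<N N<S) (bag-vertices k k<N v (subst (v ∈_) (sym vs≡) (∈-++⁺ʳ done (here refl))))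
          (trans (cong B (sym (+-identityʳ _))) (ahead 0)) b)
        λ {τ} s (b′ , ptr≡ , j′≡) → done ∷ʳ v , rest , trans vs≡ (sym (++-assoc done (v ∷ []) rest)) , suc-injective len ,
          trans j′≡ (cong (_∸ 1) j≡) , (λ x → trans (cong (λ p → B (p + x)) ptr≡) (trans (cong B (sym (+-suc (scalar σ $ptr) x))) (ahead (suc x)))) ,
          subst (λ l → Building k (Filled k) l τ) (sym (foldl-∷ʳ addRow [] v done)) b′

  run-collect : ∀ {σ₀} → Inputs σ₀ → (∀ x → B x ≡ cells (stream 0 N) x) →
    (∀ x → array σ₀ %row x ≡ 0) → (∀ x → array σ₀ %in x ≡ 0) →
    Run collect σ₀ (collectTime N L D) (λ τ → Table S #e (array τ %row) (array τ %in) edgesAt)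
  run-collect {σ₀} inp stored no-row no-in =
    straight-then λ s₁ →
    straight-then λ s₂ →
    let inputs = λ {σ} (s : Same collectBag _ σ) → inputs-same (s₁ ▹ s₂ ▹ s) inp in
    weaken ≤-refl
      (run-upto (λ k σ → Collected k (stream k (N ∸ k)) σ) (Inputs.#bags≡ ∘ inputs)
        (λ {k} k<N s i≡ col → run-collectBag (inputs s) i≡ k<N
           (subst (λ l → Collected k l _) (cong (stream k) (+-∸-assoc 1 k<N)) col))
        refl (record { table = empty ; ahead = stored }))
      λ _ col → table-cong (λ i _ → complete i) (Collected.table col)
    where
    empty : Table S #e (array σ₀ %row) (array σ₀ %in) (Filled 0)
    empty = record { rows = λ _ _ _ → no-row _ ; flags = λ _ _ _ _ → no-in _ }
    complete : ∀ i → Filled N i ≡ edgesAt i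
    complete i with i <? N
    ... | yes i<N = filled-below i<N
    ... | no i≮N  = trans (filled-above (≮⇒≥ i≮N)) (cong bagEdges (sym (no-bag i (≮⇒≥ i≮N))))

-- Paths in the tree decomposition

module _ {A : Set} where

  unique-∷ʳ⁻ : ∀ (xs : List A) {x} → Unique (xs ∷ʳ x) → x ∉ xs × Unique xs
  unique-∷ʳ⁻ []       _           = (λ ()) , []
  unique-∷ʳ⁻ (y ∷ xs) (fresh ∷ u) with unique-∷ʳ⁻ xs u
  ... | x∉ , u′ = (λ { (here refl) → All.lookup fresh (∈-++⁺ʳ xs (here refl)) refl ; (there x∈) → x∉ x∈ }) ,
                  All.tabulate (λ z∈ → All.lookup fresh (∈-++⁺ˡ z∈)) ∷ u′

  unique-∷ʳ⁺ : ∀ {xs : List A} {x} → Unique xs → x ∉ xs → Unique (xs ∷ʳ x)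
  unique-∷ʳ⁺ u x∉ = Uniqueₚ.++⁺ u ([] ∷ []) λ { (x∈ , here refl) → x∉ x∈ }

module Walks (T : Multigraph) where

  joins-swap : ∀ {e u v} → Joins T e u v → Joins T e v u
  joins-swap (inj₁ (p , q)) = inj₂ (p , q)
  joins-swap (inj₂ (p , q)) = inj₁ (p , q)

  start∈ : ∀ {u v} (π : Walk T u v) → u ∈ verticesOf T π
  start∈ ε       = here refl
  start∈ (_ ◅ _) = here refl

  ends∈ : ∀ {u v f} (π : Walk T u v) → f ∈ edgesOf T π → end₁ T f ∈ verticesOf T π × end₂ T f ∈ verticesOf T π
  ends∈ ((e , inj₁ (refl , refl)) ◅ π) (here refl) = here refl , there (start∈ π)
  ends∈ ((e , inj₂ (refl , refl)) ◅ π) (here refl) = there (start∈ π) , here refl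
  ends∈ ((e , j) ◅ π) (there f∈) with ends∈ π f∈
  ... | p , q = there p , there q

  -- An edge that occurs again would revisit both of its ends, in particular the vertex just left.
  path-edges-unique : ∀ {u v} (π : Walk T u v) → IsPath T π → Unique (edgesOf T π)
  path-edges-unique ε _ = []
  path-edges-unique {u} ((e , j) ◅ π) (fresh ∷ path) =
    All.tabulate (λ { f∈ refl → u∉ (revisited j (ends∈ π f∈)) }) ∷ path-edges-unique π path
    where
    u∉ : u ∉ verticesOf T π
    u∉ u∈ = All.lookup fresh u∈ refl
    revisited : ∀ {v} → Joins T e u v → end₁ T e ∈ verticesOf T π × end₂ T e ∈ verticesOf T π → u ∈ verticesOf T π
    revisited (inj₁ (refl , _)) (p , _) = p
    revisited (inj₂ (_ , refl)) (_ , q) = q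

  sources-◅◅ : ∀ {u v w} (π : Walk T u v) (ρ : Walk T v w) → sources T (π ◅◅ ρ) ≡ sources T π ++ sources T ρ
  sources-◅◅ ε       ρ = refl
  sources-◅◅ (s ◅ π) ρ = cong (_ ∷_) (sources-◅◅ π ρ)

  edgesOf-◅◅ : ∀ {u v w} (π : Walk T u v) (ρ : Walk T v w) → edgesOf T (π ◅◅ ρ) ≡ edgesOf T π ++ edgesOf T ρ
  edgesOf-◅◅ ε             ρ = refl
  edgesOf-◅◅ ((e , _) ◅ π) ρ = cong (e ∷_) (edgesOf-◅◅ π ρ)

-- All that the search has to provide: an injective rank and, for every node of nonzero rank, an
-- edge to a node of smaller rank. `upEdge` yields edge numbers rather than edges, so that the root
-- has a value even in a tree without edges.
module Rooted (T : Multigraph) (rank : Vertex T → ℕ) (rank-injective : ∀ {x y} → rank x ≡ rank y → x ≡ y)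
  (up : Vertex T → Vertex T) (upEdge : Vertex T → ℕ)
  (climbs : ∀ x → rank x ≢ 0 → rank (up x) < rank x × ∃ λ e → toℕ e ≡ upEdge x × Joins T e x (up x)) where

  open Walks T

  -- `bounded` ensures that the walk remains a path when a deeper end is attached, `through` is
  -- where coherence will be applied, and `treeEdges` shows that any other edge would close a cycle.
  record Climb (a b : Vertex T) : Set where
    field
      walk      : Walk T a b
      path      : IsPath T walk
      bounded   : ∀ {x} → x ∈ verticesOf T walk → rank x ≤ rank a ⊔ rank b
      through   : rank b < rank a → up a ∈ verticesOf T walk
      treeEdges : ∀ {e} → e ∈ edgesOf T walk → ∃ λ x → toℕ e ≡ upEdge x

  -- From the deeper of the two ends, go up until the ends meet.
  climb : ∀ a b → Climb a b
  climb a b = go a b (<-wellFounded _)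
    where
    go : ∀ a b → Acc _<_ (rank a + rank b) → Climb a b
    go a b (acc rec) with <-cmp (rank a) (rank b)
    go a b (acc rec) | tri≈ _ eq _ rewrite rank-injective {a} {b} eq = record
      { walk = ε ; path = [] ∷ [] ; bounded = λ { (here refl) → m≤m⊔n _ _ } ; through = λ lt → ⊥-elim (<-irrefl refl lt) ; treeEdges = λ () }
    go a b (acc rec) | tri> _ _ b<a with climbs a (λ z → n≮0 (subst (rank b <_) z b<a))
    ... | lt , e , ix , j = record
      { walk      = (e , j) ◅ C.walk
      ; path      = All.tabulate (λ { x∈ refl → <⇒≱ below (C.bounded x∈) }) ∷ C.path
      ; bounded   = λ { (here refl) → m≤m⊔n _ _ ; (there x∈) → ≤-trans (C.bounded x∈) (≤-trans (<⇒≤ below) (m≤m⊔n _ _)) }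
      ; through   = λ _ → there (start∈ C.walk)
      ; treeEdges = λ { (here refl) → a , ix ; (there e∈) → C.treeEdges e∈ }
      }
      where
      module C = Climb (go (up a) b (rec (+-monoˡ-< (rank b) lt)))
      below : rank (up a) ⊔ rank b < rank a
      below = ⊔-lub lt b<a
    go a b (acc rec) | tri< a<b _ _ with climbs b (λ z → n≮0 (subst (rank a <_) z a<b))
    ... | lt , e , ix , j = record
      { walk      = C.walk ◅◅ last
      ; path      = subst Unique (sym vertices≡) (unique-∷ʳ⁺ C.path λ b∈ → <⇒≱ below (C.bounded b∈))
      ; bounded   = λ {x} x∈ → bounded′ (∈-++⁻ (verticesOf T C.walk) (subst (x ∈_) vertices≡ x∈))
      ; through   = λ b<a → ⊥-elim (<-asym a<b b<a)
      ; treeEdges = λ {f} f∈ → [ C.treeEdges , (λ { (here refl) → b , ix }) ]′ (∈-++⁻ (edgesOf T C.walk) (subst (f ∈_) (edgesOf-◅◅ C.walk last) f∈))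
      }
      where
      module C = Climb (go a (up b) (rec (+-monoʳ-< (rank a) lt)))
      last : Walk T (up b) b
      last = (e , joins-swap j) ◅ ε
      vertices≡ : verticesOf T (C.walk ◅◅ last) ≡ verticesOf T C.walk ∷ʳ b
      vertices≡ = cong (_∷ʳ b) (sources-◅◅ C.walk last)
      below : rank a ⊔ rank (up b) < rank b
      below = ⊔-lub a<b lt
      bounded′ : ∀ {x} → x ∈ verticesOf T C.walk ⊎ x ∈ (b ∷ []) → rank x ≤ rank a ⊔ rank b
      bounded′ (inj₁ x∈)          = ≤-trans (C.bounded x∈) (≤-trans (<⇒≤ below) (m≤n⊔m _ _))
      bounded′ (inj₂ (here refl)) = m≤n⊔m _ _

  -- An edge that is not of the form upEdge x closes a cycle with the climb between its ends.
  edges≤vertices : (∀ {i} (π : Walk T i i) → ¬ IsCycle T π) → #E T ≤ #V T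
  edges≤vertices acyclic = Finₚ.injective⇒≤ {f = λ e → proj₁ (lower-end e)} λ {e} {f} eq →
    Finₚ.toℕ-injective (trans (proj₂ (lower-end e)) (trans (cong upEdge eq) (sym (proj₂ (lower-end f)))))
    where
    lower-end : ∀ e → ∃ λ x → toℕ e ≡ upEdge x
    lower-end e with Finₚ.any? (λ x → toℕ e ≟ upEdge x)
    ... | yes found = found
    ... | no none′  = ⊥-elim (acyclic ((e , inj₁ (refl , refl)) ◅ C.walk)
      ( (λ ())
      , All.tabulate (λ { f∈ refl → none′ (C.treeEdges f∈) }) ∷ path-edges-unique C.walk C.path
      , All.tabulate (λ { x∈ refl → proj₁ (unique-∷ʳ⁻ (sources T C.walk) C.path) x∈ }) ∷ proj₂ (unique-∷ʳ⁻ (sources T C.walk) C.path)))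
      where
      module C = Climb (climb (end₂ T e) (end₁ T e))

Touches : ∀ {G : Multigraph} (D : TreeDecomposition G) → Edge G → Vertex (tree D) → Set
Touches {G} D e i = end₁ G e ∈ˢ bag D i ⊎ end₂ G e ∈ˢ bag D i

module Separation {G : Multigraph} (D : TreeDecomposition G)
  (rank : Vertex (tree D) → ℕ) (rank-injective : ∀ {x y} → rank x ≡ rank y → x ≡ y)
  (up : Vertex (tree D) → Vertex (tree D)) (upEdge : Vertex (tree D) → ℕ)
  (climbs : ∀ x → rank x ≢ 0 → rank (up x) < rank x × ∃ λ e → toℕ e ≡ upEdge x × Joins (tree D) e x (up x)) where

  open Rooted (tree D) rank rank-injective up upEdge climbs

  -- The path from `a` to an earlier node passes through the parent of `a`, so coherence puts `v`
  -- there.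
  shared-up : ∀ {v a b} → rank b < rank a → v ∈ˢ bag D a → v ∈ˢ bag D b → v ∈ˢ bag D (up a)
  shared-up {v} {a} {b} b<a v∈a v∈b = coherent D v v∈a v∈b C.walk C.path (C.through b<a)
    where module C = Climb (climb a b)

  -- For an edge that touches the two bags at different ends, take a bag `b` with both ends. If `b`
  -- is later than `a`, both ends are also in the bag above `b`; so `b` can be moved up until it is
  -- `a` or earlier, and then `shared-up` puts one of the ends above `a`.
  adjacent-up : ∀ {u w a c} → rank c < rank a → u ∈ˢ bag D a → w ∈ˢ bag D c → (∃ λ b → u ∈ˢ bag D b × w ∈ˢ bag D b) →
                u ∈ˢ bag D (up a) ⊎ w ∈ˢ bag D (up a)
  adjacent-up {u} {w} {a} {c} c<a u∈a w∈c (b , u∈b , w∈b) = go b (<-wellFounded _) u∈b w∈b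
    where
    go : ∀ b → Acc _<_ (rank b) → u ∈ˢ bag D b → w ∈ˢ bag D b → u ∈ˢ bag D (up a) ⊎ w ∈ˢ bag D (up a)
    go b (acc rec) u∈b w∈b with <-cmp (rank b) (rank a)
    ... | tri< b<a _ _ = inj₁ (shared-up b<a u∈a u∈b)
    ... | tri≈ _ eq _ rewrite rank-injective {b} {a} eq = inj₂ (shared-up c<a w∈b w∈c)
    ... | tri> _ _ a<b = go (up b) (rec (proj₁ (climbs b λ z → n≮0 (subst (rank a <_) z a<b))))
                           (shared-up a<b u∈b u∈a) (shared-up (<-trans c<a a<b) w∈b w∈c)

  touches-up : ∀ {e a c} → rank c < rank a → Touches D e a → Touches D e c → Touches D e (up a)
  touches-up c<a (inj₁ p) (inj₁ q) = inj₁ (shared-up c<a p q)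
  touches-up c<a (inj₂ p) (inj₂ q) = inj₂ (shared-up c<a p q)
  touches-up {e} c<a (inj₁ p) (inj₂ q) = adjacent-up c<a p q (coversEdge D e)
  touches-up {e} c<a (inj₂ p) (inj₁ q) with coversEdge D e
  ... | b , p′ , q′ with adjacent-up c<a p q (b , q′ , p′)
  ...   | inj₁ r = inj₂ r
  ...   | inj₂ r = inj₁ r

-- Sums over lists, and the input as stored in memory

module _ {A : Set} where

  -- Each entry of `xs` is cut out of `ys`; as `xs` has no repetitions, its remaining entries are
  -- still found in what is left.
  sum-⊆ : ∀ (f : A → ℕ) {xs ys} → Unique xs → (∀ {x} → x ∈ xs → x ∈ ys) → sum (map f xs) ≤ sum (map f ys)
  sum-⊆ f {[]}     _           _  = z≤n
  sum-⊆ f {x ∷ xs} {ys} (fresh ∷ u) ⊆ys with ∈-∃++ (⊆ys (here refl))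
  ... | as , bs , refl = begin
    f x + sum (map f xs)                    ≤⟨ +-monoʳ-≤ (f x) (sum-⊆ f u without) ⟩
    f x + sum (map f (as ++ bs))            ≡⟨ cong (f x +_) (split bs) ⟩
    f x + (sum (map f as) + sum (map f bs)) ≡⟨ +-comm (f x) _ ⟩
    sum (map f as) + sum (map f bs) + f x   ≡⟨ +-assoc (sum (map f as)) _ _ ⟩
    sum (map f as) + (sum (map f bs) + f x) ≡⟨ cong (sum (map f as) +_) (+-comm _ (f x)) ⟩
    sum (map f as) + sum (map f (x ∷ bs))   ≡⟨ split (x ∷ bs) ⟨
    sum (map f (as ++ x ∷ bs))              ∎
    where
    open ≤-Reasoning
    split : ∀ bs → sum (map f (as ++ bs)) ≡ sum (map f as) + sum (map f bs)
    split bs = trans (cong sum (map-++ f as bs)) (sum-++ (map f as) (map f bs))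
    without : ∀ {y} → y ∈ xs → y ∈ as ++ bs
    without y∈ with ∈-++⁻ as (⊆ys (there y∈))
    ... | inj₁ y∈as         = ∈-++⁺ˡ y∈as
    ... | inj₂ (here refl)  = ⊥-elim (All.lookup fresh y∈ refl)
    ... | inj₂ (there y∈bs) = ∈-++⁺ʳ as y∈bs

  length-as-sum : ∀ (xs : List A) → length xs ≡ sum (map (λ _ → 1) xs)
  length-as-sum []       = refl
  length-as-sum (_ ∷ xs) = cong suc (length-as-sum xs)

  length-⊆ : ∀ {xs ys : List A} → Unique xs → (∀ {x} → x ∈ xs → x ∈ ys) → length xs ≤ length ys
  length-⊆ {xs} {ys} u ⊆ys = subst₂ _≤_ (sym (length-as-sum xs)) (sym (length-as-sum ys)) (sum-⊆ (λ _ → 1) u ⊆ys)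

  length-concatMap : ∀ {B : Set} (g : A → List B) xs {d} → (∀ {x} → x ∈ xs → length (g x) ≤ d) → length (concatMap g xs) ≤ length xs * d
  length-concatMap g []       _ = z≤n
  length-concatMap g (x ∷ xs) b = ≤-trans (≤-reflexive (length-++ (g x))) (+-mono-≤ (b (here refl)) (length-concatMap g xs (b ∘ there)))

cells-tabulate : ∀ {n} (f : Fin n → ℕ) i → cells (tabulate f) (toℕ i) ≡ f i
cells-tabulate f Fin.zero    = refl
cells-tabulate f (Fin.suc i) = cells-tabulate (f ∘ Fin.suc) i

cells-allFin : ∀ {n} (f : Fin n → ℕ) i → cells (map f (allFin n)) (toℕ i) ≡ f i
cells-allFin f i = trans (cong (λ xs → cells xs (toℕ i)) (map-tabulate id f)) (cells-tabulate f i)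

length-members : ∀ {n} (s : Subset n) → length (members s) ≡ ∣ s ∣
length-members []             = refl
length-members {suc n} (b ∷ s) = first b
  where
  -- Stated for any `h`, since unfolding `tabulate` composes it with `Fin.suc`.
  shift : ∀ b {k} (h : Fin k → Fin n) → length (filter (_∈ˢ? (b ∷ s)) (tabulate (Fin.suc ∘ h))) ≡ length (filter (_∈ˢ? s) (tabulate h))
  shift b {zero}  h = refl
  shift b {suc k} h with does (h Fin.zero ∈ˢ? s)
  ... | true  = cong suc (shift b (h ∘ Fin.suc))
  ... | false = shift b (h ∘ Fin.suc)
  first : ∀ b → length (members (b ∷ s)) ≡ ∣ b ∷ s ∣
  first true  = cong suc (trans (shift true id) (length-members s))
  first false = trans (shift false id) (length-members s)

∈-members⁺ : ∀ {n} {s : Subset n} {x} → x ∈ˢ s → x ∈ members s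
∈-members⁺ {s = s} x∈ = ∈-filter⁺ (_∈ˢ? s) (∈-allFin _) x∈

∈-members⁻ : ∀ {n} {s : Subset n} {x} → x ∈ members s → x ∈ˢ s
∈-members⁻ {s = s} x∈ = proj₂ (∈-filter⁻ (_∈ˢ? s) {xs = allFin _} x∈)

-- Writing the output

writeOutput : Program
writeOutput =
  $e ≔ lit 0 ⨟
  (while var $E ⊖ var $e loop
    ((if′ %fixed [ var $e ⊕ lit 1 ]
      then outputArray [ var $e ]≔ %end₂ [ var $e ]
      else (outputArray [ var $e ]≔ %end₁ [ var $e ])) ⨟
     $e ≔ var $e ⊕ lit 1))

run-writeOutput : ∀ {σ₀ #e ω} → scalar σ₀ $E ≡ #e → Holds (array σ₀ %fixed) ω →
  Run writeOutput σ₀ (2 + (4 + #e * (4 + 17)))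
      (λ τ → ∀ e → e < #e → array τ outputArray e ≡ (if ω e then array σ₀ %end₂ e else array σ₀ %end₁ e))
run-writeOutput {σ₀} {#e} {ω} E≡ fixed =
  straight-then λ _ →
  run-upto I (λ s → trans (scalars s $E) E≡)
    (λ _ s → body (arrays s %end₁) (arrays s %end₂) (subst (λ A → Holds A ω) (sym (arrays s %fixed)) fixed))
    refl (λ _ ())
  where
  result : ℕ → ℕ
  result e = if ω e then array σ₀ %end₂ e else array σ₀ %end₁ e
  I : ℕ → State → Set
  I k σ = ∀ e → e < k → array σ outputArray e ≡ result e
  body : ∀ {k σ} → array σ %end₁ ≡ array σ₀ %end₁ → array σ %end₂ ≡ array σ₀ %end₂ → Holds (array σ %fixed) ω →
         scalar σ $e ≡ k → I k σ → Run _ σ 17 (λ τ → scalar τ $e ≡ suc k × I (suc k) τ)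
  body {k} {σ} end₁≡ end₂≡ fixed refl written =
    run-if {Q = λ τ → scalar τ $e ≡ k × I (suc k) τ}
      (λ nz → run-straight (refl , extend _ (trans (cong-app end₂≡ k) (selected (bit≢0 choice nz)))))
      (λ z → run-straight (refl , extend _ (trans (cong-app end₁≡ k) (selected (bit≡0 choice z)))))
    then-run λ _ (e≡ , written′) → run-straight (trans (cong (_+ 1) e≡) (+-comm k 1) , written′)
    where
    choice : array σ %fixed (k + 1) ≡ bit (ω k)
    choice = trans (cong (array σ %fixed) (+-comm k 1)) (fixed k)
    selected : ∀ {b} → ω k ≡ b → (if b then array σ₀ %end₂ k else array σ₀ %end₁ k) ≡ result k
    selected refl = refl
    extend : ∀ v → v ≡ result k → ∀ e → e < suc k → update (array σ outputArray) k v e ≡ result e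
    extend v v≡ e (s≤s e≤k) with m≤n⇒m<n∨m≡n e≤k
    ... | inj₁ e<k  = trans (update-neq (array σ outputArray) v (<⇒≢ e<k ∘ sym)) (written e e<k)
    ... | inj₂ refl = trans (update-eq (array σ outputArray) k v refl) v≡

-- Time bounds

-- A record rather than a bare inequality, so that `c` can be inferred: `_⊞_` adds the constants up,
-- and `relax` compares the sum with a round number by computation.
record Bounded (Y n c : ℕ) : Set where
  constructor bounded
  field
    bound : n ≤ c * Y

open Bounded

infixr 6 _⊞_

_⊞_ : ∀ {Y n n′ c c′} → Bounded Y n c → Bounded Y n′ c′ → Bounded Y (n + n′) (c + c′)
_⊞_ {Y} {c = c} {c′} (bounded p) (bounded q) = bounded (≤-trans (+-mono-≤ p q) (≤-reflexive (sym (*-distribʳ-+ Y c c′))))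

totalTime : (N #e m t L D K : ℕ) → ℕ
totalTime N #e m t L D K =
  (6 + (linkAllTime 1 #e + (linkAllTime 1 m + (exploreTime N m + (multiplesTime #e + collectTime N L D))))) +
  ((2 + (2 + t * (2 + forwardStepTime K))) + ((2 + (4 + t * (4 + backwardStepTime K))) + (2 + (4 + #e * (4 + 17)))))

module Budget (w r N : ℕ) (1≤w : 1 ≤ w) (1≤r : 1 ≤ r) (1≤N : 1 ≤ N) where

  -- `K` bounds the number of edges at a bag; up to constants, `R` is the time for a row, `X` that
  -- for an enumeration and `U` that for the whole run.
  K R X U : ℕ
  K = 2 * w * r
  R = w * r
  X = 2 ^ K * R
  U = X * N

  K≡2R : K ≡ 2 * R
  K≡2R = *-assoc 2 w r

  1≤R : 1 ≤ R
  1≤R = *-mono-≤ 1≤w 1≤r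

  R≤X : R ≤ X
  R≤X = ≤-trans (≤-reflexive (sym (*-identityˡ R))) (*-monoˡ-≤ R (m^n>0 2 K))

  1≤X : 1 ≤ X
  1≤X = ≤-trans 1≤R R≤X

  1≤U : 1 ≤ U
  1≤U = *-mono-≤ 1≤X 1≤N

  constant : ∀ {Y} → 1 ≤ Y → ∀ k → Bounded Y k k
  constant {Y} 1≤Y k = bounded (≤-trans (≤-reflexive (sym (*-identityʳ k))) (*-monoʳ-≤ k 1≤Y))

  relax : ∀ {Y n c c′} {_ : T (c ≤ᵇ c′)} → Bounded Y n c → Bounded Y n c′
  relax {Y} {c = c} {c′} {le} (bounded p) = bounded (≤-trans p (*-monoˡ-≤ Y (≤ᵇ⇒≤ c c′ le)))

  wider : ∀ {Y Z n c} → Y ≤ Z → Bounded Y n c → Bounded Z n c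
  wider {c = c} Y≤Z (bounded p) = bounded (≤-trans p (*-monoʳ-≤ c Y≤Z))

  row-bound : ∀ c d → Bounded R (rowTime c K d) ((4 + c) + 2 * (7 + d))
  row-bound c d = constant 1≤R (4 + c) ⊞ bounded (≤-reflexive (trans (cong (_* (7 + d)) K≡2R) (swap R (7 + d))))
    where
    swap : ∀ R d → 2 * R * d ≡ 2 * d * R
    swap = solve-∀

  encode-bound : ∀ r test → Bounded R (encodeTime r test K) ((1 + cost r) + (2 + (5 + 2 * (7 + (1 + cost test + 5 + 4)))))
  encode-bound r test = constant 1≤R (1 + cost r) ⊞ constant 1≤R 2 ⊞ row-bound 1 (1 + cost test + 5 + 4)

  increment-bound : Bounded R (incrementTime K) (2 + ((5 + 2 * 24) + 4))
  increment-bound = constant 1≤R 2 ⊞ row-bound 1 17 ⊞ constant 1≤R 4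

  locate-bound : Bounded R (locateTime K) 120
  locate-bound = relax (encode-bound (var $c) (masked %bit) ⊞ constant 1≤R 2 ⊞ encode-bound (var $r) chosen)

  enumerate-bound : ∀ {d c} → Bounded R d c → Bounded X (enumerateTime K d) (4 + (2 + (c + 59)))
  enumerate-bound {d} {c} b = constant 1≤X 4 ⊞ bounded (≤-trans
    (*-monoʳ-≤ (2 ^ K) (bound (constant 1≤R 2 ⊞ b ⊞ increment-bound)))
    (≤-reflexive (swap (2 ^ K) (2 + (c + 59)) R)))
    where
    swap : ∀ p c R → p * (c * R) ≡ c * (p * R)
    swap = solve-∀

  sweepStep-bound : Bounded R (sweepStepTime K) 260
  sweepStep-bound = relax (locate-bound ⊞ (constant 1≤R 2 ⊞ row-bound 1 35 ⊞ constant 1≤R 4) ⊞ constant 1≤R 29)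

  pushStep-bound : Bounded R (pushStepTime K) 140
  pushStep-bound = relax (locate-bound ⊞ constant 1≤R 15)

  fixStep-bound : Bounded R (fixStepTime K) 260
  fixStep-bound = relax (encode-bound (var $c) (masked %fixed) ⊞ constant 1≤R 2 ⊞ locate-bound ⊞ constant 1≤R 17 ⊞ row-bound 1 6)

  forwardStep-bound : Bounded X (2 + forwardStepTime K) 600
  forwardStep-bound = relax (constant 1≤X 12 ⊞ (constant 1≤X 2 ⊞ enumerate-bound sweepStep-bound) ⊞ (constant 1≤X 2 ⊞ enumerate-bound pushStep-bound))

  backwardStep-bound : Bounded X (4 + backwardStepTime K) 400
  backwardStep-bound = relax (constant 1≤X 10 ⊞ (constant 1≤X 2 ⊞ enumerate-bound fixStep-bound) ⊞ constant 1≤X 4)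

  vertex-bound : Bounded r (2 + collectVertexTime r) 60
  vertex-bound = relax (constant 1≤r 7 ⊞ (constant 1≤r 5 ⊞ bounded {c = 32} (≤-reflexive (*-comm r 32))) ⊞ constant 1≤r 8)

  bag-bound : Bounded X (4 + collectBagTime (suc w) r) 140
  bag-bound = relax (constant 1≤X 11 ⊞ wider R≤X (bounded {c = 120} (begin
    suc w * (2 + collectVertexTime r)  ≤⟨ *-mono-≤ (+-monoˡ-≤ w 1≤w) (bound vertex-bound) ⟩
    (w + w) * (60 * r)                 ≡⟨ swap w r ⟩
    120 * R                            ∎)) ⊞ constant 1≤X 4)
    where
    open ≤-Reasoning
    swap : ∀ w r → (w + w) * (60 * r) ≡ 120 * (w * r)
    swap = solve-∀

  scale : ∀ {d c n} → n ≤ N → Bounded X d c → Bounded U (n * d) c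
  scale {d} {c} {n} n≤N (bounded p) = bounded (≤-trans (*-mono-≤ n≤N p) (≤-reflexive (swap N c X)))
    where
    swap : ∀ N c X → N * (c * X) ≡ c * (X * N)
    swap = solve-∀

  -- The hypothesis comes from counting each edge at a bag that it touches, as a bag has at most `K`
  -- edges. It lets work linear in the number of edges fit into `U`.
  edge-bound : ∀ {#e} → #e ≤ N * K → ∀ k → Bounded U (#e * k) (2 * k)
  edge-bound {#e} #e≤ k = bounded (begin
    #e * k             ≤⟨ *-monoˡ-≤ k #e≤ ⟩
    N * K * k          ≡⟨ cong (λ K → N * K * k) K≡2R ⟩
    N * (2 * R) * k    ≡⟨ swap N R k ⟩
    2 * k * (R * N)    ≤⟨ *-monoʳ-≤ (2 * k) (*-monoˡ-≤ N R≤X) ⟩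
    2 * k * U          ∎)
    where
    open ≤-Reasoning
    swap : ∀ N R k → N * (2 * R) * k ≡ 2 * k * (R * N)
    swap = solve-∀

  explore-bound : ∀ {m} → m ≤ N → Bounded U (exploreTime N m) 104
  explore-bound {m} m≤N = constant 1≤U 14 ⊞ scale ≤-refl (constant 1≤X 16) ⊞
    bounded (≤-trans (≤-reflexive (*-distribʳ-+ 37 m m)) (bound {c = 74} (scale m≤N (constant 1≤X 37) ⊞ scale m≤N (constant 1≤X 37))))

  total-bound : ∀ {#e m t} → #e ≤ N * K → m ≤ N → t ≤ N → totalTime N #e m t (suc w) r K ≤ 2000 * U
  -- The constants below add up to 1525, which is rounded up to 2000.
  total-bound #e≤ m≤N t≤N = bound {c = 2000} (relax
    ((constant 1≤U 6 ⊞ (constant 1≤U 6 ⊞ edge-bound #e≤ 53) ⊞ (constant 1≤U 6 ⊞ scale m≤N (constant 1≤X 53)) ⊞ explore-bound m≤N ⊞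
      (constant 1≤U 8 ⊞ edge-bound #e≤ 15) ⊞ (constant 1≤U 8 ⊞ scale ≤-refl bag-bound)) ⊞
     (constant 1≤U 4 ⊞ scale t≤N forwardStep-bound) ⊞ (constant 1≤U 6 ⊞ scale t≤N backwardStep-bound) ⊞ (constant 1≤U 6 ⊞ edge-bound #e≤ 21)))

-- Correctness and optimality

prepare : Program
prepare =
  $S ≔ var $N ⊕ var $V ⊕ lit 1 ⨟
  linkAll $E (var $N) %end₁ %end₂ ⨟
  linkAll $M (lit 0) %tree₁ %tree₂ ⨟
  explore ⨟
  multiples ⨟
  collect

solve : Program
solve = forward ⨟ backward ⨟ writeOutput

balance : Program
balance = prepare ⨟ solve

-- The instance and its bags in terms of numbers

module Reduction {G : Multigraph} (p : Weighting G) (D : TreeDecomposition G) where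

  N #e m #v S w r : ℕ
  N  = #bags D
  #e = #E G
  m  = #E (tree D)
  #v = #V G
  S  = N + #v + 1
  -- With both parameters at least 1, `suc w` is at most `w + w` and the time units of `Budget` are
  -- positive.
  w  = width D ⊔ 1
  r  = maxDegree G ⊔ 1

  0<N : 0 < N
  0<N = ≤-<-trans z≤n (Finₚ.toℕ<n (IsTree.root (isTree D)))

  open Budget w r N (m≤n⊔m (width D) 1) (m≤n⊔m (maxDegree G) 1) 0<N public

  σ₀ : State
  σ₀ = input G p D

  first second weight tree₁ tree₂ : ℕ → ℕ
  first  = array σ₀ %end₁
  second = array σ₀ %end₂
  weight = array σ₀ %weight
  tree₁  = array σ₀ %tree₁
  tree₂  = array σ₀ %tree₂

  index< : ∀ {n k} → k < n → ∃ λ (i : Fin n) → toℕ i ≡ k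
  index< k<n = fromℕ< k<n , Finₚ.toℕ-fromℕ< k<n

  cells< : ∀ {n b} (f : Fin n → ℕ) → (∀ i → f i < b) → ∀ k → k < n → cells (map f (allFin n)) k < b
  cells< f f< k k<n with index< k<n
  ... | i , refl = subst (_< _) (sym (cells-allFin f i)) (f< i)

  first< : ∀ e → e < #e → first e < #v
  first< = cells< _ λ e → Finₚ.toℕ<n (end₁ G e)

  second< : ∀ e → e < #e → second e < #v
  second< = cells< _ λ e → Finₚ.toℕ<n (end₂ G e)

  tree< : ∀ e → e < m → tree₁ e < N × tree₂ e < N
  tree< e e<m = cells< _ (λ e → Finₚ.toℕ<n (end₁ (tree D) e)) e e<m , cells< _ (λ e → Finₚ.toℕ<n (end₂ (tree D) e)) e e<m

  open Exploring N m tree₁ tree₂ tree< public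

  first-at : ∀ e → first (toℕ e) ≡ toℕ (end₁ G e)
  first-at = cells-allFin _

  second-at : ∀ e → second (toℕ e) ≡ toℕ (end₂ G e)
  second-at = cells-allFin _

  N+v<S : ∀ {v} → v < #v → N + v < S
  N+v<S v< = ≤-trans (+-monoʳ-< N v<) (m≤m+n (N + #v) 1)

  N<S : N < S
  N<S = ≤-trans (s≤s (m≤m+n N #v)) (≤-reflexive (+-comm 1 (N + #v)))

  -- Rows 0, …, N − 1 of the adjacency table belong to the tree nodes, rows N, N + 1, … to the vertices of G.
  side₁ side₂ : ℕ → ℕ
  side₁ e = N + first e
  side₂ e = N + second e

  adjacency : ℕ → List ℕ
  adjacency u = hits side₁ side₂ #e u ++ hits tree₁ tree₂ m u

  empty : ∀ {xs : List ℕ} → (∀ {x} → x ∉ xs) → xs ≡ []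
  empty {[]}     _    = refl
  empty {x ∷ xs} none = ⊥-elim (none (here refl))

  adjacency-node : ∀ x → x < N → adjacency x ≡ hits tree₁ tree₂ m x
  adjacency-node x x<N = cong (_++ hits tree₁ tree₂ m x) (empty λ e∈ →
    [ (λ eq → <⇒≱ x<N (≤-trans (m≤m+n N _) (≤-reflexive eq))) , (λ eq → <⇒≱ x<N (≤-trans (m≤m+n N _) (≤-reflexive eq))) ]′
      (proj₂ (∈-hits⁻ side₁ side₂ {#e} {x} e∈)))

  adjacency-vertex : ∀ v → adjacency (N + v) ≡ hits side₁ side₂ #e (N + v)
  adjacency-vertex v = trans (cong (hits side₁ side₂ #e (N + v) ++_) (empty λ {e} e∈ → far e (∈-hits⁻ tree₁ tree₂ {m} {N + v} e∈))) (++-identityʳ _)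
    where
    far : ∀ e → ¬ (e < m × (tree₁ e ≡ N + v ⊎ tree₂ e ≡ N + v))
    far e (e<m , inj₁ eq) = <⇒≱ (proj₁ (tree< e e<m)) (≤-trans (m≤m+n N v) (≤-reflexive (sym eq)))
    far e (e<m , inj₂ eq) = <⇒≱ (proj₂ (tree< e e<m)) (≤-trans (m≤m+n N v) (≤-reflexive (sym eq)))

  ∈-incident : ∀ v {e} → e ∈ adjacency (N + v) → e < #e × (first e ≡ v ⊎ second e ≡ v)
  ∈-incident v {e} e∈ with ∈-hits⁻ side₁ side₂ {#e} {N + v} (subst (e ∈_) (adjacency-vertex v) e∈)
  ... | e< , inj₁ eq = e< , inj₁ (+-cancelˡ-≡ N _ _ eq)
  ... | e< , inj₂ eq = e< , inj₂ (+-cancelˡ-≡ N _ _ eq)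

  incident-∈ : ∀ v {e} → e < #e → first e ≡ v ⊎ second e ≡ v → e ∈ adjacency (N + v)
  incident-∈ v {e} e< touch = subst (e ∈_) (sym (adjacency-vertex v))
    (∈-hits⁺ side₁ side₂ e< ([ inj₁ ∘ cong (N +_) , inj₂ ∘ cong (N +_) ]′ touch))

  degree-bound : ∀ v → v < #v → length (adjacency (N + v)) ≤ r
  degree-bound v v< with index< v<
  ... | v̂ , refl = begin
    length (adjacency (N + toℕ v̂))                ≡⟨ cong length (adjacency-vertex (toℕ v̂)) ⟩
    length (hits side₁ side₂ #e (N + toℕ v̂))      ≤⟨ length-⊆ (unique-hits side₁ side₂ #e _) incident ⟩
    length (map toℕ (incidentEdges G v̂))          ≡⟨ length-map toℕ (incidentEdges G v̂) ⟩
    length (incidentEdges G v̂)                    ≤⟨ All.lookup (xs≤max 0 _) (∈-map⁺ (length ∘ incidentEdges G) (∈-allFin v̂)) ⟩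
    maxDegree G                                   ≤⟨ m≤m⊔n _ 1 ⟩
    r                                             ∎
    where
    open ≤-Reasoning
    incident : ∀ {e} → e ∈ hits side₁ side₂ #e (N + toℕ v̂) → e ∈ map toℕ (incidentEdges G v̂)
    incident {e} e∈ with ∈-incident (toℕ v̂) (subst (e ∈_) (sym (adjacency-vertex (toℕ v̂))) e∈)
    ... | e< , touch with index< e<
    ...   | ê , refl = ∈-map⁺ toℕ (∈-filter⁺ (λ e → (end₁ G e Finₚ.≟ v̂) ⊎-dec (end₂ G e Finₚ.≟ v̂)) (∈-allFin ê)
                         ([ (λ eq → inj₁ (Finₚ.toℕ-injective (trans (sym (first-at ê)) eq))) ,
                            (λ eq → inj₂ (Finₚ.toℕ-injective (trans (sym (second-at ê)) eq))) ]′ touch))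

  bagList : Vertex (tree D) → List ℕ
  bagList i = map toℕ (members (bag D i))

  vertices : ℕ → List ℕ
  vertices i with i <? N
  ... | yes i<N = bagList (fromℕ< i<N)
  ... | no _    = []

  vertices-at : ∀ i → vertices (toℕ i) ≡ bagList i
  vertices-at i with toℕ i <? N
  ... | yes i<N = cong bagList (Finₚ.fromℕ<-toℕ i i<N)
  ... | no i≮N  = ⊥-elim (i≮N (Finₚ.toℕ<n i))

  no-vertices : ∀ i → N ≤ i → vertices i ≡ []
  no-vertices i N≤i with i <? N
  ... | yes i<N = ⊥-elim (<⇒≱ i<N N≤i)
  ... | no _    = refl

  sizes : ℕ → ℕ
  sizes = array σ₀ %size

  bagList-length : ∀ i → length (bagList i) ≡ ∣ bag D i ∣
  bagList-length i = trans (length-map toℕ (members (bag D i))) (length-members (bag D i))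

  sizes≡ : ∀ i → i < N → sizes i ≡ length (vertices i)
  sizes≡ i i<N with index< i<N
  ... | î , refl = trans (cells-allFin _ î) (sym (trans (cong length (vertices-at î)) (bagList-length î)))

  bag-size : ∀ i → i < N → length (vertices i) ≤ suc w
  bag-size i i<N with index< i<N
  ... | î , refl = begin
    length (vertices (toℕ î))  ≡⟨ trans (cong length (vertices-at î)) (bagList-length î) ⟩
    ∣ bag D î ∣                ≤⟨ All.lookup (xs≤max 0 _) (∈-map⁺ (∣_∣ ∘ bag D) (∈-allFin î)) ⟩
    largest                    ≤⟨ m≤n+m∸n largest 1 ⟩
    suc (width D)              ≤⟨ s≤s (m≤m⊔n (width D) 1) ⟩
    suc w                      ∎
    where
    open ≤-Reasoning
    largest = max 0 (map (λ i → ∣ bag D i ∣) (allFin N))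

  ∈-vertices⁻ : ∀ i {v} → v ∈ vertices (toℕ i) → ∃ λ v̂ → v ≡ toℕ v̂ × v̂ ∈ˢ bag D i
  ∈-vertices⁻ i {v} v∈ with ∈-map⁻ toℕ (subst (v ∈_) (vertices-at i) v∈)
  ... | v̂ , v̂∈ , eq = v̂ , eq , ∈-members⁻ v̂∈

  ∈-vertices⁺ : ∀ i {v} → v ∈ˢ bag D i → toℕ v ∈ vertices (toℕ i)
  ∈-vertices⁺ i v∈ = subst (_ ∈_) (sym (vertices-at i)) (∈-map⁺ toℕ (∈-members⁺ v∈))

  vertices< : ∀ i → i < N → ∀ v → v ∈ vertices i → v < #v
  vertices< i i<N v v∈ with index< i<N
  ... | î , refl with ∈-vertices⁻ î v∈
  ...   | v̂ , refl , _ = Finₚ.toℕ<n v̂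

  open Collecting S N #e #v (suc w) r N<S adjacency vertices (array σ₀ %bag) sizes
    (λ _ → N+v<S) degree-bound (λ v _ e e∈ → proj₁ (∈-incident v e∈)) sizes≡ bag-size vertices< no-vertices public

  ∈-edgesAt⁻ : ∀ i {e} → e ∈ edgesAt (toℕ i) → ∃ λ ê → e ≡ toℕ ê × Touches D ê i
  ∈-edgesAt⁻ i {e} e∈ with ∈-bagEdges⁻ (vertices (toℕ i)) e∈
  ... | v , v∈ , e∈v with ∈-vertices⁻ i v∈ | ∈-incident v e∈v
  ...   | v̂ , refl , v̂∈ | e< , touch with index< e<
  ...     | ê , refl = ê , refl , [ (λ eq → inj₁ (at (first-at ê) eq)) , (λ eq → inj₂ (at (second-at ê) eq)) ]′ touch
    where
    at : ∀ {x} {y : Vertex G} → x ≡ toℕ y → x ≡ toℕ v̂ → y ∈ˢ bag D i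
    at x≡y x≡v = subst (_∈ˢ bag D i) (Finₚ.toℕ-injective (trans (sym x≡v) x≡y)) v̂∈

  ∈-edgesAt⁺ : ∀ i e → Touches D e i → toℕ e ∈ edgesAt (toℕ i)
  ∈-edgesAt⁺ i e (inj₁ v∈) = ∈-bagEdges⁺ (vertices (toℕ i)) (∈-vertices⁺ i v∈) (incident-∈ _ (Finₚ.toℕ<n e) (inj₁ (first-at e)))
  ∈-edgesAt⁺ i e (inj₂ v∈) = ∈-bagEdges⁺ (vertices (toℕ i)) (∈-vertices⁺ i v∈) (incident-∈ _ (Finₚ.toℕ<n e) (inj₂ (second-at e)))

  edgesAt-N : edgesAt N ≡ []
  edgesAt-N = cong bagEdges (no-vertices N ≤-refl)

  edgesAt< : ∀ i → i ≤ N → ∀ e → e ∈ edgesAt i → e < #e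
  edgesAt< i i≤N e e∈ with ∈-bagEdges⁻ (vertices i) e∈
  ... | v , _ , e∈v = proj₁ (∈-incident v e∈v)

  edgesAt-short : ∀ i → i ≤ N → length (edgesAt i) ≤ K
  edgesAt-short i i≤N with m≤n⇒m<n∨m≡n i≤N
  ... | inj₂ refl = ≤-trans (≤-reflexive (cong length edgesAt-N)) z≤n
  ... | inj₁ i<N = begin
    length (edgesAt i)                              ≤⟨ length-⊆ (unique-bagEdges (vertices i)) (λ e∈ → collect⁺ (∈-bagEdges⁻ (vertices i) e∈)) ⟩
    length (concatMap (λ v → adjacency (N + v)) (vertices i)) ≤⟨ length-concatMap _ (vertices i) (λ {v} v∈ → degree-bound v (vertices< i i<N v v∈)) ⟩
    length (vertices i) * r                         ≤⟨ *-monoˡ-≤ r (≤-trans (bag-size i i<N) (+-monoˡ-≤ w (m≤n⊔m (width D) 1))) ⟩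
    (w + w) * r                                     ≡⟨ cong (λ x → (w + x) * r) (+-identityʳ w) ⟨
    K                                               ∎
    where
    open ≤-Reasoning
    collect⁺ : ∀ {e} → (∃ λ v → v ∈ vertices i × e ∈ adjacency (N + v)) → e ∈ concatMap (λ v → adjacency (N + v)) (vertices i)
    collect⁺ (v , v∈ , e∈) = ∈-concat⁺′ e∈ (∈-map⁺ (λ v → adjacency (N + v)) v∈)

  #e≤NK : #e ≤ N * K
  #e≤NK = begin
    #e                                   ≡⟨ length-upTo #e ⟨
    length (upTo #e)                     ≤⟨ length-⊆ (Uniqueₚ.upTo⁺ #e) (covered ∘ ∈-upTo⁻) ⟩
    length (concatMap edgesAt (upTo N))  ≤⟨ length-concatMap edgesAt (upTo N) (λ i∈ → edgesAt-short _ (<⇒≤ (∈-upTo⁻ i∈))) ⟩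
    length (upTo N) * K                  ≡⟨ cong (_* K) (length-upTo N) ⟩
    N * K                                ∎
    where
    open ≤-Reasoning
    covered : ∀ {e} → e < #e → e ∈ concatMap edgesAt (upTo N)
    covered e< with index< e<
    ... | ê , refl with coversEdge D ê
    ...   | i , v∈ , _ = ∈-concat⁺′ (∈-edgesAt⁺ i ê (inj₁ v∈)) (∈-map⁺ edgesAt (∈-upTo⁺ (Finₚ.toℕ<n i)))

  stored : ∀ x → array σ₀ %bag x ≡ cells (stream 0 N) x
  stored x = cong (λ xs → cells xs x) (trans (cong concat (map-tabulate id bagList)) (streamed N 0 bagList (λ i → vertices-at i)))
    where
    streamed : ∀ n k (h : Fin n → List ℕ) → (∀ i → vertices (k + toℕ i) ≡ h i) → concat (tabulate h) ≡ stream k n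
    streamed zero    k h eq = refl
    streamed (suc n) k h eq = cong₂ _++_ (sym (trans (cong vertices (sym (+-identityʳ k))) (eq Fin.zero)))
      (streamed n (suc k) (h ∘ Fin.suc) λ i → trans (cong vertices (sym (+-suc k (toℕ i)))) (eq (Fin.suc i)))

-- Preprocessing, and the rooted tree that it finds

module Balancing {G : Multigraph} (p : Weighting G) (D : TreeDecomposition G) where

  open Reduction p D

  record Prepared (τ : State) : Set where
    field
      stride   : scalar τ $S ≡ S
      explored : Explored (scalar τ $t) (array τ %queue) (array τ %pos) (array τ %parent)
      closed   : Closed (scalar τ $t) (array τ %queue) (array τ %pos)
      mul      : ∀ e → e < #e → array τ %mul (suc e) ≡ S * suc e
      table    : Table S #e (array τ %row) (array τ %in) edgesAt

  prepareTime : ℕ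
  prepareTime = 6 + (linkAllTime 1 #e + (linkAllTime 1 m + (exploreTime N m + (multiplesTime #e + collectTime N (suc w) r))))

  run-prepare : Run prepare σ₀ prepareTime Prepared
  run-prepare =
    straight-then λ s₁ →
    run-linkAll side₁ side₂ (λ _ → []) refl refl
      (λ s e _ → cong₂ (λ x A → x + A e) (scalars s $N) (arrays s %end₁) , λ _ → cong₂ (λ x A → x + A e) (scalars s $N) (arrays s %end₂))
      (λ e e< → N+v<S (first< e e<) , N+v<S (second< e e<))
      (record { rows = λ _ _ _ → refl ; ends = λ _ _ → sym (*-zeroʳ S) }) then-run λ s₂ l₂ →
    run-linkAll tree₁ tree₂ (hits side₁ side₂ #e) (scalars s₂ $S) (scalars s₂ $M)
      (λ s e _ → cong-app (arrays (s₂ ▹ s) %tree₁) e , λ _ → cong-app (arrays (s₂ ▹ s) %tree₂) e)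
      (λ e e< → <-trans (proj₁ (tree< e e<)) N<S , <-trans (proj₂ (tree< e e<)) N<S)
      l₂ then-run λ s₃ l₃ →
    let r₃ = s₂ ▹ s₃ in
    run-explore {R = adjacency} (scalars r₃ $S) (scalars r₃ $N) 0<N (<⇒≤ N<S) (arrays r₃ %tree₁) (arrays r₃ %tree₂)
      (Linked.rows l₃) adjacency-node (cong-app (arrays r₃ %queue)) (cong-app (arrays r₃ %pos)) then-run λ s₄ (ex , cl) →
    let r₄ = r₃ ▹ s₄ in
    run-multiples (scalars r₄ $S) (scalars r₄ $E) then-run λ s₅ muls →
    let r₅ = r₄ ▹ s₅ in
    weaken ≤-refl
      (run-collect
        (record { stride = scalars r₅ $S
                ; #bags≡ = scalars r₅ $N
                ; adj    = subst (λ A → Rows A S adjacency) (sym (arrays (s₄ ▹ s₅) %adj)) (Linked.rows l₃)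
                ; mul    = muls
                ; bag≡   = arrays r₅ %bag
                ; size≡  = arrays r₅ %size })
        stored (cong-app (arrays r₅ %row)) (cong-app (arrays r₅ %in)))
      λ {τ} s₆ tab → let r₆ = s₅ ▹ s₆ in record
        { stride   = scalars (r₅ ▹ s₆) $S
        ; explored = explored′ (scalars r₆ $t) (arrays r₆ %queue) (arrays r₆ %pos) (arrays r₆ %parent) ex
        ; closed   = closed′ (scalars r₆ $t) (arrays r₆ %queue) (arrays r₆ %pos) cl
        ; mul      = λ e e< → trans (cong-app (arrays s₆ %mul) (suc e)) (muls e e<)
        ; table    = tab
        }
    where
    explored′ : ∀ {t t′ Q Q′ P P′ F F′} → t′ ≡ t → Q′ ≡ Q → P′ ≡ P → F′ ≡ F → Explored t Q P F → Explored t′ Q′ P′ F′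
    explored′ refl refl refl refl ex = ex
    closed′ : ∀ {t t′ Q Q′ P P′} → t′ ≡ t → Q′ ≡ Q → P′ ≡ P → Closed t Q P → Closed t′ Q′ P′
    closed′ refl refl refl cl = cl

  module Order {t : ℕ} {Q pos par : ℕ → ℕ} (explored : Explored t Q pos par) (closed : Closed t Q pos) where
    open Explored explored

    reached : ∀ i → pos (toℕ i) ≢ 0
    reached i = along (IsTree.connected (isTree D) (fromℕ< 0<N) i)
      (λ z → case trans (sym z) (trans (cong pos (trans (Finₚ.toℕ-fromℕ< 0<N) (sym root))) (proj₂ (queue 0 nonempty))) of λ ())
      where
      along : ∀ {i j} → Walk (tree D) i j → pos (toℕ i) ≢ 0 → pos (toℕ j) ≢ 0
      along ε nz = nz
      along ((e , j) ◅ π) nz with visited _ nz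
      ... | k , k<t , Qk with closed k k<t (toℕ e) (Finₚ.toℕ<n e)
      ...   | seen with j
      ...     | inj₁ (refl , refl) = along π (proj₂ (seen (inj₁ (trans (cells-allFin _ e) (sym Qk)))) ∘ trans (cong pos (cells-allFin _ e)))
      ...     | inj₂ (refl , refl) = along π (proj₁ (seen (inj₂ (trans (cells-allFin _ e) (sym Qk)))) ∘ trans (cong pos (cells-allFin _ e)))

    rank : Vertex (tree D) → ℕ
    rank i = proj₁ (visited _ (reached i))

    rank< : ∀ i → rank i < t
    rank< i = proj₁ (proj₂ (visited _ (reached i)))

    at-rank : ∀ i → Q (rank i) ≡ toℕ i
    at-rank i = proj₂ (proj₂ (visited _ (reached i)))

    rank-injective : ∀ {i j} → rank i ≡ rank j → i ≡ j
    rank-injective {i} {j} eq = Finₚ.toℕ-injective (trans (sym (at-rank i)) (trans (cong Q eq) (at-rank j)))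

    rank-unique : ∀ {i k} → k < t → Q k ≡ toℕ i → rank i ≡ k
    rank-unique {i} k<t eq = queue-injective _ _ (rank< i) k<t (trans (at-rank i) (sym eq))

    -- Parent and connecting edge of the node at a queue position. The pair at position 0 is a
    -- default that makes `up` and `upEdge` total; `climbs` speaks about the other positions only.
    above : ∀ k → k < t → Vertex (tree D) × ℕ
    above zero    _   = fromℕ< 0<N , 0
    above (suc k) k<t with parents (suc k) k<t 1+n≢0
    ... | j , j<k , _ , e , _ = fromℕ< (proj₁ (queue j (<-trans j<k k<t))) , e

    above-spec : ∀ k (k<t : k < t) → k ≢ 0 → ∀ i → Q k ≡ toℕ i → let u , e = above k k<t in
      toℕ u ≡ par (Q k) × rank u < k × ∃ λ ê → toℕ ê ≡ e × Joins (tree D) ê i u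
    above-spec zero    k<t k≢0 i Qk = ⊥-elim (k≢0 refl)
    above-spec (suc k) k<t k≢0 i Qk with parents (suc k) k<t 1+n≢0
    ... | j , j<k , p≡ , e , e<m , ends = trans u≡ (sym p≡) , subst (_< suc k) (sym (rank-unique j<t (sym u≡))) j<k ,
          fromℕ< e<m , Finₚ.toℕ-fromℕ< e<m , joins ends
      where
      j<t = <-trans j<k k<t
      u≡ : toℕ (fromℕ< (proj₁ (queue j j<t))) ≡ Q j
      u≡ = Finₚ.toℕ-fromℕ< (proj₁ (queue j j<t))
      same-node : ∀ {x : Vertex (tree D)} {y} (f : Edge (tree D) → Vertex (tree D)) → cells (map (toℕ ∘ f) (allFin m)) e ≡ y → y ≡ toℕ x → f (fromℕ< e<m) ≡ x
      same-node f f≡ y≡ = Finₚ.toℕ-injective (trans (sym (cells-allFin (toℕ ∘ f) (fromℕ< e<m)))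
        (trans (cong (cells (map (toℕ ∘ f) (allFin m))) (Finₚ.toℕ-fromℕ< e<m)) (trans f≡ y≡)))
      joins : Ends e (Q j) (Q (suc k)) → Joins (tree D) (fromℕ< e<m) i (fromℕ< (proj₁ (queue j j<t)))
      joins (inj₁ (p , q)) = inj₂ (same-node (end₁ (tree D)) p (sym u≡) , same-node (end₂ (tree D)) q Qk)
      joins (inj₂ (p , q)) = inj₁ (same-node (end₁ (tree D)) p Qk , same-node (end₂ (tree D)) q (sym u≡))

    up : Vertex (tree D) → Vertex (tree D)
    up i = proj₁ (above (rank i) (rank< i))

    upEdge : Vertex (tree D) → ℕ
    upEdge i = proj₂ (above (rank i) (rank< i))

    climbs : ∀ i → rank i ≢ 0 → rank (up i) < rank i × ∃ λ e → toℕ e ≡ upEdge i × Joins (tree D) e i (up i)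
    climbs i nz = proj₂ (above-spec (rank i) (rank< i) nz i (at-rank i))

    open Rooted (tree D) rank rank-injective up upEdge climbs using (edges≤vertices)
    open Separation D rank rank-injective up upEdge climbs using (touches-up)

    m≤N : m ≤ N
    m≤N = edges≤vertices (IsTree.acyclic (isTree D))

    shared-edge-up : ∀ {a c e} → rank c < rank a → e ∈ edgesAt (toℕ a) → e ∈ edgesAt (toℕ c) → e ∈ edgesAt (toℕ (up a))
    shared-edge-up {a} {c} c<a e∈a e∈c =
      let ê  , e≡  , at-a = ∈-edgesAt⁻ a e∈a
          ê′ , e≡′ , at-c = ∈-edgesAt⁻ c e∈c
      in subst (_∈ edgesAt (toℕ (up a))) (sym e≡)
           (∈-edgesAt⁺ (up a) ê (touches-up c<a at-a (subst (λ e → Touches D e c) (Finₚ.toℕ-injective (trans (sym e≡′) e≡)) at-c)))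

    separated : ∀ j k → j < k → k < t → ∀ e → e ∈ edgesAt (Q k) → e ∈ edgesAt (Q j) → e ∈ edgesAt (par (Q k))
    separated j k j<k k<t e e∈k e∈j =
      let a , a≡ = index< (proj₁ (queue k k<t))
          c , c≡ = index< (proj₁ (queue j (<-trans j<k k<t)))
          rank-a = rank-unique {a} k<t (sym a≡)
          rank-c = rank-unique {c} (<-trans j<k k<t) (sym c≡)
          nonroot = λ z → n≮0 (subst (j <_) (trans (sym rank-a) z) j<k)
          up≡ = trans (proj₁ (above-spec (rank a) (rank< a) nonroot a (at-rank a))) (cong (λ k → par (Q k)) rank-a)
      in subst (λ x → e ∈ edgesAt x) up≡
           (shared-edge-up {a} {c} (subst₂ _<_ (sym rank-c) (sym rank-a) j<k)
             (subst (λ x → e ∈ edgesAt x) (sym a≡) e∈k) (subst (λ x → e ∈ edgesAt x) (sym c≡) e∈j))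

-- Loads at the bags and the makespan

module Optimality {G : Multigraph} (p : Weighting G) (D : TreeDecomposition G) where

  open Reduction p D
  open Loads first second weight #v

  load-sum : ∀ α v es → load es α v ≡ sum (map weight (filter (λ e → target α e ≟ v) es))
  load-sum α v []       = refl
  load-sum α v (e ∷ es) with target α e ≟ v
  ... | yes eq rewrite eq | ≡ᵇ-refl v = cong (weight e +_) (load-sum α v es)
  ... | no neq rewrite ≢⇒≡ᵇ-false neq = load-sum α v es

  Matches : Choice → Orientation G → Set
  Matches α o = ∀ e → target α (toℕ e) ≡ toℕ (head o e)

  inDegree-sum : ∀ o v → weightedInDegree {G} p o v ≡ sum (map weight (map toℕ (filter (λ e → head o e Finₚ.≟ v) (allFin #e))))
  inDegree-sum o v = cong sum (trans (map-cong (λ e → sym (cells-allFin p e)) into) (map-∘ into))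
    where into = filter (λ e → head o e Finₚ.≟ v) (allFin #e)

  load≤inDegree : ∀ {α o} → Matches α o → ∀ i → i < N → ∀ v → load (edgesAt i) α (toℕ v) ≤ weightedInDegree {G} p o v
  load≤inDegree {α} {o} matches i i<N v = subst₂ _≤_ (sym (load-sum α (toℕ v) (edgesAt i))) (sym (inDegree-sum o v))
    (sum-⊆ weight (Uniqueₚ.filter⁺ into? (unique-bagEdges (vertices i))) included)
    where
    into? = λ e → target α e ≟ toℕ v
    included : ∀ {e} → e ∈ filter into? (edgesAt i) → e ∈ map toℕ (filter (λ e → head o e Finₚ.≟ v) (allFin #e))
    included e∈ =
      let e∈i , into = ∈-filter⁻ into? {xs = edgesAt i} e∈
          ê , ê≡     = index< (edgesAt< i (<⇒≤ i<N) _ e∈i)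
          to-v       = Finₚ.toℕ-injective (trans (sym (matches ê)) (trans (cong (target α) ê≡) into))
      in subst (_∈ map toℕ (filter (λ e → head o e Finₚ.≟ v) (allFin #e))) ê≡
           (∈-map⁺ toℕ (∈-filter⁺ (λ e → head o e Finₚ.≟ v) (∈-allFin ê) to-v))

  -- Every edge directed into `v` has `v` as an end, so it is among the edges at any bag that
  -- contains `v`.
  inDegree≤load : ∀ {α o} → Matches α o → ∀ i v → v ∈ˢ bag D i → weightedInDegree {G} p o v ≤ load (edgesAt (toℕ i)) α (toℕ v)
  inDegree≤load {α} {o} matches i v v∈ = subst₂ _≤_ (sym (inDegree-sum o v)) (sym (load-sum α (toℕ v) (edgesAt (toℕ i))))
    (sum-⊆ weight (Uniqueₚ.map⁺ Finₚ.toℕ-injective (Uniqueₚ.filter⁺ into? (Uniqueₚ.allFin⁺ #e))) included)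
    where
    into? = λ e → head o e Finₚ.≟ v
    included : ∀ {e} → e ∈ map toℕ (filter into? (allFin #e)) → e ∈ filter (λ e → target α e ≟ toℕ v) (edgesAt (toℕ i))
    included e∈ with ∈-map⁻ toℕ e∈
    ... | ê , ê∈ , refl with ∈-filter⁻ into? {xs = allFin #e} ê∈
    ...   | _ , refl = ∈-filter⁺ (λ e → target α e ≟ toℕ v) (∈-edgesAt⁺ i ê (touches (head-valid o ê))) (matches ê)
      where
      touches : head o ê ≡ end₁ G ê ⊎ head o ê ≡ end₂ G ê → Touches D ê i
      touches (inj₁ eq) = inj₁ (subst (_∈ˢ bag D i) eq v∈)
      touches (inj₂ eq) = inj₂ (subst (_∈ˢ bag D i) eq v∈)

  orient : Choice → Orientation G
  orient ω = record { head = λ e → if ω (toℕ e) then end₂ G e else end₁ G e ; head-valid = λ e → valid (ω (toℕ e)) }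
    where
    valid : ∀ b {e} → (if b then end₂ G e else end₁ G e) ≡ end₁ G e ⊎ (if b then end₂ G e else end₁ G e) ≡ end₂ G e
    valid true  = inj₂ refl
    valid false = inj₁ refl

  target-at : ∀ ω e → target ω (toℕ e) ≡ toℕ (if ω (toℕ e) then end₂ G e else end₁ G e)
  target-at ω e with ω (toℕ e)
  ... | true  = second-at e
  ... | false = first-at e

  -- A loop gets its first end, which is also its head; numbers that belong to no edge get a
  -- default.
  choice : Orientation G → Choice
  choice o k with k <? #e
  ... | yes k< = not (does (head o (fromℕ< k<) Finₚ.≟ end₁ G (fromℕ< k<)))
  ... | no _   = false

  choice-at : ∀ o e → choice o (toℕ e) ≡ not (does (head o e Finₚ.≟ end₁ G e))
  choice-at o e with toℕ e <? #e
  ... | yes k< = cong (λ e → not (does (head o e Finₚ.≟ end₁ G e))) (Finₚ.fromℕ<-toℕ e k<)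
  ... | no k≮  = ⊥-elim (k≮ (Finₚ.toℕ<n e))

  choice-matches : ∀ o → Matches (choice o) o
  choice-matches o e rewrite choice-at o e with head o e Finₚ.≟ end₁ G e
  ... | yes eq = trans (first-at e) (cong toℕ (sym eq))
  ... | no neq with head-valid o e
  ...   | inj₁ eq = ⊥-elim (neq eq)
  ...   | inj₂ eq = trans (second-at e) (cong toℕ (sym eq))

  inDegree≤makespan : ∀ o v → weightedInDegree {G} p o v ≤ makespan {G} p o
  inDegree≤makespan o v = All.lookup (xs≤max 0 _) (∈-map⁺ (weightedInDegree {G} p o) (∈-allFin v))

  peak≤makespan : ∀ o i → i < N → peak (edgesAt i) (choice o) ≤ makespan {G} p o
  peak≤makespan o i i<N = peak-least (edgesAt i) (choice o) below
    where
    below : ∀ v → v < #v → load (edgesAt i) (choice o) v ≤ makespan {G} p o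
    below v v< with index< v<
    ... | v̂ , refl = ≤-trans (load≤inDegree {o = o} (choice-matches o) i i<N v̂) (inDegree≤makespan o v̂)

  makespan≤ : ∀ ω B → (∀ i → peak (edgesAt (toℕ i)) ω ≤ B) → makespan {G} p (orient ω) ≤ B
  makespan≤ ω B peaks = max≤v⁺ {xs = map (weightedInDegree {G} p (orient ω)) (allFin #v)} z≤n (Allₚ.map⁺ (All.tabulate λ {v} _ → below v))
    where
    below : ∀ v → weightedInDegree {G} p (orient ω) v ≤ B
    below v with coversVertex D v
    ... | i , v∈ = ≤-trans (inDegree≤load {o = orient ω} (target-at ω) i v v∈) (≤-trans (load≤peak (edgesAt (toℕ i)) ω (Finₚ.toℕ<n v)) (peaks i))

module Conclusion {G : Multigraph} (p : Weighting G) (D : TreeDecomposition G) where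

  open Reduction p D
  open Balancing p D
  open Optimality p D

  Solved : State → Set
  Solved σ = ∃ λ (o : Orientation G) → Optimal {G} p o × Represents σ o

  solveTime : ℕ
  solveTime = (2 + (2 + N * (2 + forwardStepTime K))) + ((2 + (4 + N * (4 + backwardStepTime K))) + (2 + (4 + #e * (4 + 17))))

  module _ {τ : State} (s : Same prepare σ₀ τ) (prep : Prepared τ) where
    open Prepared prep
    open Explored explored
    open Order explored closed

    private
      t = scalar τ $t
      Q = array τ %queue

    earlier-parent : ∀ k → k < t → k ≢ 0 → ∃ λ j → j < k × array τ %parent (Q k) ≡ Q j
    earlier-parent k k<t k≢0 = let j , j<k , p≡ , _ = parents k k<t k≢0 in j , j<k , p≡

    open Search first second weight #v S N #e K N<S edgesAt (λ i _ → unique-bagEdges (vertices i)) edgesAt-short edgesAt<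
      (λ e e< → first< e e< , second< e e<) edgesAt-N t Q (array τ %parent) (λ j j<t → proj₁ (queue j j<t)) queue-injective
      (trans (cong (array τ %parent) root) top) earlier-parent separated
      using (Env; env-same; run-forward; run-backward; Solution)

    env : Env τ
    env = record
      { ready = record
        { inst = record { first≡ = arrays s %end₁ ; second≡ = arrays s %end₂ ; weight≡ = arrays s %weight ; #v≡ = scalars s $V }
        ; stride = stride
        ; rows   = λ i i≤N → Table.rows table i (≤-<-trans i≤N N<S)
        ; mul    = mul
        ; member = λ i i≤N → Table.flags table i (≤-<-trans i≤N N<S)
        }
      ; t≡ = refl ; queue≡ = refl ; parent≡ = refl }

    optimal : ∀ {ω} → Solution ω → Optimal {G} p (orient ω)
    optimal {ω} solution o′ = makespan≤ ω (makespan {G} p o′) λ i →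
      subst (λ x → peak (edgesAt x) ω ≤ makespan {G} p o′) (at-rank i)
        (solution (choice o′) (makespan {G} p o′) (peak≤makespan o′) (rank i) (rank< i))
      where open Loads first second weight #v

    run-solve : Run solve τ solveTime Solved
    run-solve =
      slower (loop≤ 2 (2 + forwardStepTime K))
        (run-forward env (unwritten (arrays s %bit)) (λ x _ → cong-app (arrays s %load) x)
          (cong-app (arrays s %cost)) (cong-app (arrays s %msg))) then-run λ s₁ (fw , zeros) →
      let r₁ = s ▹ s₁ in
      slower (loop≤ 4 (4 + backwardStepTime K))
        (run-backward (env-same s₁ env) nonempty fw zeros (cong-app (arrays r₁ %fixed))) then-run λ s₂ (ω , fixed , solution) →
      let r₂ = r₁ ▹ s₂ in
      weaken ≤-refl (run-writeOutput (scalars r₂ $E) fixed) λ _ written →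
        orient ω , optimal solution , λ e →
          trans (written (toℕ e) (Finₚ.toℕ<n e))
            (trans (cong₂ (λ A B → if ω (toℕ e) then B (toℕ e) else A (toℕ e)) (arrays r₂ %end₁) (arrays r₂ %end₂)) (target-at ω e))
      where
      loop≤ : ∀ c d → 2 + (c + t * d) ≤ 2 + (c + N * d)
      loop≤ c d = +-monoʳ-≤ 2 (+-monoʳ-≤ c (*-monoˡ-≤ d t≤N))
      unwritten : ∀ {A : ℕ → ℕ} → A ≡ (λ _ → 0) → Holds A none
      unwritten refl _ = refl

  run-balance : Run balance σ₀ (prepareTime + solveTime) Solved
  run-balance = run-prepare then-run run-solve

  -- A property of the tree alone, but its proof needs a search order; the one in the final state of
  -- `prepare` is at hand.
  tree-edges : ∀ {τ} → Prepared τ → m ≤ N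
  tree-edges prep = Order.m≤N (Prepared.explored prep) (Prepared.closed prep)

  run-solves : ∀ {b B} → b ≤ B → Run balance σ₀ b Solved → SolvesWithin balance G p D B
  run-solves b≤B (run {σ} {t} exec fast solved) = σ , t , exec , ≤-trans fast b≤B , solved

  solves : SolvesWithin balance G p D (2000 * U)
  solves = run-solves (total-bound #e≤NK (tree-edges (post run-prepare)) ≤-refl) run-balance

theorem3p2 :
    ∃ λ (P : Program) → ∃ λ (C : ℕ) →
      (G : Multigraph) (p : Weighting G) (D : TreeDecomposition G) →
      let w = width D ⊔ 1
          r = maxDegree G ⊔ 1
      in SolvesWithin P G p D (C * (2 ^ (2 * w * r) * (w * r) * #bags D))
theorem3p2 = balance , 2000 , λ G p D → Conclusion.solves p D
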